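{- Let $T_1$ and $T_2$ be trees with orders $m$ and $n$ and diameters $d_1\ge 2$ and $d_2\ge 2$, let $G=T_1\Box T_2$, $p=mn$, $d=d_1+d_2$ and $\xi=|W(T_1)|+|W(T_2)|-2$. Then ${\rm rn}(G)$ equals $$ \begin{cases} (p-1)(d+1)-2nL(T_1)-2mL(T_2)+1, & \text{if } |W(T_1)|=|W(T_2)|=1,\\ (p-1)d-2nL(T_1)-2mL(T_2), & \text{if } |W(T_1)|\cdot|W(T_2)|=2,\\ (p-1)(d-1)-2nL(T_1)-2mL(T_2)+1, & \text{if } |W(T_1)|=|W(T_2)|=2, \end{cases} $$ if and only if there exists a feasible ordering $(z_0,\ldots,z_{p-1})$ of $V(G)$ such that all of the following hold: (a) $L(z_0)+L(z_{p-1})=1$ when $|W(G)|=1$, and $L(z_0)+L(z_{p-1})=0$ when $|W(G)|\ge 2$; (b) $L(z_s)\le \frac{d+1-2\xi}{2}$ for all $0\le s\le p-1$, except when $|W(G)|=4$ and $s\in\{p/2-1,p/2\}$, in which case $L(z_s)\le\frac{d+3-2\xi}{2}$; (c) any two non-feasible vertices $z_a,z_b$ with $0\le a<b\le p-1$ satisfy $$\phi(z_a,z_b)\le (b-a-1)\Big(\frac{d+1-\xi}{2}\Big)-\sum_{t=a+1}^{b-1}L(z_t)-\frac{\xi-\delta(z_a,z_b)-1}{2}$$ if $|W(G)|=4$ and $\{p/2-1,p/2\}\subseteq\{a,a+1,\ldots,b\}$, and $$\phi(z_a,z_b)\le (b-a-1)\Big(\frac{d+1-\xi}{2}\Big)-\sum_{t=a+1}^{b-1}L(z_t)-\frac{\xi-\delta(z_a,z_b)}{2}$$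 otherwise. Moreover, if such an ordering satisfies (a), (b), (c), then the mapping $f$ defined by $f(z_0)=0$ and $f(z_{i+1})=f(z_i)+d+1-L(z_i)-L(z_{i+1})-\delta(z_i,z_{i+1})$ for $0\le i\le p-2$ is an optimal radio labeling of $G$ (i.e. a radio labeling of span ${\rm rn}(G)$).
   Context: All graphs are finite, simple and connected; $d(u,v)$ is the distance and ${\rm diam}(G)$ the diameter. A radio labeling of $G$ is a map $f:V(G)\to\mathbb{Z}_{\ge 0}$ with $|f(u)-f(v)|\geq {\rm diam}(G)+1-d(u,v)$ for all distinct $u,v$; its span is $\max f-\min f$, and ${\rm rn}(G)$ is the minimum span. For a graph $H$ and $v\in V(H)$, $w_H(v)=\sum_{u\in V(H)}d(u,v)$; weight centers minimize $w_H$, and $W(H)$ is their set. A tree $T$ has one or two weight centers, adjacent if two. The level is $L_T(u)=\min_{w\in W(T)}d(u,w)$ and $L(T)=\sum_u L_T(u)$. Root $T$ at its weight center(s): $u$ is an ancestor of $v$ if the unique path from $v$ to its nearest weight center passes through $u$ (every vertex is its own ancestor). $\phi_T(u,v)=\max\{L_T(z): z$ a common ancestor of $u,v\}$ (0 if none). $\delta_T(u,v)=1$ if $W(T)=\{w,w'\}$ and $u,v$ lie in different components of $T-ww'$, else $0$. For $G=T_1\Box T_2$ and $z=(x,y)$: $L(z)=L_{T_1}(x)+L_{T_2}(y)$, $\phi(z_a,z_b)=\phi_{T_1}(x_a,x_b)+\phi_{T_2}(y_a,y_b)$, $\delta(z_a,z_b)=\delta_{T_1}(x_a,x_b)+\delta_{T_2}(y_a,y_b)$.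 $W(G)=W(T_1)\times W(T_2)$. Vertices $z_a,z_b$ are feasible if $\phi(z_a,z_b)=0$ and $\delta(z_a,z_b)=\xi$ (different/opposite/separate sectors when $|W(G)|=1/2/4$), non-feasible otherwise. An ordering $(z_0,\ldots,z_{p-1})$ of $V(G)$ is feasible if $z_t,z_{t+1}$ are feasible for all $0\le t\le p-2$, except that when $|W(G)|=4$ and $t=p/2-1$ one instead requires $\phi(z_{p/2-1},z_{p/2})=0$ and $\delta(z_{p/2-1},z_{p/2})=1$. -}

module Defs where

open import Data.Bool using (Bool; true; false; T; _∧_; _∨_; not; if_then_else_)
open import Data.Nat as ℕ using (ℕ; zero; suc; _+_; _*_; _∸_; _≤_; _<_; _⊔_; _⊓_; _≡ᵇ_; _≤ᵇ_; ∣_-_∣)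
open import Data.Nat.DivMod using (_/_)
open import Data.Integer as ℤ using (ℤ; +_)
open import Data.Fin as Fin using (Fin; toℕ; remQuot)
open import Data.List using (List; []; _∷_; _∷ʳ_; length; map; foldr; allFin; filterᵇ)
open import Data.Nat.ListAction using (sum)
open import Data.Bool.ListAction using (any; all)
open import Data.List.Relation.Unary.Unique.Propositional using (Unique)
open import Data.List.Relation.Unary.Linked using (Linked)
open import Data.Product using (Σ; ∃; _×_; _,_; proj₁; proj₂)
open import Data.Sum using (_⊎_)
open import Relation.Nullary using (¬_)
open import Relation.Nullary.Decidable using (⌊_⌋)
open import Relation.Binary.PropositionalEquality using (_≡_; _≢_)
open import Function.Definitions using (Bijective)

Adj : ℕ → Set
Adj N = Fin N → Fin N → Bool

module _ {N : ℕ} where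

  _==_ : Fin N → Fin N → Bool
  u == v = ⌊ u Fin.≟ v ⌋

  sumOver : (Fin N → ℕ) → ℕ
  sumOver f = sum (map f (allFin N))

  maxOver : (Fin N → ℕ) → ℕ
  maxOver f = foldr (λ v acc → f v ⊔ acc) 0 (allFin N)

  -- minimum over all vertices (the default maxOver f is ≥ every value)
  minOver : (Fin N → ℕ) → ℕ
  minOver f = foldr (λ v acc → f v ⊓ acc) (maxOver f) (allFin N)

  IsSimple : Adj N → Set
  IsSimple A = (∀ u v → A u v ≡ A v u) × (∀ u → A u u ≡ false)

  data Walk (A : Adj N) : Fin N → Fin N → Set where
    here : ∀ {u} → Walk A u u
    step : ∀ {u w v} → T (A u w) → Walk A w v → Walk A u v

  Connected : Adj N → Set
  Connected A = ∀ u v → Walk A u v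

  HasCycle : Adj N → Set
  HasCycle A = Σ (Fin N) λ x → Σ (List (Fin N)) λ ys →
    (2 ≤ length ys) × Unique (x ∷ ys) × Linked (λ a b → T (A a b)) ((x ∷ ys) ∷ʳ x)

  IsTree : Adj N → Set
  IsTree A = IsSimple A × Connected A × ¬ HasCycle A

  reachIn : Adj N → ℕ → Fin N → Fin N → Bool
  reachIn A zero    u v = u == v
  reachIn A (suc k) u v = reachIn A k u v ∨ any (λ w → reachIn A k u w ∧ A w v) (allFin N)

  -- least k in [from, from+fuel) with P k, or from+fuel if none
  search : (ℕ → Bool) → ℕ → ℕ → ℕ
  search P from zero       = from
  search P from (suc fuel) = if P from then from else search P (suc from) fuel

  -- distance: least length of a walk (every distance in a connected graph
  -- on N vertices is < N)
  dist : Adj N → Fin N → Fin N → ℕ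
  dist A u v = search (λ k → reachIn A k u v) 0 N

  diam : Adj N → ℕ
  diam A = maxOver (λ u → maxOver (λ v → dist A u v))

  weight : Adj N → Fin N → ℕ
  weight A v = sumOver (λ u → dist A u v)

  isWC : Adj N → Fin N → Bool
  isWC A v = all (λ u → weight A v ≤ᵇ weight A u) (allFin N)

  WC : Adj N → List (Fin N)
  WC A = filterᵇ (isWC A) (allFin N)

  nW : Adj N → ℕ
  nW A = length (WC A)

  level : Adj N → Fin N → ℕ
  level A u = foldr (λ w acc → dist A u w ⊓ acc) N (WC A)

  totLevel : Adj N → ℕ
  totLevel A = sumOver (level A)

  -- u is an ancestor of v: u lies on the (geodesic) path from v to a
  -- nearest weight center w of v
  isAnc : Adj N → Fin N → Fin N → Bool
  isAnc A u v = any (λ w → (dist A v w ≡ᵇ level A v) ∧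
                           (dist A v u + dist A u w ≡ᵇ dist A v w)) (WC A)

  phiT : Adj N → Fin N → Fin N → ℕ
  phiT A u v = maxOver (λ z → if isAnc A z u ∧ isAnc A z v then level A z else 0)

  delEdge : Adj N → Fin N → Fin N → Adj N
  delEdge A w w' x y = A x y ∧ not ((x == w ∧ y == w') ∨ (x == w' ∧ y == w))

  deltaT : Adj N → Fin N → Fin N → ℕ
  deltaT A u v with WC A
  ... | w ∷ w' ∷ [] = if reachIn (delEdge A w w') N u v then 0 else 1
  ... | _           = 0

  IsRadio : Adj N → (Fin N → ℕ) → Set
  IsRadio A f = ∀ u v → u ≢ v → diam A + 1 ≤ ∣ f u - f v ∣ + dist A u v

  spanL : (Fin N → ℕ) → ℕ
  spanL f = maxOver f ∸ minOver f

  IsRn : Adj N → ℤ → Set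
  IsRn A r = (Σ (Fin N → ℕ) λ f → IsRadio A f × (+ spanL f ≡ r))
           × (∀ f → IsRadio A f → r ℤ.≤ + spanL f)

prod : ∀ {m n} → Adj m → Adj n → Adj (m * n)
prod {m} {n} A B z z' with remQuot {m} n z | remQuot {m} n z'
... | (x , y) | (x' , y') = (A x x' ∧ (y == y')) ∨ ((x == x') ∧ B y y')

-- the value in the three cases of the theorem (last clause unreachable
-- for trees, which have 1 or 2 weight centers)
rnCases : ℕ → ℕ → ℤ → ℤ → ℤ → ℤ
rnCases 1 1 v₁ v₂ v₃ = v₁
rnCases 1 2 v₁ v₂ v₃ = v₂
rnCases 2 1 v₁ v₂ v₃ = v₂
rnCases 2 2 v₁ v₂ v₃ = v₃
rnCases _ _ v₁ v₂ v₃ = + 0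

module Prod {m n : ℕ} (A : Adj m) (B : Adj n) where

  p : ℕ
  p = m * n

  G : Adj p
  G = prod A B

  x_ : Fin p → Fin m
  x_ z = proj₁ (remQuot {m} n z)

  y_ : Fin p → Fin n
  y_ z = proj₂ (remQuot {m} n z)

  LG : Fin p → ℕ
  LG z = level A (x_ z) + level B (y_ z)

  phiG : Fin p → Fin p → ℕ
  phiG a b = phiT A (x_ a) (x_ b) + phiT B (y_ a) (y_ b)

  deltaG : Fin p → Fin p → ℕ
  deltaG a b = deltaT A (x_ a) (x_ b) + deltaT B (y_ a) (y_ b)

  d : ℕ
  d = diam A + diam B

  ξ : ℤ
  ξ = (+ nW A ℤ.+ + nW B) ℤ.- + 2

  nWG : ℕ
  nWG = nW G

  half : ℕ
  half = p / 2

  rnValue : ℤ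
  rnValue = rnCases (nW A) (nW B)
    (((+ (p ∸ 1)) ℤ.* (+ (d + 1)) ℤ.- + (2 * n * totLevel A) ℤ.- + (2 * m * totLevel B)) ℤ.+ + 1)
    ((+ (p ∸ 1)) ℤ.* (+ d) ℤ.- + (2 * n * totLevel A) ℤ.- + (2 * m * totLevel B))
    (((+ (p ∸ 1)) ℤ.* ((+ d) ℤ.- + 1) ℤ.- + (2 * n * totLevel A) ℤ.- + (2 * m * totLevel B)) ℤ.+ + 1)

  Feasible : Fin p → Fin p → Set
  Feasible a b = (phiG a b ≡ 0) × (+ deltaG a b ≡ ξ)

  Middle : ℕ → Set
  Middle t = (nWG ≡ 4) × (t ≡ half ∸ 1)

  FeasibleOrdering : (Fin p → Fin p) → Set
  FeasibleOrdering z = Bijective _≡_ _≡_ z ×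
    (∀ (a b : Fin p) → toℕ b ≡ suc (toℕ a) →
       (Middle (toℕ a) → (phiG (z a) (z b) ≡ 0) × (deltaG (z a) (z b) ≡ 1)) ×
       (¬ Middle (toℕ a) → Feasible (z a) (z b)))

  CondA : (Fin p → Fin p) → Set
  CondA z = ∀ (i j : Fin p) → toℕ i ≡ 0 → toℕ j ≡ p ∸ 1 →
    (nWG ≡ 1 → LG (z i) + LG (z j) ≡ 1) × (2 ≤ nWG → LG (z i) + LG (z j) ≡ 0)

  -- (b), both sides multiplied by 2
  CondB : (Fin p → Fin p) → Set
  CondB z = ∀ (s : Fin p) →
    let E = (nWG ≡ 4) × ((toℕ s ≡ half ∸ 1) ⊎ (toℕ s ≡ half)) in
    (E → + (2 * LG (z s)) ℤ.≤ (+ (d + 3)) ℤ.- + 2 ℤ.* ξ) ×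
    (¬ E → + (2 * LG (z s)) ℤ.≤ (+ (d + 1)) ℤ.- + 2 ℤ.* ξ)

  innerSum : (Fin p → Fin p) → Fin p → Fin p → ℕ
  innerSum z a b = sumOver (λ t → if (toℕ a ℕ.<ᵇ toℕ t) ∧ (toℕ t ℕ.<ᵇ toℕ b) then LG (z t) else 0)

  -- (c), both sides multiplied by 2
  CondC : (Fin p → Fin p) → Set
  CondC z = ∀ (a b : Fin p) → toℕ a < toℕ b → ¬ Feasible (z a) (z b) →
    let k  = toℕ b ∸ toℕ a ∸ 1
        R  = (+ k) ℤ.* ((+ (d + 1)) ℤ.- ξ) ℤ.- + (2 * innerSum z a b)
        δ  = + deltaG (z a) (z b)
        E  = (nWG ≡ 4) × (toℕ a ≤ half ∸ 1) × (half ≤ toℕ b)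
    in (E → + (2 * phiG (z a) (z b)) ℤ.≤ R ℤ.- ((ξ ℤ.- δ) ℤ.- + 1)) ×
       (¬ E → + (2 * phiG (z a) (z b)) ℤ.≤ R ℤ.- (ξ ℤ.- δ))

  RecLabel : (Fin p → Fin p) → (Fin p → ℕ) → Set
  RecLabel z f = (∀ (i : Fin p) → toℕ i ≡ 0 → f (z i) ≡ 0) ×
    (∀ (a b : Fin p) → toℕ b ≡ suc (toℕ a) →
       + f (z b) ≡ ((((+ f (z a) ℤ.+ + (d + 1)) ℤ.- + LG (z a)) ℤ.- + LG (z b)) ℤ.- + deltaG (z a) (z b)))

{-# OPTIONS --safe #-}

-- In a tree every vertex has exactly one neighbour closer to a given root and none at equal
-- distance, so medians exist, and d(u,v) = L(u) + L(v) - 2φ(u,v) + δ(u,v). Summing this over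
-- consecutive vertices of the ordering of the product by increasing labels gives
--   span = (p-1)(d+1-ξ) - 2L(G) + L(z_0) + L(z_{p-1}) + Σ (2φ + (ξ-δ) + slack),
-- where slack is the surplus of a step in the radio inequality. For four weight centres some step
-- must have δ < ξ: otherwise the ordering would stay in one pair of opposite sectors, and the two
-- halves of a tree with two weight centres have equal size. In the case of equality there is exactly
-- one such step, and equal sizes force it into the middle. All other steps are then determined, and
-- the radio inequality for a pair of vertices, summed along the ordering, becomes condition (c),
-- while (b) is its instance for two vertices at distance two in the ordering.

module Submission where

open import Defs
open import Data.Bool as Bool using (Bool; true; false; T; _∧_; _∨_; _xor_; not; if_then_else_)
open import Data.Bool.ListAction using (any)
open import Data.Bool.Properties using (T-∧; T-∨; T-≡; T?)
open import Data.Empty using (⊥-elim)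
open import Data.Fin as Fin using (Fin; toℕ; fromℕ<; remQuot; combine)
import Data.Fin.Properties as Finₚ
open import Data.Integer using (+_)
import Data.Integer as ℤ
import Data.Integer.Properties as ℤₚ
import Data.Integer.Tactic.RingSolver as ℤRing
open import Data.List using (List; []; _∷_; _∷ʳ_; length; foldr; allFin; tabulate; filterᵇ)
-- Several imports overload _∷_; the variable lists of solve need an unambiguous one.
open import Data.List using () renaming (_∷_ to _⨟_)
open import Data.List.Membership.Propositional using (_∈_)
open import Data.List.Membership.Propositional.Properties using (∈-allFin; ∈-filter⁺; ∈-filter⁻)
import Data.List.Properties as Listₚ
open import Data.List.Relation.Unary.All as All using (All; []; _∷_)
import Data.List.Relation.Unary.All.Properties as Allₚ
open import Data.List.Relation.Unary.AllPairs using ([]; _∷_)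
import Data.List.Relation.Unary.AllPairs.Properties as AllPairsₚ
open import Data.List.Relation.Unary.Any as Any using (Any)
import Data.List.Relation.Unary.Any.Properties as Anyₚ
open import Data.List.Relation.Unary.Linked using (Linked; []; [-]; _∷_)
open import Data.List.Relation.Unary.Unique.Propositional using (Unique)
import Data.List.Relation.Unary.Unique.Propositional.Properties as Uniqueₚ
open import Data.Nat hiding (parity)
open import Data.Nat.DivMod using (m*n/n≡m; m/n<m; m≥n⇒m/n>0)
import Data.Nat.ListAction
open import Data.Nat.Properties
open import Data.Nat.Tactic.RingSolver using (solve; solve-∀)
open import Data.Product using (Σ; ∃-syntax; _×_; _,_; proj₁; proj₂)
open import Data.Sum using (_⊎_; inj₁; inj₂; [_,_]′)
open import Data.Unit using (tt)
open import Function using (_∘_; id; case_of_)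
open import Function.Bundles using (_⇔_; mk⇔; mk⤖; module Equivalence)
open import Function.Definitions using (Bijective; Injective)
open import Function.Properties.Bijection using (⤖⇒↔)
open import Relation.Binary.Definitions using (tri<; tri≈; tri>)
open import Relation.Binary.PropositionalEquality
open import Relation.Nullary using (¬_; Dec; yes; no; contradiction)
open import Relation.Nullary.Decidable using (toWitness; fromWitness; from-yes; map′; _×-dec_; _→-dec_)
open import Algebra.Properties.CommutativeMonoid.Sum +-0-commutativeMonoid
  using (sum; sum-cong-≗; ∑-distrib-+; sum-permute)

-- Walks and distances

-- With four weight centres, call the exclusive or of the two sides of a vertex its parity. A step
-- with `δ = 2` changes both sides and keeps the parity, a step with `δ = 1` reverses it, and each
-- parity class contains half of the vertices. Hence the steps cannot all have `δ = 2`, and a single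
-- step with `δ = 1` cuts the ordering into two runs of equal length. That step costs `ξ - δ = 1`,
-- which in the case of equality leaves neither slack nor a positive `φ`. This unit is the `+ 1` in
-- the third value of the span, and the exceptions in (b) and (c) record whether it falls between
-- the positions concerned. The `+ 1` for a single weight centre has another origin: only one vertex
-- has level zero, so the end levels add up to at least one. All cases are therefore treated at
-- once, with `e₀` for the least sum of the end levels and `four` for the presence of the middle
-- step. The conditions contain integer differences; every subtracted term is moved to the side
-- where it is added, which leaves inequalities between natural numbers.

private
  variable
    N : ℕ

  to : ∀ {a b} {A : Set a} {B : Set b} → A ⇔ B → A → B
  to = Equivalence.to

  from : ∀ {a b} {A : Set a} {B : Set b} → A ⇔ B → B → A
  from = Equivalence.from

==⇒≡ : {u v : Fin N} → T (u == v) → u ≡ v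
==⇒≡ = toWitness

≡⇒== : {u v : Fin N} → u ≡ v → T (u == v)
≡⇒== = fromWitness

any-intro : (P : Fin N → Bool) (w : Fin N) → T (P w) → T (any P (allFin N))
any-intro P w Pw = Anyₚ.any⁺ P (Any.map (λ { refl → Pw }) (∈-allFin w))

any-elim : (P : Fin N → Bool) → T (any P (allFin N)) → ∃[ w ] T (P w)
any-elim P h = Any.satisfied (Anyₚ.any⁻ P (allFin _) h)

-- Grows at its far end, as `reachIn` does, whereas `Walk` grows at its near end; the length is an
-- index so that it can be compared with `dist`.
data Path (A : Adj N) (u : Fin N) : ℕ → Fin N → Set where
  nil  : Path A u 0 u
  snoc : ∀ {k w v} → Path A u k w → T (A w v) → Path A u (suc k) v

module _ {N : ℕ} {A : Adj N} where

  cons : ∀ {k u w v} → T (A u w) → Path A w k v → Path A u (suc k) v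
  cons e nil        = snoc nil e
  cons e (snoc p f) = snoc (cons e p) f

  _◅◅_ : ∀ {k l u w v} → Path A u k w → Path A w l v → Path A u (l + k) v
  p ◅◅ nil      = p
  p ◅◅ snoc q e = snoc (p ◅◅ q) e

  walk⇒path : ∀ {u v} → Walk A u v → ∃[ k ] Path A u k v
  walk⇒path here       = 0 , nil
  walk⇒path (step e w) = _ , cons e (proj₂ (walk⇒path w))

  reachIn-mono : ∀ {k l u v} → k ≤ l → T (reachIn A k u v) → T (reachIn A l u v)
  reachIn-mono {k} {l} k≤l h with ≤⇒≤′ k≤l
  ... | ≤′-refl     = h
  ... | ≤′-step k≤′ = from T-∨ (inj₁ (reachIn-mono (≤′⇒≤ k≤′) h))

  path⇒reachIn : ∀ {k u v} → Path A u k v → T (reachIn A k u v)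
  path⇒reachIn nil = ≡⇒== refl
  path⇒reachIn (snoc {w = w} p e) =
    from T-∨ (inj₂ (any-intro _ w (from T-∧ (path⇒reachIn p , e))))

  reachIn⇒path : ∀ k {u v} → T (reachIn A k u v) → ∃[ j ] j ≤ k × Path A u j v
  reachIn⇒path zero    h rewrite ==⇒≡ h = 0 , z≤n , nil
  reachIn⇒path (suc k) h with to T-∨ h
  ... | inj₁ h′ = let j , j≤k , p = reachIn⇒path k h′ in j , m≤n⇒m≤1+n j≤k , p
  ... | inj₂ h′ = let w , e = any-elim (λ w → reachIn A k _ w ∧ A w _) h′
                      e₁ , e₂ = to T-∧ e
                      j , j≤k , p = reachIn⇒path k e₁
                  in suc j , s≤s j≤k , snoc p e₂

module _ {N : ℕ} (P : ℕ → Bool) where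

  search-least : ∀ s fuel j → s ≤ j → T (P j) → search {N} P s fuel ≤ j
  search-least s zero j s≤j _ = s≤j
  search-least s (suc fuel) j s≤j Pj with P s in eq
  ... | true  = s≤j
  ... | false with m≤n⇒m<n∨m≡n s≤j
  ...   | inj₁ s<j  = search-least (suc s) fuel j s<j Pj
  ...   | inj₂ refl = contradiction (subst T eq Pj) id

  -- A failed search returns `s + fuel`, so a result strictly below it certifies a hit.
  search-found : ∀ s fuel → search {N} P s fuel < s + fuel → T (P (search {N} P s fuel))
  search-found s zero h = contradiction (subst (s <_) (+-identityʳ s) h) (<-irrefl refl)
  search-found s (suc fuel) h with P s in eq
  ... | true  = subst T (sym eq) tt
  ... | false = search-found (suc s) fuel (subst (search {N} P (suc s) fuel <_) (+-suc s fuel) h)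

module _ {N : ℕ} {A : Adj N} where

  -- Phrased by path lengths instead of `dist`, whose search stops at `N`: the bound `k < N` must be
  -- known before `dist` is known to find anything.
  Shortest : ℕ → Fin N → Fin N → Set
  Shortest k u v = Path A u k v × (∀ j → Path A u j v → k ≤ j)

  path⇒shortest : ∀ {k u v} → Path A u k v → ∃[ j ] j ≤ k × Shortest j u v
  path⇒shortest {k} {u} {v} p =
    j , j≤k , subst (λ i → Path A u i v) (sym j≡i) q , least
    where
    P = λ i → reachIn A i u v
    j = search {N} P 0 (suc k)
    j≤k : j ≤ k
    j≤k = search-least {N} P 0 (suc k) k z≤n (path⇒reachIn p)
    found = reachIn⇒path j (search-found {N} P 0 (suc k) (s≤s j≤k))
    i = proj₁ found
    q = proj₂ (proj₂ found)
    least : ∀ l → Path A u l v → j ≤ l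
    least l r = search-least {N} P 0 (suc k) l z≤n (path⇒reachIn r)
    j≡i : j ≡ i
    j≡i = ≤-antisym (least i q) (proj₁ (proj₂ found))

  shortest-prefix : ∀ {k u v i} → Shortest k u v → i ≤ k → ∃[ x ] Shortest i u x
  shortest-prefix {k} {v = v} s i≤k with m≤n⇒m<n∨m≡n i≤k
  ... | inj₂ refl = v , s
  shortest-prefix (snoc p e , min) _ | inj₁ i<k =
    shortest-prefix (p , λ j q → s≤s⁻¹ (min (suc j) (snoc q e))) (s≤s⁻¹ i<k)

  -- The vertices at distance 0, …, k from u on a shortest path are distinct.
  shortest<N : ∀ {k u v} → Shortest k u v → k < N
  shortest<N {k} {u} s = Finₚ.injective⇒≤ {f = λ i → proj₁ (x i)} inj
    where
    x : (i : Fin (suc k)) → ∃[ y ] Shortest (toℕ i) u y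
    x i = shortest-prefix s (s≤s⁻¹ (Finₚ.toℕ<n i))
    inj : ∀ {i j} → proj₁ (x i) ≡ proj₁ (x j) → i ≡ j
    inj {i} {j} eq with x i | x j
    ... | y , p , minp | y′ , q , minq with refl ← eq =
      Finₚ.toℕ-injective (≤-antisym (minp _ q) (minq _ p))

  -- Holds without connectedness, because `deltaT` tests reachability within `N` steps in a tree
  -- with an edge removed.
  path⇒reachIn-N : ∀ {k u v} → Path A u k v → T (reachIn A N u v)
  path⇒reachIn-N p = let j , _ , s = path⇒shortest p
                     in reachIn-mono (<⇒≤ (shortest<N s)) (path⇒reachIn (proj₁ s))

  dist-≤ : ∀ {k u v} → Path A u k v → dist A u v ≤ k
  dist-≤ p = search-least {N} _ 0 N _ z≤n (path⇒reachIn p)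

  path⇒dist-path : ∀ {k u v} → Path A u k v → Path A u (dist A u v) v × dist A u v < N
  path⇒dist-path {k} {u} {v} p = subst (λ i → Path A u i v) (sym d≡j) r , d<N
    where
    s   = path⇒shortest p
    d<N : dist A u v < N
    d<N = ≤-<-trans (dist-≤ (proj₁ (proj₂ (proj₂ s)))) (shortest<N (proj₂ (proj₂ s)))
    f   = reachIn⇒path (dist A u v) (search-found {N} _ 0 N d<N)
    j   = proj₁ f
    r   = proj₂ (proj₂ f)
    d≡j : dist A u v ≡ j
    d≡j = ≤-antisym (dist-≤ r) (proj₁ (proj₂ f))

module Metric {N : ℕ} (A : Adj N) (simple : IsSimple A) (conn : Connected A) where

  -- Opaque, so that the search defining dist is never unfolded.
  opaque
    D : Fin N → Fin N → ℕ
    D = dist A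

    D≡dist : ∀ u v → D u v ≡ dist A u v
    D≡dist u v = refl

    D-≤ : ∀ {k u v} → Path A u k v → D u v ≤ k
    D-≤ = dist-≤

    geodesic : ∀ u v → Path A u (D u v) v
    geodesic u v = proj₁ (path⇒dist-path (proj₂ (walk⇒path (conn u v))))

    D<N : ∀ u v → D u v < N
    D<N u v = proj₂ (path⇒dist-path (proj₂ (walk⇒path (conn u v))))

    D-refl : ∀ u → D u u ≡ 0
    D-refl u = n≤0⇒n≡0 (D-≤ nil)

  flip-edge : ∀ {u v} → T (A u v) → T (A v u)
  flip-edge {u} {v} = subst T (proj₁ simple u v)

  edge-≢ : ∀ {u v} → T (A u v) → u ≢ v
  edge-≢ {u} e refl = subst T (proj₂ simple u) e

  reverse : ∀ {k u v} → Path A u k v → Path A v k u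
  reverse nil        = nil
  reverse (snoc p e) = cons (flip-edge e) (reverse p)

  D-sym : ∀ u v → D u v ≡ D v u
  D-sym u v = ≤-antisym (D-≤ (reverse (geodesic v u))) (D-≤ (reverse (geodesic u v)))

  triangle : ∀ u w v → D u v ≤ D u w + D w v
  triangle u w v =
    ≤-trans (D-≤ (geodesic u w ◅◅ geodesic w v)) (≤-reflexive (+-comm (D w v) (D u w)))

  D≡0⇒≡ : ∀ {u v} → D u v ≡ 0 → u ≡ v
  D≡0⇒≡ {u} {v} eq with nil ← subst (λ i → Path A u i v) eq (geodesic u v) = refl

  D-edge : ∀ {u v} → T (A u v) → D u v ≡ 1
  D-edge {u} {v} e with D u v in eq | D-≤ (snoc nil e)
  ... | zero        | _ = contradiction (D≡0⇒≡ eq) (edge-≢ e)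
  ... | suc zero    | _ = refl
  ... | suc (suc _) | s≤s ()

  edge-≤ : ∀ {w v} u → T (A w v) → D u v ≤ suc (D u w)
  edge-≤ u e = D-≤ (snoc (geodesic u _) e)

  predecessor : ∀ {u v k} → D u v ≡ suc k → ∃[ w ] T (A w v) × D u w ≡ k
  predecessor {u} {v} {k} eq with subst (λ i → Path A u i v) eq (geodesic u v)
  ... | snoc {w = w} p e = w , e ,
    ≤-antisym (D-≤ p) (s≤s⁻¹ (subst (_≤ suc (D u w)) eq (edge-≤ u e)))

-- Distances in trees

linked-∷ʳ : ∀ {a} {X : Set a} {R : X → X → Set} xs {y z} →
            Linked R (xs ∷ʳ y) → R y z → Linked R ((xs ∷ʳ y) ∷ʳ z)
linked-∷ʳ []           [-]       Ryz = Ryz ∷ [-]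
linked-∷ʳ (_ ∷ [])     (Rx ∷ Rs) Ryz = Rx ∷ linked-∷ʳ [] Rs Ryz
linked-∷ʳ (_ ∷ x ∷ xs) (Rx ∷ Rs) Ryz = Rx ∷ linked-∷ʳ (x ∷ xs) Rs Ryz

unique-∷ʳ : ∀ {a} {X : Set a} {xs : List X} {y} →
            Unique xs → All (_≢ y) xs → Unique (xs ∷ʳ y)
unique-∷ʳ uxs ≢y = AllPairsₚ.++⁺ uxs ([] ∷ []) (All.map (_∷ []) ≢y)

module Tree {N : ℕ} (A : Adj N) (tree : IsTree A) where

  open Metric A (proj₁ tree) (proj₁ (proj₂ tree)) public

  acyclic : ¬ HasCycle A
  acyclic = proj₂ (proj₂ tree)

  Edge : Fin N → Fin N → Set
  Edge a b = T (A a b)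

  below-≢ : ∀ r {x y k} → D r x ≤ k → D r y ≡ suc k → x ≢ y
  below-≢ r x≤k y≡ refl = <-irrefl refl (≤-trans (≤-reflexive (sym y≡)) x≤k)

  -- Descend from c and d to their predecessors until these meet: every way of closing up
  -- the resulting simple path is a cycle.
  chain : ∀ r k {c d} → D r c ≡ suc k → D r d ≡ suc k → c ≢ d →
          ∃[ L ] 1 ≤ length L × All (λ x → D r x ≤ k) L × Unique L × Linked Edge (c ∷ (L ∷ʳ d))
  chain r k {c} {d} c≡ d≡ c≢d
    with predecessor c≡ | predecessor d≡
  ... | a , ac , a≡ | b , bd , b≡ with a Fin.≟ b
  ...   | yes refl = a ∷ [] , s≤s z≤n , ≤-reflexive a≡ ∷ [] , [] ∷ [] , flip-edge ac ∷ bd ∷ [-]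
  chain r zero _ _ _ | a , ac , a≡ | b , bd , b≡ | no a≢b =
    contradiction (trans (sym (D≡0⇒≡ a≡)) (D≡0⇒≡ b≡)) a≢b
  chain r (suc k) _ _ _ | a , ac , a≡ | b , bd , b≡ | no a≢b
    with chain r k a≡ b≡ a≢b
  ... | L , _ , L≤ , uL , linked =
    a ∷ (L ∷ʳ b) , s≤s z≤n ,
    ≤-reflexive a≡ ∷ Allₚ.∷ʳ⁺ (All.map m≤n⇒m≤1+n L≤) (≤-reflexive b≡) ,
    Allₚ.∷ʳ⁺ (All.map (λ x≤k → ≢-sym (below-≢ r x≤k a≡)) L≤) a≢b
      ∷ unique-∷ʳ uL (All.map (λ x≤k → below-≢ r x≤k b≡) L≤) ,
    flip-edge ac ∷ linked-∷ʳ (a ∷ L) linked bd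

  2≤length-∷ʳ : ∀ (L : List (Fin N)) {b} → 1 ≤ length L → 2 ≤ length (L ∷ʳ b)
  2≤length-∷ʳ L {b} 1≤ = ≤-trans (≤-trans (s≤s 1≤) (≤-reflexive (+-comm 1 (length L))))
                               (≤-reflexive (sym (Listₚ.length-++ L)))

  -- Trees are bipartite: an edge inside a level closes the path that `chain` finds below that
  -- level.
  no-level-edge : ∀ r {c d} → Edge c d → D r c ≢ D r d
  no-level-edge r {c} {d} cd eq with D r d in d≡
  ... | zero  = edge-≢ cd (trans (sym (D≡0⇒≡ eq)) (D≡0⇒≡ d≡))
  ... | suc k with chain r k eq d≡ (edge-≢ cd)
  ...   | L , 1≤ , L≤ , uL , linked = acyclic
    (c , L ∷ʳ d , 2≤length-∷ʳ L 1≤ ,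
     Allₚ.∷ʳ⁺ (All.map (λ x≤k → ≢-sym (below-≢ r x≤k eq)) L≤) (edge-≢ cd)
       ∷ unique-∷ʳ uL (All.map (λ x≤k → below-≢ r x≤k d≡) L≤) ,
     linked-∷ʳ (c ∷ L) linked (flip-edge cd))

  -- Two different predecessors are joined by a path from `chain` that stays below `c`, and `c`
  -- completes it to a cycle.
  unique-pred : ∀ r {a b c} → Edge a c → Edge b c →
                D r c ≡ suc (D r a) → D r c ≡ suc (D r b) → a ≡ b
  unique-pred r {a} {b} {c} ac bc a≡ b≡ with a Fin.≟ b
  ... | yes a≡b = a≡b
  ... | no a≢b with D r a in a≡k | suc-injective (trans (sym b≡) a≡)
  ...   | zero  | ba = trans (sym (D≡0⇒≡ a≡k)) (D≡0⇒≡ ba)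
  ...   | suc k | ba with chain r k a≡k ba a≢b
  ...     | L , 1≤ , L≤ , uL , linked = ⊥-elim (acyclic
    (c , a ∷ (L ∷ʳ b) , s≤s (≤-trans (s≤s z≤n) (2≤length-∷ʳ L 1≤)) ,
     (≢-sym (edge-≢ ac) ∷ Allₚ.∷ʳ⁺ (All.map (λ x≤k → ≢-sym (below-≢ r (m≤n⇒m≤1+n x≤k) (trans a≡ (cong suc a≡k)))) L≤)
                                    (≢-sym (edge-≢ bc)))
       ∷ Allₚ.∷ʳ⁺ (All.map (λ x≤k → ≢-sym (below-≢ r x≤k a≡k)) L≤) a≢b
       ∷ unique-∷ʳ uL (All.map (λ x≤k → below-≢ r x≤k ba) L≤) ,
     flip-edge ac ∷ linked-∷ʳ (a ∷ L) linked bc))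

  edge-levels : ∀ r {u v} → Edge u v → D r v ≡ suc (D r u) ⊎ D r u ≡ suc (D r v)
  edge-levels r {u} {v} e with <-cmp (D r u) (D r v)
  ... | tri< u<v _ _ = inj₁ (≤-antisym (edge-≤ r e) u<v)
  ... | tri≈ _ eq _  = contradiction eq (no-level-edge r e)
  ... | tri> _ _ v<u = inj₂ (≤-antisym (edge-≤ r (flip-edge e)) v<u)

  Between : Fin N → Fin N → Fin N → Set
  Between a b c = D a b + D b c ≡ D a c

  between-≤ : ∀ {a b c} → D a b + D b c ≤ D a c → Between a b c
  between-≤ {a} {b} {c} h = ≤-antisym h (triangle a b c)

  between-end : ∀ a b → Between a b b
  between-end a b = trans (cong (λ x → D a b + x) (D-refl b)) (+-identityʳ (D a b))

  between-extend : ∀ {a b c c′} → Between a b c → Edge c c′ → D a c′ ≡ suc (D a c) → Between a b c′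
  between-extend {a} {b} {c} {c′} abc cc′ eq = between-≤ (begin
    D a b + D b c′       ≤⟨ +-monoʳ-≤ (D a b) (edge-≤ b cc′) ⟩
    D a b + suc (D b c)  ≡⟨ +-suc (D a b) (D b c) ⟩
    suc (D a b + D b c)  ≡⟨ cong suc abc ⟩
    suc (D a c)          ≡⟨ eq ⟨
    D a c′               ∎)
    where open ≤-Reasoning

  between-retract : ∀ {a b c c′} → Between a b c → Edge c′ c → D b c ≡ suc (D b c′) →
                    D a c ≡ suc (D a c′)
  between-retract {a} {b} {c} {c′} abc c′c eq = ≤-antisym (edge-≤ a c′c) (begin
    suc (D a c′)          ≤⟨ s≤s (triangle a b c′) ⟩
    suc (D a b + D b c′)  ≡⟨ +-suc (D a b) (D b c′) ⟨
    D a b + suc (D b c′)  ≡⟨ cong (λ x → D a b + x) eq ⟨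
    D a b + D b c         ≡⟨ abc ⟩
    D a c                 ∎)
    where open ≤-Reasoning

  step-toward : ∀ {z c} → z ≢ c → ∃[ x ] Edge x c × D z c ≡ suc (D z x)
  step-toward {z} {c} z≢c with D z c in eq
  ... | zero  = contradiction (D≡0⇒≡ eq) z≢c
  ... | suc j with predecessor eq
  ...   | x , xc , x≡ = x , xc , cong suc (sym x≡)

  Median : Fin N → Fin N → Fin N → Fin N → Set
  Median u v w z = Between w z u × Between w z v × Between v z u

  -- Induction along the geodesic from `v` to `u`. While `u` moves away from `w` the median stays;
  -- when `u` moves towards `w`, the median must have been the previous vertex and moves along.
  median-at : ∀ k u v w → D v u ≡ k → ∃[ z ] Median u v w z
  median-at zero u v w eq with refl ← D≡0⇒≡ eq = u , between-end w u , between-end w u , between-end u u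
  median-at (suc k) u v w eq with predecessor eq
  ... | u′ , u′u , u′≡ with median-at k u′ v w u′≡ | edge-levels w u′u
  ...   | z , wzu′ , wzv , vzu′ | inj₁ up =
    z , between-extend wzu′ u′u up , wzv ,
    between-extend vzu′ u′u (trans eq (cong suc (sym u′≡)))
  ...   | z , wzu′ , wzv , vzu′ | inj₂ down with z Fin.≟ u′
  ...     | yes refl = u , between-end w u , wuv , between-end v u
    where
    wuv : Between w u v
    wuv = begin
      D w u + D u v         ≡⟨ cong (λ x → D w u + x) (trans (D-sym u v) (trans eq (cong suc (sym u′≡)))) ⟩
      D w u + suc (D v u′)  ≡⟨ +-suc (D w u) (D v u′) ⟩
      suc (D w u) + D v u′  ≡⟨ cong₂ _+_ down (D-sym u′ v) ⟨
      D w u′ + D u′ v       ≡⟨ wzv ⟩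
      D w v                 ∎
      where open ≡-Reasoning
  -- Both `u` and the neighbour `x` of `u′` towards `z` precede `u′` as seen from `w`, so they
  -- agree; but `x` is closer to `v` than `u′`, and `u` is farther.
  ...     | no z≢u′ with step-toward z≢u′
  ...       | x , xu′ , zx with unique-pred w xu′ (flip-edge u′u) (between-retract wzu′ xu′ zx) down
  ...         | refl = contradiction
    (trans (sym u′≡) (trans (between-retract vzu′ xu′ zx) (cong suc eq)))
    (<⇒≢ (m≤n⇒m≤1+n ≤-refl))

  median : ∀ u v w → ∃[ z ] Median u v w z
  median u v w = median-at (D v u) u v w refl

  -- The edge `y w` separates `u` from `v`. If the median of `w`, `v`, `u` were not `w`, the
  -- neighbour of `w` towards it would be closer to `v`, hence equal to `y`, and also closer to `u`.
  far-side : ∀ {u v w y} → Edge y w → D v w ≡ suc (D v y) → D u y ≡ suc (D u w) → Between u w v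
  far-side {u} {v} {w} {y} yw vy uy with median w v u
  ... | z , uzw , uzv , vzw with z Fin.≟ w
  ...   | yes refl = uzv
  ...   | no z≢w with step-toward z≢w
  ...     | x , xw , zx with unique-pred v xw yw (between-retract vzw xw zx) vy
  ...       | refl = contradiction
    (trans uy (cong suc (between-retract uzw xw zx)))
    (<⇒≢ (s≤s (n≤1+n _)))

-- Weight centres

sumOver≡sum : (f : Fin N → ℕ) → sumOver f ≡ sum f
sumOver≡sum {N} f = trans (cong Data.Nat.ListAction.sum (Listₚ.map-tabulate id f)) (go f)
  where
  go : ∀ {n} (g : Fin n → ℕ) → Data.Nat.ListAction.sum (tabulate g) ≡ sum g
  go {zero}  g = refl
  go {suc n} g = cong (λ s → g Fin.zero + s) (go (λ i → g (Fin.suc i)))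

sum-mono-≤ : (f g : Fin N → ℕ) → (∀ i → f i ≤ g i) → sum f ≤ sum g
sum-mono-≤ {zero}  f g h = z≤n
sum-mono-≤ {suc N} f g h = +-mono-≤ (h Fin.zero) (sum-mono-≤ _ _ (λ i → h (Fin.suc i)))

sum-mono-< : (f g : Fin N → ℕ) → (∀ i → f i ≤ g i) → ∀ j → f j < g j → sum f < sum g
sum-mono-< f g h Fin.zero    lt = +-mono-<-≤ lt (sum-mono-≤ _ _ (λ i → h (Fin.suc i)))
sum-mono-< f g h (Fin.suc j) lt = +-mono-≤-< (h Fin.zero) (sum-mono-< _ _ (λ i → h (Fin.suc i)) j lt)

sum-*ˡ : ∀ c (f : Fin N → ℕ) → sum (λ i → c * f i) ≡ c * sum f
sum-*ˡ {zero}  c f = sym (*-zeroʳ c)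
sum-*ˡ {suc N} c f = trans (cong (λ s → c * f Fin.zero + s) (sum-*ˡ c (λ i → f (Fin.suc i))))
                           (sym (*-distribˡ-+ c (f Fin.zero) _))

module _ {a} {X : Set a} (f : X → ℕ) where

  foldr-⊔-upper : ∀ {x} xs → x ∈ xs → f x ≤ foldr (λ v acc → f v ⊔ acc) 0 xs
  foldr-⊔-upper (x ∷ xs) (Any.here refl) = m≤m⊔n (f x) _
  foldr-⊔-upper (x ∷ xs) (Any.there x∈)  = ≤-trans (foldr-⊔-upper xs x∈) (m≤n⊔m (f x) _)

  foldr-⊔-least : ∀ xs {b} → (∀ x → f x ≤ b) → foldr (λ v acc → f v ⊔ acc) 0 xs ≤ b
  foldr-⊔-least []       h = z≤n
  foldr-⊔-least (x ∷ xs) h = ⊔-lub (h x) (foldr-⊔-least xs h)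

  foldr-⊓-lower : ∀ {x e} xs → x ∈ xs → foldr (λ v acc → f v ⊓ acc) e xs ≤ f x
  foldr-⊓-lower (x ∷ xs) (Any.here refl) = m⊓n≤m (f x) _
  foldr-⊓-lower (x ∷ xs) (Any.there x∈)  = ≤-trans (m⊓n≤n (f x) _) (foldr-⊓-lower xs x∈)

  foldr-⊓-greatest : ∀ {e b} xs → b ≤ e → (∀ x → x ∈ xs → b ≤ f x) → b ≤ foldr (λ v acc → f v ⊓ acc) e xs
  foldr-⊓-greatest []       be h = be
  foldr-⊓-greatest (x ∷ xs) be h =
    ⊓-glb (h x (Any.here refl)) (foldr-⊓-greatest xs be (λ y y∈ → h y (Any.there y∈)))

maxOver-upper : (f : Fin N → ℕ) → ∀ v → f v ≤ maxOver f
maxOver-upper f v = foldr-⊔-upper f _ (∈-allFin v)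

maxOver-least : (f : Fin N → ℕ) → ∀ {b} → (∀ v → f v ≤ b) → maxOver f ≤ b
maxOver-least f = foldr-⊔-least f (allFin _)

argmin : ∀ {n} (f : Fin (suc n) → ℕ) → ∃[ i ] ∀ j → f i ≤ f j
argmin {zero}  f = Fin.zero , λ { Fin.zero → ≤-refl }
argmin {suc n} f with argmin (λ i → f (Fin.suc i))
... | i , h with ≤-total (f Fin.zero) (f (Fin.suc i))
...   | inj₁ le = Fin.zero , λ { Fin.zero → ≤-refl ; (Fin.suc j) → ≤-trans le (h j) }
...   | inj₂ ge = Fin.suc i , λ { Fin.zero → ge ; (Fin.suc j) → h j }

⟦_⟧ : Bool → ℕ
⟦ b ⟧ = if b then 1 else 0

module _ {N : ℕ} (A : Adj N) where

  isWC-intro : ∀ v → (∀ u → weight A v ≤ weight A u) → T (isWC A v)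
  isWC-intro v h = Allₚ.all⁻ _ {xs = allFin N} (All.tabulate (λ {u} _ → ≤⇒≤ᵇ (h u)))

  isWC-elim : ∀ v → T (isWC A v) → ∀ u → weight A v ≤ weight A u
  isWC-elim v h u = ≤ᵇ⇒≤ _ _ (All.lookup (Allₚ.all⁺ _ (allFin N) h) (∈-allFin u))

  WC-intro : ∀ v → (∀ u → weight A v ≤ weight A u) → v ∈ WC A
  WC-intro v h = ∈-filter⁺ (T? ∘ isWC A) (∈-allFin v) (isWC-intro v h)

  WC-minimal : ∀ {v} → v ∈ WC A → ∀ u → weight A v ≤ weight A u
  WC-minimal {v} h = isWC-elim v (proj₂ (∈-filter⁻ (T? ∘ isWC A) {xs = allFin N} h))

-- κ + 1 is the number of weight centres. If κ = 1, side u tells whether the first of them is the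
-- nearer one to u; if κ = 0, all vertices are on the same side.
record TreeStructure {N : ℕ} (A : Adj N) : Set where
  field
    κ             : ℕ
    nW≡           : nW A ≡ suc κ
    κ-cases       : κ ≡ 0 ⊎ κ ≡ 1
    side          : Fin N → Bool
    delta≡        : ∀ u v → deltaT A u v ≡ ⟦ side u xor side v ⟧
    one-side      : κ ≡ 0 → ∀ u → side u ≡ true
    balanced      : κ ≡ 1 → sum (λ u → ⟦ side u ⟧) ≡ sum (λ u → ⟦ not (side u) ⟧)
    dist≡         : ∀ u v → dist A u v + 2 * phiT A u v ≡ level A u + level A v + deltaT A u v
    centre-unique : κ ≡ 0 → ∀ u v → level A u ≡ 0 → level A v ≡ 0 → u ≡ v

deltaT-one : (A : Adj N) {w : Fin N} → WC A ≡ w ∷ [] → ∀ u v → deltaT A u v ≡ 0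
deltaT-one A eq u v rewrite eq = refl

deltaT-two : (A : Adj N) {w w′ : Fin N} → WC A ≡ w ∷ w′ ∷ [] → ∀ u v →
             deltaT A u v ≡ (if reachIn (delEdge A w w′) N u v then 0 else 1)
deltaT-two A eq u v rewrite eq = refl

module Centres {n : ℕ} (A : Adj (suc n)) (tree : IsTree A) where

  open Tree A tree

  private
    V = Fin (suc n)

  weight≡ : ∀ v → weight A v ≡ sum (λ u → D u v)
  weight≡ v = trans (sumOver≡sum (λ u → dist A u v)) (sum-cong-≗ (λ u → sym (D≡dist u v)))

  -- Distances from u are convex along the geodesic from w to w′, and strictly so at u = y.
  weight-convex : ∀ {w w′ y j} → Edge y w → D w′ y ≡ suc j → D w′ w ≡ suc (suc j) →
                  suc (suc j) * weight A y < suc j * weight A w + weight A w′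
  weight-convex {w} {w′} {y} {j} yw y≡ w≡ = subst₂ _<_ lhs rhs (sum-mono-< _ _ pointwise y strict)
    where
    lhs : sum (λ u → suc (suc j) * D u y) ≡ suc (suc j) * weight A y
    lhs = trans (sum-*ˡ (suc (suc j)) (λ u → D u y)) (cong (λ s → suc (suc j) * s) (sym (weight≡ y)))
    rhs : sum (λ u → suc j * D u w + D u w′) ≡ suc j * weight A w + weight A w′
    rhs = trans (∑-distrib-+ (λ u → suc j * D u w) (λ u → D u w′))
                (cong₂ _+_ (trans (sum-*ˡ (suc j) (λ u → D u w)) (cong (λ s → suc j * s) (sym (weight≡ w))))
                           (sym (weight≡ w′)))
    nearer : ∀ j d e → suc d ≤ e + suc (suc j) → suc (suc j) * d ≤ suc j * suc d + e
    nearer j d e h = begin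
      d + suc j * d            ≤⟨ +-monoˡ-≤ (suc j * d) (s≤s⁻¹ (≤-trans h (≤-reflexive (+-suc e (suc j))))) ⟩
      e + suc j + suc j * d    ≡⟨ lem j d e ⟩
      suc j * suc d + e        ∎
      where
      open ≤-Reasoning
      lem : ∀ j d e → e + suc j + suc j * d ≡ suc j * suc d + e
      lem = solve-∀
    farther : ∀ j e → suc (suc j) * suc e ≡ suc j * e + (e + suc (suc j))
    farther = solve-∀
    -- Where `w` is nearer to `u` than `y`, the geodesic to `w′` passes through `w` and equality
    -- holds. On the other side the triangle inequality through `w′` suffices.
    pointwise : ∀ u → suc (suc j) * D u y ≤ suc j * D u w + D u w′
    pointwise u with edge-levels u yw
    ... | inj₁ eq = subst (λ x → _ ≤ suc j * x + D u w′) (sym eq)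
      (nearer j (D u y) (D u w′)
        (subst₂ (λ x z → x ≤ D u w′ + z) eq w≡ (triangle u w′ w)))
    ... | inj₂ eq = ≤-reflexive (begin
      suc (suc j) * D u y                    ≡⟨ cong (λ x → suc (suc j) * x) eq ⟩
      suc (suc j) * suc (D u w)              ≡⟨ farther j (D u w) ⟩
      suc j * D u w + (D u w + suc (suc j))  ≡⟨ cong (λ x → suc j * D u w + (D u w + x)) (trans (D-sym w w′) w≡) ⟨
      suc j * D u w + (D u w + D w w′)       ≡⟨ cong (λ x → suc j * D u w + x)
                                                  (far-side yw (trans w≡ (cong suc (sym y≡))) eq) ⟩
      suc j * D u w + D u w′                 ∎)
      where open ≡-Reasoning
    strict : suc (suc j) * D y y < suc j * D y w + D y w′
    strict rewrite D-refl y | *-zeroʳ j | D-edge yw = s≤s z≤n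

  -- Between nonadjacent centres, strict convexity would make the weight at `y` smaller than a
  -- weighted mean of two minimal weights.
  WC-adjacent : ∀ {w w′} → w ∈ WC A → w′ ∈ WC A → w ≢ w′ → Edge w w′
  WC-adjacent {w} {w′} w∈ w′∈ w≢w′ with step-toward (≢-sym w≢w′)
  ... | y , yw , eq with D w′ y in y≡
  ...   | zero with refl ← D≡0⇒≡ y≡ = flip-edge yw
  ...   | suc j = contradiction (weight-convex yw y≡ eq) (≤⇒≯ (begin
    suc j * weight A w + weight A w′  ≤⟨ +-mono-≤ (*-monoʳ-≤ (suc j) (WC-minimal A w∈ y)) (WC-minimal A w′∈ y) ⟩
    suc j * weight A y + weight A y   ≡⟨ +-comm (suc j * weight A y) (weight A y) ⟩
    suc (suc j) * weight A y          ∎))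
    where open ≤-Reasoning

  data Shape : List V → Set where
    one : ∀ w → Shape (w ∷ [])
    two : ∀ w w′ → Edge w w′ → Shape (w ∷ w′ ∷ [])

  -- Three centres would be pairwise adjacent, and such a triangle has an edge between two vertices
  -- at equal distance from the third.
  shape : Shape (WC A)
  shape = go (WC A) (Uniqueₚ.filter⁺ (T? ∘ isWC A) (Uniqueₚ.allFin⁺ (suc n))) id
             (let i , h = argmin (weight A) in WC-intro A i h)
    where
    go : ∀ ws → Unique ws → (∀ {x} → x ∈ ws → x ∈ WC A) → ∀ {x} → x ∈ ws → Shape ws
    go (w ∷ [])      _ _ _ = one w
    go (w ∷ w′ ∷ []) ((w≢w′ ∷ []) ∷ _) ⊆WC _ =
      two w w′ (WC-adjacent (⊆WC (Any.here refl)) (⊆WC (Any.there (Any.here refl))) w≢w′)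
    go (w ∷ w′ ∷ w″ ∷ _) ((w≢w′ ∷ w≢w″ ∷ _) ∷ (w′≢w″ ∷ _) ∷ _) ⊆WC _ =
      contradiction (trans (D-edge (WC-adjacent w∈ w′∈ w≢w′)) (sym (D-edge (WC-adjacent w∈ w″∈ w≢w″))))
                    (no-level-edge w (WC-adjacent w′∈ w″∈ w′≢w″))
      where
      w∈  = ⊆WC (Any.here refl)
      w′∈ = ⊆WC (Any.there (Any.here refl))
      w″∈ = ⊆WC (Any.there (Any.there (Any.here refl)))

  -- The strict inequality makes the centre unique, and all vertices on the way to it inherit the
  -- same centre.
  Nearest : V → V → Set
  Nearest c u = c ∈ WC A × (∀ {c′} → c′ ∈ WC A → c′ ≢ c → D c u < D c′ u)

  nearest-≤ : ∀ {c u} → Nearest c u → ∀ {c′} → c′ ∈ WC A → D c u ≤ D c′ u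
  nearest-≤ {c} (_ , near) {c′} c′∈ with c′ Fin.≟ c
  ... | yes refl = ≤-refl
  ... | no c′≢c  = <⇒≤ (near c′∈ c′≢c)

  dist≡D : ∀ u v → dist A u v ≡ D v u
  dist≡D u v = trans (sym (D≡dist u v)) (D-sym u v)

  level-nearest : ∀ {c u} → Nearest c u → level A u ≡ D c u
  level-nearest {c} {u} near = ≤-antisym
    (≤-trans (foldr-⊓-lower (dist A u) (WC A) (proj₁ near)) (≤-reflexive (dist≡D u c)))
    -- `level` takes the minimum from the default value `N`, which no distance reaches.
    (foldr-⊓-greatest (dist A u) (WC A) (<⇒≤ (D<N c u))
      (λ c′ c′∈ → ≤-trans (nearest-≤ near c′∈) (≤-reflexive (sym (dist≡D u c′)))))

  nearest-between : ∀ {c z u} → Nearest c u → Between c z u → Nearest c z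
  nearest-between {c} {z} {u} (c∈ , near) czu = c∈ , λ {c′} c′∈ c′≢c →
    +-cancelʳ-< (D z u) (D c z) (D c′ z)
      (≤-<-trans (≤-reflexive czu) (<-≤-trans (near c′∈ c′≢c) (triangle c′ z u)))

  isAnc⇒between : ∀ {c z u} → Nearest c u → T (isAnc A z u) → Between c z u
  isAnc⇒between {c} {z} {u} near h = go (WC A) id (Anyₚ.any⁻ _ (WC A) h)
    where
    go : ∀ ws → (∀ {x} → x ∈ ws → x ∈ WC A) →
         Any (λ w → T ((dist A u w ≡ᵇ level A u) ∧ (dist A u z + dist A z w ≡ᵇ dist A u w))) ws →
         Between c z u
    go (w ∷ ws) ⊆WC (Any.there p) = go ws (⊆WC ∘ Any.there) p
    go (w ∷ ws) ⊆WC (Any.here p) with to T-∧ p | w Fin.≟ c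
    ... | p₁ , p₂ | yes refl = begin
      D c z + D z u            ≡⟨ +-comm (D c z) (D z u) ⟩
      D z u + D c z            ≡⟨ cong₂ _+_ (dist≡D u z) (dist≡D z c) ⟨
      dist A u z + dist A z c  ≡⟨ ≡ᵇ⇒≡ _ _ p₂ ⟩
      dist A u c               ≡⟨ dist≡D u c ⟩
      D c u                    ∎
      where open ≡-Reasoning
    -- Only `c` attains the level of `u`, so the first conjunct of `isAnc` excludes every other
    -- centre.
    ... | p₁ , p₂ | no w≢c = contradiction
      (trans (sym (dist≡D u w)) (trans (≡ᵇ⇒≡ _ _ p₁) (level-nearest near)))
      (>⇒≢ (proj₂ near (⊆WC (Any.here refl)) w≢c))

  between⇒isAnc : ∀ {c z u} → Nearest c u → Between c z u → T (isAnc A z u)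
  between⇒isAnc {c} {z} {u} near czu =
    Anyₚ.any⁺ _ (Any.map (λ { refl → from T-∧ (≡⇒≡ᵇ _ _ e₁ , ≡⇒≡ᵇ _ _ e₂) }) (proj₁ near))
    where
    open ≡-Reasoning
    e₁ = trans (dist≡D u c) (sym (level-nearest near))
    e₂ : dist A u z + dist A z c ≡ dist A u c
    e₂ = begin
      dist A u z + dist A z c  ≡⟨ cong₂ _+_ (dist≡D u z) (dist≡D z c) ⟩
      D z u + D c z            ≡⟨ +-comm (D z u) (D c z) ⟩
      D c z + D z u            ≡⟨ czu ⟩
      D c u                    ≡⟨ dist≡D u c ⟨
      dist A u c               ∎

  commonLevel : V → V → V → ℕ
  commonLevel u v z = if isAnc A z u ∧ isAnc A z v then level A z else 0

  -- The deepest common ancestor is the median of `u`, `v` and their centre, and the path from `u`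
  -- to `v` turns there.
  phiT-same : ∀ {c u v} → Nearest c u → Nearest c v →
              dist A u v + 2 * phiT A u v ≡ level A u + level A v
  phiT-same {c} {u} {v} near-u near-v with median u v c
  ... | m , cmu , cmv , vmu = begin
    dist A u v + 2 * phiT A u v                  ≡⟨ cong₂ (λ x y → x + 2 * y) dist-uv phi≡ ⟩
    (D v m + D m u) + 2 * D c m                  ≡⟨ cong (λ x → x + D m u + 2 * D c m) (D-sym v m) ⟩
    (D m v + D m u) + 2 * D c m                  ≡⟨ rearrange (D m v) (D m u) (D c m) ⟩
    (D c m + D m u) + (D c m + D m v)            ≡⟨ cong₂ _+_ cmu cmv ⟩
    D c u + D c v                                ≡⟨ cong₂ _+_ (level-nearest near-u) (level-nearest near-v) ⟨
    level A u + level A v                        ∎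
    where
    open ≡-Reasoning
    rearrange : ∀ a b c → (a + b) + 2 * c ≡ (c + b) + (c + a)
    rearrange = solve-∀
    dist-uv : dist A u v ≡ D v m + D m u
    dist-uv = trans (dist≡D u v) (sym vmu)
    value-at-median : commonLevel u v m ≡ D c m
    value-at-median
      rewrite to T-≡ (between⇒isAnc near-u cmu) | to T-≡ (between⇒isAnc near-v cmv)
      = level-nearest (nearest-between near-u cmu)
    -- Twice the level of a common ancestor is `D c u + D c v` minus the length of the route from
    -- `v` to `u` over it; the route over the median is shortest.
    bound : ∀ {z} → Between c z u → Between c z v → D c z ≤ D c m
    bound {z} czu czv = *-cancelˡ-≤ 2 (+-cancelʳ-≤ (D v u) (2 * D c z) (2 * D c m) (R.begin
      2 * D c z + D v u                  R.≤⟨ +-monoʳ-≤ (2 * D c z) (triangle v z u) ⟩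
      2 * D c z + (D v z + D z u)        R.≡⟨ cong (λ x → 2 * D c z + (x + D z u)) (D-sym v z) ⟩
      2 * D c z + (D z v + D z u)        R.≡⟨ shuffle (D c z) (D z v) (D z u) ⟩
      (D c z + D z u) + (D c z + D z v)  R.≡⟨ cong₂ _+_ (trans czu (sym cmu)) (trans czv (sym cmv)) ⟩
      (D c m + D m u) + (D c m + D m v)  R.≡⟨ shuffle (D c m) (D m v) (D m u) ⟨
      2 * D c m + (D m v + D m u)        R.≡⟨ cong (λ x → 2 * D c m + (x + D m u)) (D-sym v m) ⟨
      2 * D c m + (D v m + D m u)        R.≡⟨ cong (λ x → 2 * D c m + x) vmu ⟩
      2 * D c m + D v u                  R.∎))
      where
      module R = ≤-Reasoning
      shuffle : ∀ a b c → 2 * a + (b + c) ≡ (a + c) + (a + b)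
      shuffle = solve-∀
    values : ∀ z → commonLevel u v z ≤ D c m
    values z with isAnc A z u in eq₁ | isAnc A z v in eq₂
    ... | false | _     = z≤n
    ... | true  | false = z≤n
    ... | true  | true  = ≤-trans (≤-reflexive (level-nearest (nearest-between near-u czu))) (bound czu czv)
      where
      czu = isAnc⇒between near-u (from T-≡ eq₁)
      czv = isAnc⇒between near-v (from T-≡ eq₂)
    phi≡ : phiT A u v ≡ D c m
    phi≡ = ≤-antisym (maxOver-least (commonLevel u v) values)
      (≤-trans (≤-reflexive (sym value-at-median)) (maxOver-upper (commonLevel u v) m))

  -- A common ancestor would inherit both `c` and `c′` as its nearest centre.
  phiT-diff : ∀ {c c′ u v} → c ≢ c′ → Nearest c u → Nearest c′ v → phiT A u v ≡ 0
  phiT-diff {c} {c′} {u} {v} c≢c′ near-u near-v =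
    n≤0⇒n≡0 (maxOver-least (commonLevel u v) values)
    where
    values : ∀ z → commonLevel u v z ≤ 0
    values z with isAnc A z u in eq₁ | isAnc A z v in eq₂
    ... | false | _     = z≤n
    ... | true  | false = z≤n
    ... | true  | true  = contradiction (proj₂ near₁ (proj₁ near₂) (≢-sym c≢c′))
                                        (<-asym (proj₂ near₂ (proj₁ near₁) c≢c′))
      where
      near₁ = nearest-between near-u (isAnc⇒between near-u (from T-≡ eq₁))
      near₂ = nearest-between near-v (isAnc⇒between near-v (from T-≡ eq₂))

-- Trees with one and with two weight centres

module CentresStructure {n : ℕ} (A : Adj (suc n)) (tree : IsTree A) where

  open Tree A tree
  open Centres A tree

  private
    V = Fin (suc n)

  structure-one : ∀ w → WC A ≡ w ∷ [] → TreeStructure A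
  structure-one w eq = record
    { κ = 0
    ; nW≡ = cong length eq
    ; κ-cases = inj₁ refl
    ; side = λ _ → true
    ; delta≡ = deltaT-one A eq
    ; one-side = λ _ _ → refl
    ; balanced = λ ()
    ; dist≡ = λ u v → trans (phiT-same (near u) (near v))
        (trans (sym (+-identityʳ _)) (cong (λ x → level A u + level A v + x) (sym (deltaT-one A eq u v))))
    ; centre-unique = λ _ u v u0 v0 → trans (sym (at-centre u u0)) (at-centre v v0)
    }
    where
    near : ∀ u → Nearest w u
    near u = subst (w ∈_) (sym eq) (Any.here refl) , λ c′∈ c′≢w → case subst (_ ∈_) eq c′∈ of λ
      { (Any.here c′≡w) → contradiction c′≡w c′≢w ; (Any.there ()) }
    at-centre : ∀ u → level A u ≡ 0 → w ≡ u
    at-centre u u0 = D≡0⇒≡ (trans (sym (level-nearest (near u))) u0)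

  module Two (w w′ : V) (ww′ : Edge w w′) (eq : WC A ≡ w ∷ w′ ∷ []) where

    ∈-cases : ∀ {c} → c ∈ WC A → c ≡ w ⊎ c ≡ w′
    ∈-cases c∈ with subst (_ ∈_) eq c∈
    ... | Any.here e              = inj₁ e
    ... | Any.there (Any.here e)  = inj₂ e

    w∈ : w ∈ WC A
    w∈ = subst (w ∈_) (sym eq) (Any.here refl)

    w′∈ : w′ ∈ WC A
    w′∈ = subst (w′ ∈_) (sym eq) (Any.there (Any.here refl))

    -- The centres are adjacent, so no vertex is equidistant from them and the strict comparison
    -- decides.
    side : V → Bool
    side u = D w u <ᵇ D w′ u

    data Side (u : V) : Bool → Set where
      near-w  : Nearest w u  → D w′ u ≡ suc (D w u) → Side u true
      near-w′ : Nearest w′ u → D w u ≡ suc (D w′ u) → Side u false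

    sides : ∀ u → Side u (side u)
    sides u with edge-levels u ww′ | D w u <ᵇ D w′ u in lt?
    ... | inj₁ e | b = subst (Side u) (trans (sym (to T-≡ (<⇒<ᵇ lt))) lt?) (near-w
      (w∈ , λ c∈ c≢w → [ (λ c≡w → contradiction c≡w c≢w) , (λ { refl → lt }) ]′ (∈-cases c∈)) e′)
      where
      e′ : D w′ u ≡ suc (D w u)
      e′ = trans (D-sym w′ u) (trans e (cong suc (D-sym u w)))
      lt : D w u < D w′ u
      lt = ≤-reflexive (sym e′)
    ... | inj₂ e | true  = contradiction (<ᵇ⇒< (D w u) (D w′ u) (from T-≡ lt?))
      (<⇒≯ (≤-reflexive (trans (cong suc (D-sym w′ u)) (trans (sym e) (D-sym u w)))))
    ... | inj₂ e | false =
      near-w′ (w′∈ , λ c∈ c≢w′ → [ (λ { refl → ≤-reflexive (sym e′) })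
                                 , (λ c≡w′ → contradiction c≡w′ c≢w′) ]′ (∈-cases c∈)) e′
      where
      e′ : D w u ≡ suc (D w′ u)
      e′ = trans (D-sym w u) (trans e (cong suc (D-sym u w′)))

    cross-dist : ∀ {c c′ u v} → Edge c c′ → D c′ u ≡ suc (D c u) → D c v ≡ suc (D c′ v) →
                 D u v ≡ suc (D c u + D c′ v)
    cross-dist {c} {c′} {u} {v} cc′ eu ev = begin
      D u v                 ≡⟨ far-side (flip-edge cc′)
                                 (trans (D-sym v c) (trans ev (cong suc (D-sym c′ v))))
                                 (trans (D-sym u c′) (trans eu (cong suc (D-sym c u)))) ⟨
      D u c + D c v         ≡⟨ cong₂ _+_ (D-sym u c) ev ⟩
      D c u + suc (D c′ v)  ≡⟨ +-suc (D c u) (D c′ v) ⟩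
      suc (D c u + D c′ v)  ∎
      where open ≡-Reasoning

    Cut : Adj (suc n)
    Cut = delEdge A w w′

    deleted : V → V → Bool
    deleted x y = (x == w ∧ y == w′) ∨ (x == w′ ∧ y == w)

    deleted-elim : ∀ {x y} → T (deleted x y) → (x ≡ w × y ≡ w′) ⊎ (x ≡ w′ × y ≡ w)
    deleted-elim h with to T-∨ h
    ... | inj₁ g = let a , b = to T-∧ g in inj₁ (==⇒≡ a , ==⇒≡ b)
    ... | inj₂ g = let a , b = to T-∧ g in inj₂ (==⇒≡ a , ==⇒≡ b)

    cut-edge : ∀ {x y} → Edge x y → ¬ ((x ≡ w × y ≡ w′) ⊎ (x ≡ w′ × y ≡ w)) → T (Cut x y)
    cut-edge {x} {y} xy not-ww′ with deleted x y in del
    ... | true  = contradiction (deleted-elim {x} {y} (from T-≡ del)) not-ww′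
    ... | false = from T-∧ (xy , tt)

    cut-elim : ∀ {x y} → T (Cut x y) → Edge x y × ¬ T (deleted x y)
    cut-elim {x} {y} h with deleted x y
    ... | true  = contradiction (proj₂ (to (T-∧ {A x y}) h)) id
    ... | false = proj₁ (to (T-∧ {A x y}) h) , id

    -- By `cross-dist` the length of the edge is one plus the distances of its ends to their
    -- centres, so both distances vanish.
    cross-edge : ∀ {x y} → D w′ x ≡ suc (D w x) → D w y ≡ suc (D w′ y) → Edge x y → w ≡ x × w′ ≡ y
    cross-edge {x} {y} ex ey xy = D≡0⇒≡ (m+n≡0⇒m≡0 (D w x) sum≡0) , D≡0⇒≡ (m+n≡0⇒n≡0 (D w x) sum≡0)
      where
      sum≡0 : D w x + D w′ y ≡ 0
      sum≡0 = suc-injective (trans (sym (cross-dist ww′ ex ey)) (D-edge xy))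

    deleted-cross : ∀ {x y} → side x ≡ true → side y ≡ false → Edge x y → T (deleted x y) × T (deleted y x)
    deleted-cross {x} {y} sx sy xy with side x | sides x | side y | sides y
    deleted-cross {x} {y} refl refl xy | _ | near-w _ ex | _ | near-w′ _ ey
      with refl , refl ← cross-edge ex ey xy
      = from T-∨ (inj₁ (from T-∧ (≡⇒== {u = w} refl , ≡⇒== {u = w′} refl))) ,
        from T-∨ (inj₂ (from T-∧ (≡⇒== {u = w′} refl , ≡⇒== {u = w} refl)))

    cut-same-side : ∀ {k u v} → Path Cut u k v → side u ≡ side v
    cut-same-side nil = refl
    cut-same-side (snoc {w = x} {v = y} p e) = trans (cut-same-side p) (step-same (side x) refl (side y) refl)
      where
      xy = proj₁ (cut-elim {x} {y} e)
      kept = proj₂ (cut-elim {x} {y} e)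
      step-same : ∀ a → side x ≡ a → ∀ b → side y ≡ b → side x ≡ side y
      step-same true  sx true  sy = trans sx (sym sy)
      step-same false sx false sy = trans sx (sym sy)
      step-same true  sx false sy = contradiction (proj₁ (deleted-cross sx sy xy)) kept
      step-same false sx true  sy = contradiction (proj₂ (deleted-cross sy sx (flip-edge xy))) kept

    -- The deleted edge has two centres as ends, while each edge of the geodesic has an end, the one
    -- farther from `c`, that is no centre. Both directions are built together because `reverse` is
    -- tied to a connected graph.
    to-centre : ∀ {c} k u → D c u ≡ k → Nearest c u → (∃[ i ] Path Cut c i u) × (∃[ i ] Path Cut u i c)
    to-centre zero u d≡ near with refl ← D≡0⇒≡ d≡ = (0 , nil) , (0 , nil)
    to-centre {c} (suc k) u d≡ near with predecessor d≡
    ... | x , xu , x≡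
      with to-centre k x x≡ (nearest-between near (trans (cong₂ _+_ x≡ (D-edge xu)) (trans (+-comm k 1) (sym d≡))))
    ...   | (i , p) , (j , q) =
      (_ , snoc p (cut-edge xu λ
        { (inj₁ (_ , u≡)) → not-centre w′∈ u≡ ; (inj₂ (_ , u≡)) → not-centre w∈ u≡ })) ,
      (_ , cons (cut-edge (flip-edge xu) λ
        { (inj₁ (u≡ , _)) → not-centre w∈ u≡ ; (inj₂ (u≡ , _)) → not-centre w′∈ u≡ }) q)
      where
      not-centre : ∀ {c′} → c′ ∈ WC A → u ≢ c′
      not-centre {c′} c′∈ refl with u Fin.≟ c
      ... | yes refl = 0≢1+n (trans (sym (D-refl u)) d≡)
      ... | no u≢c   = <⇒≱ (proj₂ near c′∈ u≢c) (≤-trans (≤-reflexive (D-refl u)) z≤n)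

    joined : ∀ {c u v} → Nearest c u → Nearest c v → T (reachIn Cut (suc n) u v)
    joined {c} {u} {v} near-u near-v =
      path⇒reachIn-N (proj₂ (proj₂ (to-centre _ u refl near-u)) ◅◅ proj₂ (proj₁ (to-centre _ v refl near-v)))

    separated : ∀ {u v} → side u ≢ side v → reachIn Cut (suc n) u v ≡ false
    separated {u} {v} ≢side with reachIn Cut (suc n) u v in r
    ... | false = refl
    ... | true  = contradiction (cut-same-side (proj₂ (proj₂ (reachIn⇒path (suc n) (from T-≡ r))))) ≢side

    delta-same : ∀ {c u v} → Nearest c u → Nearest c v → deltaT A u v ≡ 0
    delta-same {u = u} {v} near-u near-v =
      trans (deltaT-two A eq u v) (cong (λ b → if b then 0 else 1) (to T-≡ (joined near-u near-v)))

    delta-diff : ∀ {u v} → side u ≢ side v → deltaT A u v ≡ 1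
    delta-diff {u} {v} ≢side = trans (deltaT-two A eq u v) (cong (λ b → if b then 0 else 1) (separated ≢side))

    dist-same : ∀ {c u v} → Nearest c u → Nearest c v →
                dist A u v + 2 * phiT A u v ≡ level A u + level A v + 0
    dist-same near-u near-v = trans (phiT-same near-u near-v) (sym (+-identityʳ _))

    dist-diff : ∀ {c c′ u v} → Edge c c′ → Nearest c u → Nearest c′ v →
                D c′ u ≡ suc (D c u) → D c v ≡ suc (D c′ v) →
                dist A u v + 2 * phiT A u v ≡ level A u + level A v + 1
    dist-diff {c} {c′} {u} {v} cc′ near-u near-v eu ev = begin
      dist A u v + 2 * phiT A u v    ≡⟨ cong₂ (λ x y → x + 2 * y) (sym (D≡dist u v))
                                               (phiT-diff (edge-≢ cc′) near-u near-v) ⟩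
      D u v + 0                      ≡⟨ +-identityʳ (D u v) ⟩
      D u v                          ≡⟨ cross-dist cc′ eu ev ⟩
      suc (D c u + D c′ v)           ≡⟨ +-comm 1 (D c u + D c′ v) ⟩
      D c u + D c′ v + 1             ≡⟨ cong (_+ 1) (cong₂ _+_ (level-nearest near-u) (level-nearest near-v)) ⟨
      level A u + level A v + 1      ∎
      where open ≡-Reasoning

    pair : ∀ u v → deltaT A u v ≡ ⟦ side u xor side v ⟧ ×
                   dist A u v + 2 * phiT A u v ≡ level A u + level A v + ⟦ side u xor side v ⟧
    pair u v with side u in su | sides u | side v in sv | sides v
    ... | true  | near-w  nu eu | true  | near-w  nv ev = delta-same nu nv , dist-same nu nv
    ... | false | near-w′ nu eu | false | near-w′ nv ev = delta-same nu nv , dist-same nu nv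
    ... | true  | near-w  nu eu | false | near-w′ nv ev =
      delta-diff (λ s → case trans (sym su) (trans s sv) of λ ()) , dist-diff ww′ nu nv eu ev
    ... | false | near-w′ nu eu | true  | near-w  nv ev =
      delta-diff (λ s → case trans (sym su) (trans s sv) of λ ()) , dist-diff (flip-edge ww′) nu nv eu ev

    weights-equal : weight A w ≡ weight A w′
    weights-equal = ≤-antisym (WC-minimal A w∈ w′) (WC-minimal A w′∈ w)

    -- Going from `w` to `w′` adds one to the distance from every vertex on the side of `w` and
    -- removes one on the other side; the weights of the two centres agree, so the changes cancel.
    balance : sum (λ u → ⟦ side u ⟧) ≡ sum (λ u → ⟦ not (side u) ⟧)
    balance = +-cancelˡ-≡ (weight A w) _ _ (begin
      weight A w + sum (λ u → ⟦ side u ⟧)                  ≡⟨ cong (_+ sum (λ u → ⟦ side u ⟧)) (weight≡ w) ⟩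
      sum (λ u → D u w) + sum (λ u → ⟦ side u ⟧)           ≡⟨ ∑-distrib-+ (λ u → D u w) (λ u → ⟦ side u ⟧) ⟨
      sum (λ u → D u w + ⟦ side u ⟧)                       ≡⟨ sum-cong-≗ (λ u → shift u) ⟩
      sum (λ u → D u w′ + ⟦ not (side u) ⟧)                ≡⟨ ∑-distrib-+ (λ u → D u w′) (λ u → ⟦ not (side u) ⟧) ⟩
      sum (λ u → D u w′) + sum (λ u → ⟦ not (side u) ⟧)    ≡⟨ cong (_+ sum (λ u → ⟦ not (side u) ⟧)) (weight≡ w′) ⟨
      weight A w′ + sum (λ u → ⟦ not (side u) ⟧)           ≡⟨ cong (_+ sum (λ u → ⟦ not (side u) ⟧)) weights-equal ⟨
      weight A w + sum (λ u → ⟦ not (side u) ⟧)            ∎)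
      where
      open ≡-Reasoning
      shift : ∀ u → D u w + ⟦ side u ⟧ ≡ D u w′ + ⟦ not (side u) ⟧
      shift u with side u | sides u
      ... | true  | near-w _ e  = trans (+-comm (D u w) 1)
        (trans (cong suc (D-sym u w)) (trans (sym e) (trans (D-sym w′ u) (sym (+-identityʳ _)))))
      ... | false | near-w′ _ e = trans (+-identityʳ _)
        (trans (D-sym u w) (trans e (trans (cong suc (D-sym w′ u)) (+-comm 1 (D u w′)))))

    structure-two : TreeStructure A
    structure-two = record
      { κ = 1
      ; nW≡ = cong length eq
      ; κ-cases = inj₂ refl
      ; side = side
      ; delta≡ = λ u v → proj₁ (pair u v)
      ; one-side = λ ()
      ; balanced = λ _ → balance
      ; dist≡ = λ u v → trans (proj₂ (pair u v)) (cong (λ x → level A u + level A v + x) (sym (proj₁ (pair u v))))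
      ; centre-unique = λ ()
      }

  structure : TreeStructure A
  structure = go (WC A) shape refl
    where
    go : ∀ ws → Shape ws → WC A ≡ ws → TreeStructure A
    go _ (one w)        eq = structure-one w eq
    go _ (two w w′ ww′) eq = Two.structure-two w w′ ww′ eq

-- The vertex rules out the empty graph, which has no weight centre.
treeStructure : (A : Adj N) → IsTree A → Fin N → TreeStructure A
treeStructure {suc n} A tree _ = CentresStructure.structure A tree

-- Cartesian products

argmax : ∀ {n} (f : Fin (suc n) → ℕ) → ∃[ i ] ∀ j → f j ≤ f i
argmax {zero}  f = Fin.zero , λ { Fin.zero → ≤-refl }
argmax {suc n} f with argmax (λ i → f (Fin.suc i))
... | i , h with ≤-total (f Fin.zero) (f (Fin.suc i))
...   | inj₁ le = Fin.suc i , λ { Fin.zero → le ; (Fin.suc j) → h j }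
...   | inj₂ ge = Fin.zero , λ { Fin.zero → ≤-refl ; (Fin.suc j) → ≤-trans (h j) ge }

maxOver-attained : (f : Fin N → ℕ) → Fin N → ∃[ v ] maxOver f ≡ f v
maxOver-attained {suc n} f _ =
  let v , h = argmax f in v , ≤-antisym (maxOver-least f h) (maxOver-upper f v)

dist≤diam : (A : Adj N) → ∀ u v → dist A u v ≤ diam A
dist≤diam A u v = ≤-trans (maxOver-upper (dist A u) v) (maxOver-upper (λ u → maxOver (dist A u)) u)

diam-attained : (A : Adj N) → Fin N → ∃[ u ] ∃[ v ] diam A ≡ dist A u v
diam-attained A i =
  let u , e  = maxOver-attained (λ u → maxOver (dist A u)) i
      v , e′ = maxOver-attained (dist A u) i
  in u , v , trans e e′

diam-least : (A : Adj N) {b : ℕ} → (∀ u v → dist A u v ≤ b) → diam A ≤ b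
diam-least A h = maxOver-least (λ u → maxOver (dist A u)) (λ u → maxOver-least (dist A u) (h u))

sum-const : ∀ n c → sum {n} (λ _ → c) ≡ n * c
sum-const zero    c = refl
sum-const (suc n) c = cong (λ s → c + s) (sum-const n c)

sum-split : ∀ a {b} (f : Fin (a + b) → ℕ) →
            sum f ≡ sum (λ i → f (i Fin.↑ˡ b)) + sum (λ i → f (a Fin.↑ʳ i))
sum-split zero    f = refl
sum-split (suc a) f = trans (cong (λ s → f Fin.zero + s) (sum-split a (λ i → f (Fin.suc i))))
                            (sym (+-assoc (f Fin.zero) _ _))

sum-remQuot : ∀ m n (h : Fin m × Fin n → ℕ) →
              sum (λ z → h (remQuot {m} n z)) ≡ sum (λ x → sum (λ y → h (x , y)))
sum-remQuot zero    n h = refl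
sum-remQuot (suc m) n h = trans (sum-split n (λ z → h (remQuot {suc m} n z)))
  (cong₂ _+_ (sum-cong-≗ (λ j → cong h (Finₚ.remQuot-combine {suc m} Fin.zero j)))
             (trans (sum-cong-≗ (λ i → cong h (right i))) (sum-remQuot m n (λ (x , y) → h (Fin.suc x , y)))))
  where
  right : ∀ i → remQuot {suc m} n (n Fin.↑ʳ i) ≡ (Fin.suc (proj₁ (remQuot {m} n i)) , proj₂ (remQuot {m} n i))
  right i rewrite Finₚ.splitAt-↑ʳ n (m * n) i = refl

sum-remQuot-+ : ∀ m n (f : Fin m → ℕ) (g : Fin n → ℕ) →
                sum (λ z → f (proj₁ (remQuot {m} n z)) + g (proj₂ (remQuot {m} n z))) ≡ n * sum f + m * sum g
sum-remQuot-+ m n f g = begin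
  sum (λ z → f (proj₁ (remQuot {m} n z)) + g (proj₂ (remQuot {m} n z)))
    ≡⟨ sum-remQuot m n (λ (x , y) → f x + g y) ⟩
  sum (λ x → sum (λ y → f x + g y))
    ≡⟨ sum-cong-≗ (λ x → trans (∑-distrib-+ (λ _ → f x) g) (cong (_+ sum g) (sum-const n (f x)))) ⟩
  sum (λ x → n * f x + sum g)
    ≡⟨ ∑-distrib-+ (λ x → n * f x) (λ _ → sum g) ⟩
  sum (λ x → n * f x) + sum {m} (λ _ → sum g)
    ≡⟨ cong₂ _+_ (sum-*ˡ n f) (sum-const m (sum g)) ⟩
  n * sum f + m * sum g ∎
  where open ≡-Reasoning

length-filterᵇ : (P : Fin N → Bool) → length (filterᵇ P (allFin N)) ≡ sum (λ i → ⟦ P i ⟧)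
length-filterᵇ P = go P id
  where
  go : ∀ {a} {X : Set a} (P : X → Bool) {n} (f : Fin n → X) →
       length (filterᵇ P (tabulate f)) ≡ sum (λ i → ⟦ P (f i) ⟧)
  go P {zero}  f = refl
  go P {suc n} f with P (f Fin.zero)
  ... | true  = cong suc (go P (λ i → f (Fin.suc i)))
  ... | false = go P (λ i → f (Fin.suc i))

T-injective : ∀ {a b} → (T a → T b) → (T b → T a) → a ≡ b
T-injective {true}  {true}  _ _ = refl
T-injective {false} {false} _ _ = refl
T-injective {true}  {false} f _ = ⊥-elim (f tt)
T-injective {false} {true}  _ g = ⊥-elim (g tt)

module CartesianProduct {m n : ℕ} (A : Adj m) (B : Adj n)
  (simpleA : IsSimple A) (connA : Connected A) (simpleB : IsSimple B) (connB : Connected B) where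

  open Prod A B

  private
    module MA = Metric A simpleA connA
    module MB = Metric B simpleB connB

  pair : Fin m → Fin n → Fin p
  pair = combine

  x-pair : ∀ x y → x_ (pair x y) ≡ x
  x-pair x y = cong proj₁ (Finₚ.remQuot-combine x y)

  y-pair : ∀ x y → y_ (pair x y) ≡ y
  y-pair x y = cong proj₂ (Finₚ.remQuot-combine x y)

  pair-xy : ∀ z → pair (x_ z) (y_ z) ≡ z
  pair-xy z = Finₚ.combine-remQuot {m} n z

  xy-injective : ∀ {z z′} → x_ z ≡ x_ z′ → y_ z ≡ y_ z′ → z ≡ z′
  xy-injective {z} {z′} ex ey = trans (sym (pair-xy z)) (trans (cong₂ pair ex ey) (pair-xy z′))

  G≡ : ∀ z z′ → G z z′ ≡ (A (x_ z) (x_ z′) ∧ (y_ z == y_ z′)) ∨ ((x_ z == x_ z′) ∧ B (y_ z) (y_ z′))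
  G≡ z z′ = refl

  G-edge : ∀ {z z′} → T (G z z′) →
           (T (A (x_ z) (x_ z′)) × y_ z ≡ y_ z′) ⊎ (x_ z ≡ x_ z′ × T (B (y_ z) (y_ z′)))
  G-edge {z} {z′} e with to T-∨ (subst T (G≡ z z′) e)
  ... | inj₁ h = let a , b = to T-∧ h in inj₁ (a , ==⇒≡ b)
  ... | inj₂ h = let a , b = to T-∧ h in inj₂ (==⇒≡ a , b)

  G-edge-x : ∀ {z z′} → T (A (x_ z) (x_ z′)) → y_ z ≡ y_ z′ → T (G z z′)
  G-edge-x {z} {z′} a b = subst T (sym (G≡ z z′)) (from T-∨ (inj₁ (from T-∧ (a , ≡⇒== b))))

  G-edge-y : ∀ {z z′} → x_ z ≡ x_ z′ → T (B (y_ z) (y_ z′)) → T (G z z′)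
  G-edge-y {z} {z′} a b = subst T (sym (G≡ z z′)) (from T-∨ (inj₂ (from T-∧ (≡⇒== a , b))))

  lift-x : ∀ {k u v} y → Path A u k v → Path G (pair u y) k (pair v y)
  lift-x y nil = nil
  lift-x y (snoc {w = w} {v = v} p e) = snoc (lift-x y p)
    (G-edge-x (subst₂ (λ a b → T (A a b)) (sym (x-pair w y)) (sym (x-pair v y)) e)
              (trans (y-pair w y) (sym (y-pair v y))))

  lift-y : ∀ {k u v} x → Path B u k v → Path G (pair x u) k (pair x v)
  lift-y x nil = nil
  lift-y x (snoc {w = w} {v = v} p e) = snoc (lift-y x p)
    (G-edge-y (trans (x-pair x w) (sym (x-pair x v)))
              (subst₂ (λ a b → T (B a b)) (sym (y-pair x w)) (sym (y-pair x v)) e))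

  project : ∀ {k z z′} → Path G z k z′ →
            ∃[ i ] ∃[ j ] i + j ≡ k × Path A (x_ z) i (x_ z′) × Path B (y_ z) j (y_ z′)
  project nil = 0 , 0 , refl , nil , nil
  project {z = z} (snoc {w = w} {v = v} p e) with project p | G-edge {w} {v} e
  ... | i , j , refl , pa , pb | inj₁ (a , b) = suc i , j , refl , snoc pa a , subst (Path B (y_ z) j) b pb
  ... | i , j , refl , pa , pb | inj₂ (a , b) = i , suc j , +-suc i j , subst (Path A (x_ z) i) a pa , snoc pb b

  product-path : ∀ z z′ → Path G z (dist B (y_ z) (y_ z′) + dist A (x_ z) (x_ z′)) z′
  product-path z z′ = subst₂ (λ a b → Path G a (dist B (y_ z) (y_ z′) + dist A (x_ z) (x_ z′)) b)
    (pair-xy z) (pair-xy z′)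
    (lift-y (x_ z) (subst (λ k → Path B (y_ z) k (y_ z′)) (MB.D≡dist _ _) (MB.geodesic (y_ z) (y_ z′)))
      ◅◅′ lift-x (y_ z′) (subst (λ k → Path A (x_ z) k (x_ z′)) (MA.D≡dist _ _) (MA.geodesic (x_ z) (x_ z′))))
    where
    _◅◅′_ : ∀ {k l u v w} → Path G u k v → Path G v l w → Path G u (k + l) w
    _◅◅′_ {k} {l} {u} {v} {w} p q = subst (λ i → Path G u i w) (+-comm l k) (p ◅◅ q)

  -- A path in the product moves one coordinate at a time, so its projections have lengths adding up
  -- to its own; conversely the coordinates can be moved one after the other.
  dist-product : ∀ z z′ → dist G z z′ ≡ dist A (x_ z) (x_ z′) + dist B (y_ z) (y_ z′)
  dist-product z z′ = ≤-antisym
    (≤-trans (dist-≤ (product-path z z′)) (≤-reflexive (+-comm (dist B (y_ z) (y_ z′)) _)))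
    (case project (proj₁ (path⇒dist-path (product-path z z′))) of λ
      { (i , j , i+j≡ , pa , pb) → ≤-trans (+-mono-≤ (dist-≤ pa) (dist-≤ pb)) (≤-reflexive i+j≡) })

  diam-product : Fin m → Fin n → diam G ≡ d
  diam-product i j = ≤-antisym
    (diam-least G (λ z z′ → ≤-trans (≤-reflexive (dist-product z z′))
      (+-mono-≤ (dist≤diam A (x_ z) (x_ z′)) (dist≤diam B (y_ z) (y_ z′)))))
    (case diam-attained A i , diam-attained B j of λ
      { ((u , u′ , eu) , (v , v′ , ev)) → begin
          diam A + diam B           ≡⟨ cong₂ _+_ eu ev ⟩
          dist A u u′ + dist B v v′ ≡⟨ cong₂ _+_ (cong₂ (dist A) (x-pair u v) (x-pair u′ v′))
                                                 (cong₂ (dist B) (y-pair u v) (y-pair u′ v′)) ⟨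
          dist A (x_ (pair u v)) (x_ (pair u′ v′)) + dist B (y_ (pair u v)) (y_ (pair u′ v′))
                                    ≡⟨ dist-product (pair u v) (pair u′ v′) ⟨
          dist G (pair u v) (pair u′ v′) ≤⟨ dist≤diam G (pair u v) (pair u′ v′) ⟩
          diam G                    ∎ })
    where open ≤-Reasoning

  weight-product : ∀ z → weight G z ≡ n * weight A (x_ z) + m * weight B (y_ z)
  weight-product z = begin
    weight G z
      ≡⟨ sumOver≡sum (λ z′ → dist G z′ z) ⟩
    sum (λ z′ → dist G z′ z)
      ≡⟨ sum-cong-≗ (λ z′ → dist-product z′ z) ⟩
    sum (λ z′ → dist A (x_ z′) (x_ z) + dist B (y_ z′) (y_ z))
      ≡⟨ sum-remQuot-+ m n (λ x → dist A x (x_ z)) (λ y → dist B y (y_ z)) ⟩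
    n * sum (λ x → dist A x (x_ z)) + m * sum (λ y → dist B y (y_ z))
      ≡⟨ cong₂ (λ a b → n * a + m * b) (sumOver≡sum (λ x → dist A x (x_ z))) (sumOver≡sum (λ y → dist B y (y_ z))) ⟨
    n * weight A (x_ z) + m * weight B (y_ z) ∎
    where open ≡-Reasoning

  sum-LG : sum LG ≡ n * totLevel A + m * totLevel B
  sum-LG = trans (sum-remQuot-+ m n (level A) (level B))
    (sym (cong₂ (λ a b → n * a + m * b) (sumOver≡sum (level A)) (sumOver≡sum (level B))))

  weight-pair : ∀ x y → weight G (pair x y) ≡ n * weight A x + m * weight B y
  weight-pair x y = trans (weight-product (pair x y))
    (cong₂ (λ a b → n * weight A a + m * weight B b) (x-pair x y) (y-pair x y))

  -- The weight is a sum of one term per coordinate, so it is minimal exactly when both terms are.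
  -- Cancelling the factors `n` and `m` needs both trees nonempty, which the coordinates of `z`
  -- witness.
  isWC-product : ∀ z → isWC G z ≡ isWC A (x_ z) ∧ isWC B (y_ z)
  isWC-product z = T-injective forward backward
    where
    x = x_ z
    y = y_ z
    positive : ∀ {k} → Fin k → NonZero k
    positive {suc k} _ = _
    forward : T (isWC G z) → T (isWC A x ∧ isWC B y)
    forward h = from T-∧
      ( isWC-intro A x (λ x′ → *-cancelˡ-≤ n {{positive y}} (+-cancelʳ-≤ (m * weight B y) _ _
          (subst₂ _≤_ (weight-product z) (weight-pair x′ y) (isWC-elim G z h (pair x′ y)))))
      , isWC-intro B y (λ y′ → *-cancelˡ-≤ m {{positive x}} (+-cancelˡ-≤ (n * weight A x) _ _
          (subst₂ _≤_ (weight-product z) (weight-pair x y′) (isWC-elim G z h (pair x y′))))) )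
    backward : T (isWC A x ∧ isWC B y) → T (isWC G z)
    backward h = let a , b = to T-∧ h in isWC-intro G z (λ z′ →
      subst₂ _≤_ (sym (weight-product z)) (sym (weight-product z′))
        (+-mono-≤ (*-monoʳ-≤ n (isWC-elim A x a (x_ z′))) (*-monoʳ-≤ m (isWC-elim B y b (y_ z′)))))

  nW-product : nW G ≡ nW A * nW B
  nW-product = begin
    nW G
      ≡⟨ length-filterᵇ (isWC G) ⟩
    sum (λ z → ⟦ isWC G z ⟧)
      ≡⟨ sum-cong-≗ (λ z → cong ⟦_⟧ (isWC-product z)) ⟩
    sum (λ z → ⟦ isWC A (x_ z) ∧ isWC B (y_ z) ⟧)
      ≡⟨ sum-remQuot m n (λ (x , y) → ⟦ isWC A x ∧ isWC B y ⟧) ⟩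
    sum (λ x → sum (λ y → ⟦ isWC A x ∧ isWC B y ⟧))
      ≡⟨ sum-cong-≗ (λ x → inner (isWC A x)) ⟩
    sum (λ x → nW B * ⟦ isWC A x ⟧)
      ≡⟨ sum-*ˡ (nW B) (λ x → ⟦ isWC A x ⟧) ⟩
    nW B * sum (λ x → ⟦ isWC A x ⟧)
      ≡⟨ cong (λ s → nW B * s) (length-filterᵇ (isWC A)) ⟨
    nW B * nW A
      ≡⟨ *-comm (nW B) (nW A) ⟩
    nW A * nW B ∎
    where
    open ≡-Reasoning
    inner : ∀ a → sum (λ y → ⟦ a ∧ isWC B y ⟧) ≡ nW B * ⟦ a ⟧
    inner true  = trans (sym (length-filterᵇ (isWC B))) (sym (*-identityʳ (nW B)))
    inner false = trans (sum-const n 0) (trans (*-zeroʳ n) (sym (*-zeroʳ (nW B))))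

-- Labels along an ordering

-- A certificate for linear arithmetic: the hypotheses are added up to `c ≤ e`, `s` is the discarded
-- slack, and an identity for the ring solver remains.
≤-by : ∀ {a b c e} s → c ≤ e → a + e + s ≡ b + c → a ≤ b
≤-by {a} {b} {c} {e} s c≤e eq = +-cancelʳ-≤ e a b
  (≤-trans (m≤m+n (a + e) s) (≤-trans (≤-reflexive eq) (+-monoʳ-≤ b c≤e)))

≡-by : ∀ {a b c e} → c ≡ e → a + e ≡ b + c → a ≡ b
≡-by {a} {b} {e = e} refl eq = +-cancelʳ-≡ e a b eq

sumTo : ℕ → (ℕ → ℕ) → ℕ
sumTo zero    g = 0
sumTo (suc n) g = sumTo n g + g n

sumTo-const : ∀ n (g : ℕ → ℕ) c → (∀ t → t < n → g t ≡ c) → sumTo n g ≡ n * c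
sumTo-const zero    g c h = refl
sumTo-const (suc n) g c h = trans (cong₂ _+_ (sumTo-const n g c (λ t t<n → h t (m≤n⇒m≤1+n t<n))) (h n ≤-refl))
                                  (+-comm (n * c) c)

sumTo-two : ∀ s j (g : ℕ → ℕ) c c′ → (∀ t → t < s → g t ≡ c) → (∀ i → i < j → g (i + s) ≡ c′) →
            sumTo (j + s) g ≡ s * c + j * c′
sumTo-two s zero    g c c′ h h′ = trans (sumTo-const s g c h) (sym (+-identityʳ (s * c)))
sumTo-two s (suc j) g c c′ h h′ = trans
  (cong₂ _+_ (sumTo-two s j g c c′ h (λ i i<j → h′ i (m≤n⇒m≤1+n i<j))) (h′ j ≤-refl))
  (trans (+-assoc (s * c) (j * c′) c′) (cong (λ x → s * c + x) (+-comm (j * c′) c′)))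

sumTo-≡0 : ∀ n (g : ℕ → ℕ) → sumTo n g ≡ 0 → ∀ t → t < n → g t ≡ 0
sumTo-≡0 (suc n) g eq t t<1+n with m≤n⇒m<n∨m≡n (s≤s⁻¹ t<1+n)
... | inj₁ t<n  = sumTo-≡0 n g (m+n≡0⇒m≡0 (sumTo n g) eq) t t<n
... | inj₂ refl = m+n≡0⇒n≡0 (sumTo n g) eq

sumTo-≡1 : ∀ n (g : ℕ → ℕ) → sumTo n g ≡ 1 →
           ∃[ s ] s < n × g s ≡ 1 × (∀ t → t < n → t ≢ s → g t ≡ 0)
sumTo-≡1 (suc n) g eq with sumTo n g in sum≡ | g n in g≡
... | zero | zero  = contradiction eq λ ()
... | zero | suc x = n , ≤-refl , trans g≡ eq , λ t t<1+n t≢n →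
  sumTo-≡0 n g sum≡ t (≤∧≢⇒< (s≤s⁻¹ t<1+n) t≢n)
... | suc x | y = let s , s<n , gs , rest = sumTo-≡1 n g (trans sum≡ (cong suc (m+n≡0⇒m≡0 x xy≡0))) in
  s , m≤n⇒m≤1+n s<n , gs , λ t t<1+n t≢s → case m≤n⇒m<n∨m≡n (s≤s⁻¹ t<1+n) of λ
    { (inj₁ t<n) → rest t t<n t≢s ; (inj₂ refl) → trans g≡ (m+n≡0⇒n≡0 x xy≡0) }
  where
  xy≡0 : x + y ≡ 0
  xy≡0 = suc-injective eq

sumTo-single : ∀ n (g : ℕ → ℕ) j → j < n → (∀ i → i < n → i ≢ j → g i ≡ 0) → sumTo n g ≡ g j
sumTo-single (suc n) g j j<1+n h with m≤n⇒m<n∨m≡n (s≤s⁻¹ j<1+n)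
... | inj₁ j<n  = trans
  (cong₂ _+_ (sumTo-single n g j j<n (λ i i<n → h i (m≤n⇒m≤1+n i<n))) (h n ≤-refl (≢-sym (<⇒≢ j<n))))
  (+-identityʳ (g j))
... | inj₂ refl = cong (_+ g n)
  (trans (sumTo-const n g 0 (λ i i<n → h i (m≤n⇒m≤1+n i<n) (<⇒≢ i<n))) (*-zeroʳ n))

no-true : ∀ b → ¬ (b ≡ true) → ⟦ b ⟧ ≡ 0
no-true false _ = refl
no-true true  f = contradiction refl f

constant-from : ∀ {X : Set} (β : ℕ → X) s j → (∀ i → i < j → β (suc (i + s)) ≡ β (i + s)) → β (j + s) ≡ β s
constant-from β s zero    h = refl
constant-from β s (suc j) h = trans (h j ≤-refl) (constant-from β s j (λ i i<j → h i (m≤n⇒m≤1+n i<j)))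

-- Graphs enter only through these parameters. In the application `q` is `p - 1` and `h` is
-- `p / 2 - 1`; `half≡` makes `h` the only step that can cut the ordering into equal runs, and
-- `room` serves condition (b) at the two ends.
module Core {V : Set} (dist′ : V → V → ℕ) (L : V → ℕ) (φ δ : V → V → ℕ) (parity : V → Bool)
  (d ξ e₀ h q : ℕ) (four : Bool)
  (dist-eq     : ∀ u v → dist′ u v + 2 * φ u v ≡ L u + L v + δ u v)
  (δ≤ξ         : ∀ u v → δ u v ≤ ξ)
  (δ-opposite  : ∀ u v w → δ u v ≡ ξ → δ v w ≡ ξ → δ u w ≡ 0)
  (ξ≡2         : four ≡ true → ξ ≡ 2)
  (δ-mixed     : four ≡ true → ∀ u v w → δ u v + δ v w ≡ 3 → δ u w ≡ 1)
  (parity-keep : four ≡ true → ∀ u v → δ u v ≡ 2 → parity v ≡ parity u)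
  (parity-flip : four ≡ true → ∀ u v → δ u v ≡ 1 → parity v ≡ not (parity u))
  (room        : 2 * e₀ + 2 * ξ ≤ suc d)
  (h<q         : h < q)
  (half≡       : ∀ t → suc q ≡ suc t + suc t → t ≡ h)
  where

  middle : ℕ → Bool
  middle t = four ∧ (t ≡ᵇ h)

  middle⇒four : ∀ t → middle t ≡ true → four ≡ true
  middle⇒four t m = to T-≡ (proj₁ (to (T-∧ {four} {t ≡ᵇ h}) (from T-≡ m)))

  middle⇒≡ : ∀ t → middle t ≡ true → t ≡ h
  middle⇒≡ t m = ≡ᵇ⇒≡ _ _ (proj₂ (to (T-∧ {four}) (from T-≡ m)))

  middle-intro : ∀ t → four ≡ true → t ≡ h → middle t ≡ true
  middle-intro t f e = to T-≡ (from T-∧ (from T-≡ f , ≡⇒≡ᵇ _ _ e))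

  -- The exceptional positions of (b) are the two ends of the middle step.
  nearMiddle : ℕ → Bool
  nearMiddle zero    = middle zero
  nearMiddle (suc t) = middle (suc t) ∨ middle t

  nearMiddle⇒four : ∀ s → nearMiddle s ≡ true → four ≡ true
  nearMiddle⇒four zero    m = middle⇒four zero m
  nearMiddle⇒four (suc t) m =
      [ middle⇒four (suc t) ∘ to T-≡ , middle⇒four t ∘ to T-≡ ]′ (to (T-∨ {middle (suc t)}) (from T-≡ m))

  module Order (Z : ℕ → V) where

    ℓ : ℕ → ℕ
    ℓ t = L (Z t)

    inner : ℕ → ℕ → ℕ
    inner a k = sumTo k (λ i → ℓ (suc (i + a)))

    -- Among the `suc k` steps between the positions `a` and `a + k + 1` the middle one occurs at
    -- most once, and exactly in the exceptional case of (c).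
    midCount : ℕ → ℕ → ℕ
    midCount a k = sumTo (suc k) (λ i → ⟦ middle (i + a) ⟧)

    -- Condition (c) for the positions a and a + k + 1, doubled and without subtraction.
    CBound : ℕ → ℕ → Set
    CBound a k = 2 * φ (Z a) (Z (suc k + a)) + 2 * inner a k + suc k * ξ
                   ≤ k * suc d + δ (Z a) (Z (suc k + a)) + midCount a k

    -- Since `δ` loses one unit exactly at the middle step, `δ-full` covers both clauses of
    -- feasibility.
    record Good : Set where
      field
        φ-zero : ∀ t → t < q → φ (Z t) (Z (suc t)) ≡ 0
        δ-full : ∀ t → t < q → δ (Z t) (Z (suc t)) + ⟦ middle t ⟧ ≡ ξ
        condA  : ℓ 0 + ℓ q ≡ e₀
        condB  : ∀ s → s ≤ q → 2 * ℓ s + 2 * ξ ≤ suc d + 2 * ⟦ nearMiddle s ⟧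
        condC  : ∀ a k → suc k + a ≤ q →
                 ¬ (φ (Z a) (Z (suc k + a)) ≡ 0 × δ (Z a) (Z (suc k + a)) ≡ ξ) → CBound a k

    Step : (ℕ → ℕ) → (ℕ → ℕ) → ℕ → Set
    Step F g t = F (suc t) + (ℓ t + ℓ (suc t) + ξ) ≡ F t + (suc d + g t)

    RadioSeq : (ℕ → ℕ) → Set
    RadioSeq F = ∀ a k → suc k + a ≤ q → F a + suc d ≤ F (suc k + a) + dist′ (Z a) (Z (suc k + a))

    -- Telescoping: an inner level enters two steps and an end level only one, so doubling the whole
    -- sum of levels leaves `ℓ 0 + ℓ n` on the right.
    total : ∀ F g n → (∀ t → t < n → Step F g t) →
            F n + (2 * sumTo (suc n) ℓ + n * ξ) ≡ F 0 + (n * suc d + (ℓ 0 + ℓ n) + sumTo n g)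
    total F g zero    _  = base (F 0) (ℓ 0)
      where
      base : ∀ f l → f + (2 * (0 + l) + 0) ≡ f + (0 + (l + l) + 0)
      base = solve-∀
    total F g (suc n) st = arith (F 0) (F n) (F (suc n)) (ℓ 0) (ℓ n) (ℓ (suc n))
        (sumTo (suc n) ℓ) (sumTo n g) (g n) n d ξ
      (total F g n (λ t t<n → st t (m≤n⇒m≤1+n t<n))) (st n ≤-refl)
      where
      arith : ∀ f₀ f f′ l₀ l l′ S G g n d ξ →
              f + (2 * S + n * ξ) ≡ f₀ + (n * suc d + (l₀ + l) + G) →
              f′ + (l + l′ + ξ) ≡ f + (suc d + g) →
              f′ + (2 * (S + l′) + suc n * ξ) ≡ f₀ + (suc n * suc d + (l₀ + l′) + (G + g))
      arith f₀ f f′ l₀ l l′ S G g n d ξ e₁ e₂ = ≡-by (cong₂ _+_ e₁ e₂)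
        (solve (f₀ ⨟ f ⨟ f′ ⨟ l₀ ⨟ l ⨟ l′ ⨟ S ⨟ G ⨟ g ⨟ n ⨟ d ⨟ ξ ⨟ []))

    Tight : (ℕ → ℕ) → Set
    Tight F = ∀ t → t < q → Step F (λ t → ⟦ middle t ⟧) t

    interval : ∀ F → Tight F → ∀ a k → suc k + a ≤ q →
               F (suc k + a) + (ℓ a + ℓ (suc k + a) + 2 * inner a k + suc k * ξ)
                 ≡ F a + (suc k * suc d + midCount a k)
    interval F tight a zero    a<q = base (F a) (F (suc a)) (ℓ a) (ℓ (suc a)) d ξ ⟦ middle a ⟧ (tight a a<q)
      where
      base : ∀ f f′ l l′ d ξ g → f′ + (l + l′ + ξ) ≡ f + (suc d + g) →
             f′ + (l + l′ + 2 * 0 + 1 * ξ) ≡ f + (1 * suc d + (0 + g))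
      base f f′ l l′ d ξ g e = ≡-by e (solve (f ⨟ f′ ⨟ l ⨟ l′ ⨟ d ⨟ ξ ⨟ g ⨟ []))
    interval F tight a (suc k) k<q =
      arith (F a) (F b) (F (suc b)) (ℓ a) (ℓ b) (ℓ (suc b)) (inner a k) (midCount a k) ⟦ middle b ⟧ k d ξ
        (interval F tight a k (<⇒≤ k<q)) (tight b k<q)
      where
      b = suc k + a
      arith : ∀ f₀ f f′ l₀ l l′ S G g k d ξ →
              f + (l₀ + l + 2 * S + suc k * ξ) ≡ f₀ + (suc k * suc d + G) →
              f′ + (l + l′ + ξ) ≡ f + (suc d + g) →
              f′ + (l₀ + l′ + 2 * (S + l) + suc (suc k) * ξ) ≡ f₀ + (suc (suc k) * suc d + (G + g))
      arith f₀ f f′ l₀ l l′ S G g k d ξ e₁ e₂ = ≡-by (cong₂ _+_ e₁ e₂)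
        (solve (f₀ ⨟ f ⨟ f′ ⨟ l₀ ⨟ l ⨟ l′ ⨟ S ⨟ G ⨟ g ⨟ k ⨟ d ⨟ ξ ⨟ []))

    -- `interval` gives the difference of the labels and `dist-eq` the distance. The levels of the
    -- two ends cancel, so for tight labels the radio inequality of a pair is equivalent to
    -- `CBound`.
    CBound⇒radio : ∀ F → Tight F → ∀ a k → suc k + a ≤ q → CBound a k →
                   F a + suc d ≤ F (suc k + a) + dist′ (Z a) (Z (suc k + a))
    CBound⇒radio F tight a k le =
      arith (F a) (F (suc k + a)) (ℓ a) (ℓ (suc k + a)) (inner a k) k
        (φ (Z a) (Z (suc k + a))) (δ (Z a) (Z (suc k + a))) (dist′ (Z a) (Z (suc k + a))) (midCount a k) ξ d
        (interval F tight a k le) (dist-eq (Z a) (Z (suc k + a)))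
      where
      arith : ∀ f f′ l l′ S k p e D I ξ d →
              f′ + (l + l′ + 2 * S + suc k * ξ) ≡ f + (suc k * suc d + I) → D + 2 * p ≡ l + l′ + e →
              2 * p + 2 * S + suc k * ξ ≤ k * suc d + e + I → f + suc d ≤ f′ + D
      arith f f′ l l′ S k p e D I ξ d h₁ h₂ h₃ =
        ≤-by 0 (+-mono-≤ (+-mono-≤ (≤-reflexive (sym h₁)) (≤-reflexive (sym h₂))) h₃)
          (solve (f ⨟ f′ ⨟ l ⨟ l′ ⨟ S ⨟ k ⨟ p ⨟ e ⨟ D ⨟ I ⨟ ξ ⨟ d ⨟ []))

    radio⇒CBound : ∀ F → Tight F → RadioSeq F → ∀ a k → suc k + a ≤ q → CBound a k
    radio⇒CBound F tight radio a k le =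
      arith (F a) (F (suc k + a)) (ℓ a) (ℓ (suc k + a)) (inner a k) k
        (φ (Z a) (Z (suc k + a))) (δ (Z a) (Z (suc k + a))) (dist′ (Z a) (Z (suc k + a))) (midCount a k) ξ d
        (interval F tight a k le) (dist-eq (Z a) (Z (suc k + a))) (radio a k le)
      where
      arith : ∀ f f′ l l′ S k p e D I ξ d →
              f′ + (l + l′ + 2 * S + suc k * ξ) ≡ f + (suc k * suc d + I) → D + 2 * p ≡ l + l′ + e →
              f + suc d ≤ f′ + D → 2 * p + 2 * S + suc k * ξ ≤ k * suc d + e + I
      arith f f′ l l′ S k p e D I ξ d h₁ h₂ h₃ =
        ≤-by 0 (+-mono-≤ (+-mono-≤ (≤-reflexive h₁) (≤-reflexive h₂)) h₃)
          (solve (f ⨟ f′ ⨟ l ⨟ l′ ⨟ S ⨟ k ⨟ p ⨟ e ⨟ D ⨟ I ⨟ ξ ⨟ d ⨟ []))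

    -- The labels defined by an ordering

    module Sufficiency (good : Good) where

      open Good good

      2nearMiddle≤ξ : ∀ s → 2 * ⟦ nearMiddle s ⟧ ≤ ξ
      2nearMiddle≤ξ s with nearMiddle s in eq
      ... | false = z≤n
      ... | true  = ≤-reflexive (sym (ξ≡2 (nearMiddle⇒four s eq)))

      -- The exception in (b) occurs only with `ξ = 2`, so giving up one `ξ` absorbs it. The weaker
      -- bound holds at all positions and can be summed.
      2ℓ+ξ≤ : ∀ s → s ≤ q → 2 * ℓ s + ξ ≤ suc d
      2ℓ+ξ≤ s s≤q = arith (ℓ s) ξ d ⟦ nearMiddle s ⟧ (condB s s≤q) (2nearMiddle≤ξ s)
        where
        arith : ∀ l ξ d x → 2 * l + 2 * ξ ≤ suc d + 2 * x → 2 * x ≤ ξ → 2 * l + ξ ≤ suc d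
        arith l ξ d x h₁ h₂ = ≤-by 0 (+-mono-≤ h₁ h₂) (solve (l ⨟ ξ ⨟ d ⨟ x ⨟ []))

      gap-fits : ∀ t → t < q → ℓ t + ℓ (suc t) + ξ ≤ suc d
      gap-fits t t<q = arith (ℓ t) (ℓ (suc t)) ξ d (2ℓ+ξ≤ t (<⇒≤ t<q)) (2ℓ+ξ≤ (suc t) t<q)
        where
        arith : ∀ l l′ ξ d → 2 * l + ξ ≤ suc d → 2 * l′ + ξ ≤ suc d → l + l′ + ξ ≤ suc d
        arith l l′ ξ d h₁ h₂ = *-cancelˡ-≤ 2 (≤-by 0 (+-mono-≤ h₁ h₂) (solve (l ⨟ l′ ⨟ ξ ⨟ d ⨟ [])))

      -- By `gap-fits` the truncated subtraction is exact. This form also makes `F` monotone, so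
      -- that the absolute values in the radio inequality can be resolved.
      F : ℕ → ℕ
      F zero    = 0
      F (suc t) = F t + ((suc d + ⟦ middle t ⟧) ∸ (ℓ t + ℓ (suc t) + ξ))

      tight : Tight F
      tight t t<q = trans (+-assoc (F t) _ _) (cong (λ x → F t + x)
        (m∸n+n≡m (≤-trans (gap-fits t t<q) (m≤m+n (suc d) ⟦ middle t ⟧))))

      F-mono : ∀ i a → F a ≤ F (i + a)
      F-mono zero    a = ≤-refl
      F-mono (suc i) a = ≤-trans (F-mono i a) (m≤m+n _ _)

      inner-bound : ∀ a k → suc k + a ≤ q → 2 * inner a k + k * ξ ≤ k * suc d
      inner-bound a zero    _  = z≤n
      inner-bound a (suc k) le = arith (inner a k) (ℓ (suc (k + a))) k ξ d
        (inner-bound a k (<⇒≤ le)) (2ℓ+ξ≤ (suc (k + a)) (<⇒≤ le))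
        where
        arith : ∀ S l k ξ d → 2 * S + k * ξ ≤ k * suc d → 2 * l + ξ ≤ suc d →
                2 * (S + l) + suc k * ξ ≤ suc k * suc d
        arith S l k ξ d h₁ h₂ = ≤-by 0 (+-mono-≤ h₁ h₂) (solve (S ⨟ l ⨟ k ⨟ ξ ⨟ d ⨟ []))

      -- Condition (c) is silent on feasible pairs; for them `φ = 0` and `δ = ξ`, and the sum of the
      -- bounds from (b) suffices.
      feasible⇒CBound : ∀ a k → suc k + a ≤ q →
                        φ (Z a) (Z (suc k + a)) ≡ 0 → δ (Z a) (Z (suc k + a)) ≡ ξ → CBound a k
      feasible⇒CBound a k le φ0 δξ = subst₂ (λ x y → 2 * x + 2 * inner a k + suc k * ξ ≤ k * suc d + y + midCount a k)
        (sym φ0) (sym δξ)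
        (arith (inner a k) k ξ d (midCount a k) (inner-bound a k le))
        where
        arith : ∀ S k ξ d I → 2 * S + k * ξ ≤ k * suc d → 2 * 0 + 2 * S + suc k * ξ ≤ k * suc d + ξ + I
        arith S k ξ d I h = ≤-by I h (solve (S ⨟ k ⨟ ξ ⨟ d ⨟ I ⨟ []))

      radio : RadioSeq F
      radio a k le with φ (Z a) (Z (suc k + a)) ≟ 0 | δ (Z a) (Z (suc k + a)) ≟ ξ
      ... | yes φ0 | yes δξ = CBound⇒radio F tight a k le (feasible⇒CBound a k le φ0 δξ)
      ... | no φ≢0 | _      = CBound⇒radio F tight a k le (condC a k le (φ≢0 ∘ proj₁))
      ... | _      | no δ≢ξ = CBound⇒radio F tight a k le (condC a k le (δ≢ξ ∘ proj₂))

      middle-total : sumTo q (λ t → ⟦ middle t ⟧) ≡ ⟦ four ⟧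
      middle-total = trans
        (sumTo-single q (λ t → ⟦ middle t ⟧) h h<q (λ t _ t≢h → no-true (middle t) (λ m → t≢h (middle⇒≡ t m))))
        (cong ⟦_⟧ (T-injective (proj₁ ∘ to (T-∧ {four})) (λ f → from T-∧ (f , ≡⇒≡ᵇ h h refl))))

      span-value : F q + (2 * sumTo (suc q) ℓ + q * ξ) ≡ q * suc d + e₀ + ⟦ four ⟧
      span-value = trans (total F _ q tight) (cong₂ (λ x y → q * suc d + x + y) condA middle-total)

    -- The lower bound and the case of equality

    module LowerBound (ends : e₀ ≤ ℓ 0 + ℓ q)
      (balanced : four ≡ true → sumTo (suc q) (λ t → ⟦ parity (Z t) ⟧) ≡ sumTo (suc q) (λ t → ⟦ not (parity (Z t)) ⟧))
      (F : ℕ → ℕ) (radio : RadioSeq F) where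

      φ₁ δ₁ : ℕ → ℕ
      φ₁ t = φ (Z t) (Z (suc t))
      δ₁ t = δ (Z t) (Z (suc t))

      -- How far the step from Z t to Z (t + 1) exceeds the value it has when φ = 0 and δ = ξ
      -- and the radio inequality is tight.
      excess : ℕ → ℕ
      excess t = (F (suc t) + (ℓ t + ℓ (suc t) + ξ)) ∸ (F t + suc d)

      excess-step : ∀ t → t < q → Step F excess t
      excess-step t t<q = sym (trans (sym (+-assoc (F t) (suc d) (excess t))) (m+[n∸m]≡n
        (arith (F t) (F (suc t)) (ℓ t) (ℓ (suc t)) (φ₁ t) (δ₁ t) (dist′ (Z t) (Z (suc t))) ξ d
          (radio t 0 t<q) (dist-eq (Z t) (Z (suc t))) (δ≤ξ (Z t) (Z (suc t))))))
        where
        arith : ∀ f f′ l l′ p e D ξ d → f + suc d ≤ f′ + D → D + 2 * p ≡ l + l′ + e → e ≤ ξ →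
                f + suc d ≤ f′ + (l + l′ + ξ)
        arith f f′ l l′ p e D ξ d h₁ h₂ h₃ = ≤-by (2 * p) (+-mono-≤ h₁ (+-mono-≤ (≤-reflexive h₂) h₃))
          (solve (f ⨟ f′ ⨟ l ⨟ l′ ⨟ p ⨟ e ⨟ D ⨟ ξ ⨟ d ⨟ []))

      -- The excess pays for `2φ` and for `ξ - δ`; whatever remains is the slack of the radio
      -- inequality.
      excess-bound : ∀ t → t < q → 2 * φ₁ t + ξ ≤ excess t + δ₁ t
      excess-bound t t<q = arith (F t) (F (suc t)) (ℓ t) (ℓ (suc t)) (φ₁ t) (δ₁ t)
        (dist′ (Z t) (Z (suc t))) ξ d (excess t)
        (radio t 0 t<q) (dist-eq (Z t) (Z (suc t))) (excess-step t t<q)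
        where
        arith : ∀ f f′ l l′ p e D ξ d g → f + suc d ≤ f′ + D → D + 2 * p ≡ l + l′ + e →
                f′ + (l + l′ + ξ) ≡ f + (suc d + g) → 2 * p + ξ ≤ g + e
        arith f f′ l l′ p e D ξ d g h₁ h₂ h₃ = ≤-by 0 (+-mono-≤ h₁ (+-mono-≤ (≤-reflexive h₂) (≤-reflexive h₃)))
          (solve (f ⨟ f′ ⨟ l ⨟ l′ ⨟ p ⨟ e ⨟ D ⨟ ξ ⨟ d ⨟ g ⨟ []))

      no-excess : ∀ t → t < q → excess t ≡ 0 → φ₁ t ≡ 0 × δ₁ t ≡ ξ
      no-excess t t<q g0 = m+n≡0⇒m≡0 (φ₁ t) (n≤0⇒n≡0 two-φ) , ≤-antisym (δ≤ξ (Z t) (Z (suc t))) ξ≤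
        where
        bound : 2 * φ₁ t + ξ ≤ δ₁ t
        bound = subst (λ g → 2 * φ₁ t + ξ ≤ g + δ₁ t) g0 (excess-bound t t<q)
        two-φ : 2 * φ₁ t ≤ 0
        two-φ = +-cancelʳ-≤ ξ (2 * φ₁ t) 0 (≤-trans bound (δ≤ξ (Z t) (Z (suc t))))
        ξ≤ : ξ ≤ δ₁ t
        ξ≤ = ≤-trans (m≤n+m ξ (2 * φ₁ t)) bound

      -- A parity that never changes along the ordering would be unbalanced.
      not-all-opposite : four ≡ true → ¬ (∀ t → t < q → δ₁ t ≡ 2)
      not-all-opposite f all2 = unbalanced (parity (Z 0)) (trans (sym (sums ⟦_⟧)) (trans (balanced f) (sums (⟦_⟧ ∘ not))))
        where
        const : ∀ t → t < suc q → parity (Z t) ≡ parity (Z 0)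
        const t t≤q = trans (cong (parity ∘ Z) (sym (+-identityʳ t)))
          (constant-from (parity ∘ Z) 0 t (λ i i<t → parity-keep f _ _
            (all2 (i + 0) (subst (_< q) (sym (+-identityʳ i)) (<-≤-trans i<t (s≤s⁻¹ t≤q))))))
        sums : (g : Bool → ℕ) → sumTo (suc q) (λ t → g (parity (Z t))) ≡ suc q * g (parity (Z 0))
        sums g = sumTo-const (suc q) _ _ (λ t t<p → cong g (const t t<p))
        unbalanced : ∀ b → suc q * ⟦ b ⟧ ≢ suc q * ⟦ not b ⟧
        unbalanced true  eq = 1+n≢0 (trans eq (*-zeroʳ q))
        unbalanced false eq = 1+n≢0 (trans (sym eq) (*-zeroʳ q))

      excess-total : ⟦ four ⟧ ≤ sumTo q excess
      excess-total = cases four refl (sumTo q excess) refl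
        where
        cases : ∀ b → four ≡ b → ∀ n → sumTo q excess ≡ n → ⟦ b ⟧ ≤ n
        cases false _ _       _ = z≤n
        cases true  _ (suc _) _ = s≤s z≤n
        -- Without any excess every step has `δ = ξ = 2`.
        cases true  f zero    s = ⊥-elim (not-all-opposite f (λ t t<q →
          trans (proj₂ (no-excess t t<q (sumTo-≡0 q excess s t t<q))) (ξ≡2 f)))

      lower-bound : F 0 + (q * suc d + e₀ + ⟦ four ⟧) ≤ F q + (2 * sumTo (suc q) ℓ + q * ξ)
      lower-bound = ≤-trans
        (+-monoʳ-≤ (F 0) (+-mono-≤ (+-monoʳ-≤ (q * suc d) ends) excess-total))
        (≤-reflexive (sym (total F excess q excess-step)))

      module Equality (attained : F q + (2 * sumTo (suc q) ℓ + q * ξ) ≡ F 0 + (q * suc d + e₀ + ⟦ four ⟧)) where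

        balance : (ℓ 0 + ℓ q) + sumTo q excess ≡ e₀ + ⟦ four ⟧
        balance = arith (F 0) (q * suc d) (ℓ 0 + ℓ q) (sumTo q excess) e₀ ⟦ four ⟧
          (trans (sym (total F excess q excess-step)) attained)
          where
          arith : ∀ f a l s e m → f + (a + l + s) ≡ f + (a + e + m) → l + s ≡ e + m
          arith f a l s e m h = ≡-by h (solve (f ⨟ a ⨟ l ⨟ s ⨟ e ⨟ m ⨟ []))

        -- The end levels and the total excess are bounded below separately, so equality of the sums
        -- forces equality in both bounds.
        ends≡ : ℓ 0 + ℓ q ≡ e₀
        ends≡ = ≤-antisym (+-cancelʳ-≤ ⟦ four ⟧ _ _
          (≤-trans (+-monoʳ-≤ (ℓ 0 + ℓ q) excess-total) (≤-reflexive balance))) ends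

        excess≡ : sumTo q excess ≡ ⟦ four ⟧
        excess≡ = +-cancelˡ-≡ e₀ _ _ (trans (cong (_+ sumTo q excess) (sym ends≡)) balance)

        -- Two runs of constant, opposite parity can only balance when they have equal length.
        spike-position : four ≡ true → ∀ s → s < q → δ₁ s ≡ 1 → (∀ t → t < q → t ≢ s → δ₁ t ≡ 2) → s ≡ h
        spike-position f s s<q δs δ-rest with ≤⇒∃ s<q
          where
          ≤⇒∃ : suc s ≤ q → ∃[ j ] q ≡ j + suc s
          ≤⇒∃ le = q ∸ suc s , sym (m∸n+n≡m le)
        ... | j , q≡ = half≡ s (trans (cong suc q≡) (cong (_+ suc s) (sym same-length)))
          where
          first : ∀ t → t < suc s → parity (Z t) ≡ parity (Z 0)
          first t t≤s = trans (cong (parity ∘ Z) (sym (+-identityʳ t)))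
            (constant-from (parity ∘ Z) 0 t (λ i i<t →
              let i<s = subst (_< s) (sym (+-identityʳ i)) (<-≤-trans i<t (s≤s⁻¹ t≤s))
              in parity-keep f _ _ (δ-rest (i + 0) (<-trans i<s s<q) (<⇒≢ i<s))))
          second : ∀ i → i < suc j → parity (Z (i + suc s)) ≡ not (parity (Z 0))
          second i i≤j = trans
            (constant-from (parity ∘ Z) (suc s) i (λ i′ i′<i → parity-keep f _ _
              (δ-rest (i′ + suc s)
                (subst (i′ + suc s <_) (sym q≡) (+-monoˡ-< (suc s) (<-≤-trans i′<i (s≤s⁻¹ i≤j))))
                (≢-sym (<⇒≢ (m≤n+m (suc s) i′))))))
            (trans (parity-flip f _ _ δs) (cong not (first s ≤-refl)))
          sums : (g : Bool → ℕ) → sumTo (suc q) (λ t → g (parity (Z t))) ≡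
                                  suc s * g (parity (Z 0)) + suc j * g (not (parity (Z 0)))
          sums g = trans (cong (λ n → sumTo (suc n) (λ t → g (parity (Z t)))) q≡)
            (sumTo-two (suc s) (suc j) _ _ _ (λ t t≤s → cong g (first t t≤s)) (λ i i≤j → cong g (second i i≤j)))
          lengths : ∀ b → suc s * ⟦ b ⟧ + suc j * ⟦ not b ⟧ ≡ suc s * ⟦ not b ⟧ + suc j * ⟦ not (not b) ⟧ → suc s ≡ suc j
          lengths true  e = ≡-by e (solve (s ⨟ j ⨟ []))
          lengths false e = ≡-by (sym e) (solve (s ⨟ j ⨟ []))
          same-length : suc s ≡ suc j
          same-length = lengths (parity (Z 0)) (trans (sym (sums ⟦_⟧)) (trans (balanced f) (sums (⟦_⟧ ∘ not))))

        excess-1 : four ≡ true → ∀ t → t < q → excess t ≡ 1 → φ₁ t ≡ 0 × 1 ≤ δ₁ t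
        excess-1 f t t<q g1 = small (φ₁ t) 2φ≤1 ,
          +-cancelˡ-≤ 1 1 (δ₁ t) (≤-trans (m≤n+m 2 (2 * φ₁ t)) bound)
          where
          bound : 2 * φ₁ t + 2 ≤ 1 + δ₁ t
          bound = subst₂ (λ x g → 2 * φ₁ t + x ≤ g + δ₁ t) (ξ≡2 f) g1 (excess-bound t t<q)
          2φ≤1 : 2 * φ₁ t ≤ 1
          2φ≤1 = +-cancelʳ-≤ 2 (2 * φ₁ t) 1 (≤-trans bound (s≤s (subst (δ₁ t ≤_) (ξ≡2 f) (δ≤ξ (Z t) (Z (suc t))))))
          small : ∀ x → 2 * x ≤ 1 → x ≡ 0
          small zero    _ = refl
          small (suc x) h = contradiction (≤-trans (≤-reflexive (cong suc (sym (+-suc x (x + 0))))) h) λ { (s≤s ()) }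

        steps : ∀ t → t < q → excess t ≡ ⟦ middle t ⟧ × φ₁ t ≡ 0 × δ₁ t + ⟦ middle t ⟧ ≡ ξ
        steps t t<q = cases four refl
          where
          zero-step : middle t ≡ false → excess t ≡ 0 → excess t ≡ ⟦ middle t ⟧ × φ₁ t ≡ 0 × δ₁ t + ⟦ middle t ⟧ ≡ ξ
          zero-step m g0 rewrite m = let φ0 , δξ = no-excess t t<q g0 in g0 , φ0 , trans (+-identityʳ _) δξ
          cases : ∀ b → four ≡ b → excess t ≡ ⟦ middle t ⟧ × φ₁ t ≡ 0 × δ₁ t + ⟦ middle t ⟧ ≡ ξ
          cases false f = zero-step (cong (_∧ (t ≡ᵇ h)) f) (sumTo-≡0 q excess (trans excess≡ (cong ⟦_⟧ f)) t t<q)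
          cases true  f with sumTo-≡1 q excess (trans excess≡ (cong ⟦_⟧ f))
          ... | s , s<q , gs , rest = at-or-off
            where
            full : ∀ t → t < q → t ≢ s → δ₁ t ≡ 2
            full t t<q t≢s = trans (proj₂ (no-excess t t<q (rest t t<q t≢s))) (ξ≡2 f)
            δs : δ₁ s ≡ 1
            δs with δ₁ s in e | proj₂ (excess-1 f s s<q gs) | subst (δ₁ s ≤_) (ξ≡2 f) (δ≤ξ (Z s) (Z (suc s)))
            ... | suc zero | _ | _ = refl
            -- The unit of excess could be mere slack with `δ = 2`; but then all steps would have
            -- `δ = 2`.
            ... | suc (suc zero) | _ | _ = ⊥-elim (not-all-opposite f λ t t<q → case t ≟ s of λ
              { (yes refl) → e ; (no t≢s) → full t t<q t≢s })
            ... | suc (suc (suc _)) | _ | s≤s (s≤s ())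
            s≡h : s ≡ h
            s≡h = spike-position f s s<q δs full
            at-or-off : excess t ≡ ⟦ middle t ⟧ × φ₁ t ≡ 0 × δ₁ t + ⟦ middle t ⟧ ≡ ξ
            at-or-off with t ≟ s
            ... | yes refl rewrite middle-intro t f s≡h =
              gs , proj₁ (excess-1 f s s<q gs) , trans (cong (_+ 1) δs) (sym (ξ≡2 f))
            ... | no t≢s = zero-step (off refl) (rest t t<q t≢s)
              where
              off : ∀ {b} → middle t ≡ b → middle t ≡ false
              off {false} m = m
              off {true}  m = contradiction (trans (middle⇒≡ t m) (sym s≡h)) t≢s

        tight : Tight F
        tight t t<q = trans (excess-step t t<q) (cong (λ g → F t + (suc d + g)) (proj₁ (steps t t<q)))

        -- An end of the ordering has a neighbour on one side only, so (b) cannot come from a pair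
        -- around it. Its level is at most `e₀`, and the diameters leave enough room.
        end-bound : ∀ s → ℓ s ≤ e₀ → 2 * ℓ s + 2 * ξ ≤ suc d + 2 * ⟦ nearMiddle s ⟧
        end-bound s ℓ≤ = ≤-trans (≤-trans (+-monoˡ-≤ (2 * ξ) (*-monoʳ-≤ 2 ℓ≤)) room) (m≤m+n (suc d) _)

        -- Two full steps lead back to the same sides, so `δ` vanishes. If one of them is the middle
        -- step, the two values of `δ` add up to three and exactly one side changes; with the unit
        -- of the middle step this makes two.
        skip : ∀ t → suc t < q →
               δ (Z t) (Z (suc (suc t))) + (⟦ middle t ⟧ + ⟦ middle (suc t) ⟧) ≤ 2 * ⟦ nearMiddle (suc t) ⟧
        skip t t<q with middle t in m | middle (suc t) in m′
                      | proj₂ (proj₂ (steps t (<⇒≤ t<q))) | proj₂ (proj₂ (steps (suc t) t<q))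
        ... | false | false | δt | δt′ = ≤-reflexive (trans (+-identityʳ _)
          (δ-opposite _ (Z (suc t)) _ (trans (sym (+-identityʳ _)) δt) (trans (sym (+-identityʳ _)) δt′)))
        ... | true  | true  | _ | _ = contradiction (trans (middle⇒≡ (suc t) m′) (sym (middle⇒≡ t m))) 1+n≢n
        ... | true  | false | δt | δt′ = ≤-reflexive (cong (_+ 1)
          (δ-mixed f _ (Z (suc t)) _ (arith (δ₁ t) (δ₁ (suc t)) (trans δt (ξ≡2 f)) (trans δt′ (ξ≡2 f)))))
          where
          f = middle⇒four t m
          arith : ∀ a b → a + 1 ≡ 2 → b + 0 ≡ 2 → a + b ≡ 3
          arith a b h₁ h₂ = ≡-by (cong₂ _+_ h₁ h₂) (solve (a ⨟ b ⨟ []))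
        ... | false | true  | δt | δt′ = ≤-reflexive (cong (_+ 1)
          (δ-mixed f _ (Z (suc t)) _ (arith (δ₁ t) (δ₁ (suc t)) (trans δt (ξ≡2 f)) (trans δt′ (ξ≡2 f)))))
          where
          f = middle⇒four (suc t) m′
          arith : ∀ a b → a + 0 ≡ 2 → b + 1 ≡ 2 → a + b ≡ 3
          arith a b h₁ h₂ = ≡-by (cong₂ _+_ h₁ h₂) (solve (a ⨟ b ⨟ []))

        good : Good
        good = record
          { φ-zero = λ t t<q → proj₁ (proj₂ (steps t t<q))
          ; δ-full = λ t t<q → proj₂ (proj₂ (steps t t<q))
          ; condA  = ends≡
          ; condB  = bound
          ; condC  = λ a k le _ → radio⇒CBound F tight radio a k le
          }
          where
          bound : ∀ s → s ≤ q → 2 * ℓ s + 2 * ξ ≤ suc d + 2 * ⟦ nearMiddle s ⟧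
          bound zero    _   = end-bound 0 (≤-trans (m≤m+n (ℓ 0) (ℓ q)) (≤-reflexive ends≡))
          bound (suc t) t<q with m≤n⇒m<n∨m≡n t<q
          ... | inj₂ refl   = end-bound (suc t) (≤-trans (m≤n+m (ℓ q) (ℓ 0)) (≤-reflexive ends≡))
          ... | inj₁ 1+t<q  = arith (φ (Z t) (Z (suc (suc t)))) (δ (Z t) (Z (suc (suc t)))) (ℓ (suc t)) ξ d
            ⟦ middle t ⟧ ⟦ middle (suc t) ⟧ ⟦ nearMiddle (suc t) ⟧
            (radio⇒CBound F tight radio t 1 1+t<q) (skip t 1+t<q)
            where
            arith : ∀ p e l ξ d m m′ x → 2 * p + 2 * (0 + l) + 2 * ξ ≤ 1 * suc d + e + (0 + m + m′) →
                    e + (m + m′) ≤ 2 * x → 2 * l + 2 * ξ ≤ suc d + 2 * x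
            arith p e l ξ d m m′ x h₁ h₂ = ≤-by (2 * p) (+-mono-≤ h₁ h₂)
              (solve (p ⨟ e ⨟ l ⨟ ξ ⨟ d ⨟ m ⨟ m′ ⨟ x ⨟ []))

-- Arithmetic of the four cases and sorting by labels

-- Statements about finitely many Booleans are proved by evaluation; those below describe how sides
-- and parity change along one or two steps.
∀Bool? : {P : Bool → Set} → (∀ b → Dec (P b)) → Dec (∀ b → P b)
∀Bool? P? = map′ (λ { (t , f) true → t ; (t , f) false → f }) (λ h → h true , h false) (P? true ×-dec P? false)

xor-transitive : ∀ a b c → ⟦ a xor b ⟧ ≡ ⟦ b xor c ⟧ → ⟦ a xor c ⟧ ≡ 0
xor-transitive = from-yes (∀Bool? λ a → ∀Bool? λ b → ∀Bool? λ c →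
  (⟦ a xor b ⟧ ≟ ⟦ b xor c ⟧) →-dec (⟦ a xor c ⟧ ≟ 0))

three-flips : ∀ a a′ b b′ c c′ →
              (⟦ a xor b ⟧ + ⟦ a′ xor b′ ⟧) + (⟦ b xor c ⟧ + ⟦ b′ xor c′ ⟧) ≡ 3 → ⟦ a xor c ⟧ + ⟦ a′ xor c′ ⟧ ≡ 1
three-flips = from-yes (∀Bool? λ a → ∀Bool? λ a′ → ∀Bool? λ b → ∀Bool? λ b′ → ∀Bool? λ c → ∀Bool? λ c′ →
  ((⟦ a xor b ⟧ + ⟦ a′ xor b′ ⟧) + (⟦ b xor c ⟧ + ⟦ b′ xor c′ ⟧) ≟ 3) →-dec (⟦ a xor c ⟧ + ⟦ a′ xor c′ ⟧ ≟ 1))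

two-flips : ∀ a a′ b b′ → ⟦ a xor b ⟧ + ⟦ a′ xor b′ ⟧ ≡ 2 → b xor b′ ≡ a xor a′
two-flips = from-yes (∀Bool? λ a → ∀Bool? λ a′ → ∀Bool? λ b → ∀Bool? λ b′ →
  (⟦ a xor b ⟧ + ⟦ a′ xor b′ ⟧ ≟ 2) →-dec (b xor b′ Bool.≟ a xor a′))

one-flip : ∀ a a′ b b′ → ⟦ a xor b ⟧ + ⟦ a′ xor b′ ⟧ ≡ 1 → b xor b′ ≡ not (a xor a′)
one-flip = from-yes (∀Bool? λ a → ∀Bool? λ a′ → ∀Bool? λ b → ∀Bool? λ b′ →
  (⟦ a xor b ⟧ + ⟦ a′ xor b′ ⟧ ≟ 1) →-dec (b xor b′ Bool.≟ not (a xor a′)))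

xor≤κ : ∀ {V : Set} κ (s : V → Bool) → κ ≡ 0 ⊎ κ ≡ 1 → (κ ≡ 0 → ∀ u → s u ≡ true) → ∀ u v → ⟦ s u xor s v ⟧ ≤ κ
xor≤κ κ s (inj₁ refl) one u v rewrite one refl u | one refl v = z≤n
xor≤κ κ s (inj₂ refl) one u v with s u xor s v
... | true  = s≤s z≤n
... | false = z≤n

two-centres : ∀ q d X Y → ((+ q) ℤ.* (+ d) ℤ.- + X ℤ.- + Y) ℤ.+ + (X + Y + q * 1) ≡ + (q * suc d + 0 + 0)
two-centres q d X Y rewrite *-identityʳ q = trans (ring (+ q) (+ d) (+ X) (+ Y))
  (trans (cong (ℤ._+ + q) (sym (ℤₚ.pos-* q d))) (cong +_ (nat q d)))
  where
  ring : ∀ q d x y → q ℤ.* d ℤ.- x ℤ.- y ℤ.+ (x ℤ.+ y ℤ.+ q) ≡ q ℤ.* d ℤ.+ q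
  ring = ℤRing.solve-∀
  nat : ∀ q d → q * d + q ≡ q * suc d + 0 + 0
  nat = solve-∀

module CentreCounts (κ₁ κ₂ : ℕ) where

  fourCentres : Bool
  fourCentres = (κ₁ ≡ᵇ 1) ∧ (κ₂ ≡ᵇ 1)

  endLevel : ℕ
  endLevel = ⟦ (κ₁ ≡ᵇ 0) ∧ (κ₂ ≡ᵇ 0) ⟧

  both-one : fourCentres ≡ true → κ₁ ≡ 1 × κ₂ ≡ 1
  both-one e = let a , b = to T-∧ (from T-≡ e) in ≡ᵇ⇒≡ κ₁ 1 a , ≡ᵇ⇒≡ κ₂ 1 b

  four⇔ : κ₁ ≡ 0 ⊎ κ₁ ≡ 1 → κ₂ ≡ 0 ⊎ κ₂ ≡ 1 → suc κ₁ * suc κ₂ ≡ 4 ⇔ fourCentres ≡ true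
  four⇔ (inj₁ refl) (inj₁ refl) = mk⇔ (λ ()) (λ ())
  four⇔ (inj₁ refl) (inj₂ refl) = mk⇔ (λ ()) (λ ())
  four⇔ (inj₂ refl) (inj₁ refl) = mk⇔ (λ ()) (λ ())
  four⇔ (inj₂ refl) (inj₂ refl) = mk⇔ (λ _ → refl) (λ _ → refl)

  endLevel⇔ : κ₁ ≡ 0 ⊎ κ₁ ≡ 1 → κ₂ ≡ 0 ⊎ κ₂ ≡ 1 → ∀ x →
              ((suc κ₁ * suc κ₂ ≡ 1 → x ≡ 1) × (2 ≤ suc κ₁ * suc κ₂ → x ≡ 0)) ⇔ x ≡ endLevel
  endLevel⇔ (inj₁ refl) (inj₁ refl) x = mk⇔ (λ h → proj₁ h refl) (λ e → (λ _ → e) , λ { (s≤s ()) })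
  endLevel⇔ (inj₁ refl) (inj₂ refl) x = mk⇔ (λ h → proj₂ h (s≤s (s≤s z≤n))) (λ e → (λ ()) , λ _ → e)
  endLevel⇔ (inj₂ refl) (inj₁ refl) x = mk⇔ (λ h → proj₂ h (s≤s (s≤s z≤n))) (λ e → (λ ()) , λ _ → e)
  endLevel⇔ (inj₂ refl) (inj₂ refl) x = mk⇔ (λ h → proj₂ h (s≤s (s≤s z≤n))) (λ e → (λ ()) , λ _ → e)

  -- The largest left side is `4`, for four centres; two diameters of at least two cover it.
  endLevel-room : κ₁ ≡ 0 ⊎ κ₁ ≡ 1 → κ₂ ≡ 0 ⊎ κ₂ ≡ 1 → ∀ {d} → 4 ≤ d → 2 * endLevel + 2 * (κ₁ + κ₂) ≤ suc d
  endLevel-room (inj₁ refl) (inj₁ refl) 4≤d = ≤-trans (s≤s (s≤s z≤n)) (m≤n⇒m≤1+n 4≤d)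
  endLevel-room (inj₁ refl) (inj₂ refl) 4≤d = ≤-trans (s≤s (s≤s z≤n)) (m≤n⇒m≤1+n 4≤d)
  endLevel-room (inj₂ refl) (inj₁ refl) 4≤d = ≤-trans (s≤s (s≤s z≤n)) (m≤n⇒m≤1+n 4≤d)
  endLevel-room (inj₂ refl) (inj₂ refl) 4≤d = m≤n⇒m≤1+n 4≤d

  endLevel-≤ : ∀ {x} → (κ₁ ≡ 0 → κ₂ ≡ 0 → x ≢ 0) → endLevel ≤ x
  endLevel-≤ {x} h with κ₁ ≡ᵇ 0 in e₁ | κ₂ ≡ᵇ 0 in e₂
  ... | true  | true  = n≢0⇒n>0 (h (≡ᵇ⇒≡ κ₁ 0 (from T-≡ e₁)) (≡ᵇ⇒≡ κ₂ 0 (from T-≡ e₂)))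
  ... | true  | false = z≤n
  ... | false | _     = z≤n

  -- All values of the theorem are instances of one formula, `q (d + 1 - ξ) - X - Y + endLevel + ⟦
  -- fourCentres ⟧`, here with the negative terms moved across.
  rnCases-value : κ₁ ≡ 0 ⊎ κ₁ ≡ 1 → κ₂ ≡ 0 ⊎ κ₂ ≡ 1 → ∀ q d X Y →
    rnCases (suc κ₁) (suc κ₂)
      (((+ q) ℤ.* (+ (d + 1)) ℤ.- + X ℤ.- + Y) ℤ.+ + 1)
      ((+ q) ℤ.* (+ d) ℤ.- + X ℤ.- + Y)
      (((+ q) ℤ.* ((+ d) ℤ.- + 1) ℤ.- + X ℤ.- + Y) ℤ.+ + 1)
    ℤ.+ + (X + Y + q * (κ₁ + κ₂)) ≡ + (q * suc d + endLevel + ⟦ fourCentres ⟧)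
  rnCases-value (inj₁ refl) (inj₁ refl) q d X Y rewrite *-zeroʳ q = trans (ring (+ q) (+ (d + 1)) (+ X) (+ Y))
    (trans (cong (ℤ._+ + 1) (sym (ℤₚ.pos-* q (d + 1)))) (cong +_ (nat q d)))
    where
    ring : ∀ q d x y → q ℤ.* d ℤ.- x ℤ.- y ℤ.+ + 1 ℤ.+ (x ℤ.+ y ℤ.+ + 0) ≡ q ℤ.* d ℤ.+ + 1
    ring = ℤRing.solve-∀
    nat : ∀ q d → q * (d + 1) + 1 ≡ q * suc d + 1 + 0
    nat = solve-∀
  rnCases-value (inj₁ refl) (inj₂ refl) q d X Y = two-centres q d X Y
  rnCases-value (inj₂ refl) (inj₁ refl) q d X Y = two-centres q d X Y
  rnCases-value (inj₂ refl) (inj₂ refl) q d X Y rewrite *-comm q 2 = trans (ring (+ q) (+ d) (+ X) (+ Y))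
    (trans (cong (λ i → i ℤ.+ + q ℤ.+ + 1) (sym (ℤₚ.pos-* q d))) (cong +_ (nat q d)))
    where
    ring : ∀ q d x y → q ℤ.* (d ℤ.- + 1) ℤ.- x ℤ.- y ℤ.+ + 1 ℤ.+ (x ℤ.+ y ℤ.+ (q ℤ.+ (q ℤ.+ + 0))) ≡ q ℤ.* d ℤ.+ q ℤ.+ + 1
    ring = ℤRing.solve-∀
    nat : ∀ q d → q * d + q + 1 ≡ q * suc d + 0 + 1
    nat = solve-∀

-- An integer `v - w` is presented by the equation `X + w ≡ v`, so that comparisons with it become
-- subtraction-free statements about natural numbers.
module _ {X : ℤ.ℤ} {w v : ℕ} (X+w≡v : X ℤ.+ + w ≡ + v) where

  private
    undo : ∀ i j → i ℤ.+ j ℤ.+ ℤ.- j ≡ i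
    undo = ℤRing.solve-∀

    X≡ : + v ℤ.+ ℤ.- + w ≡ X
    X≡ = trans (cong (ℤ._+ ℤ.- + w) (sym X+w≡v)) (undo X (+ w))

    u≡ : ∀ u → + (u + w) ℤ.+ ℤ.- + w ≡ + u
    u≡ u = undo (+ u) (+ w)

  ℤ≤⇒ : ∀ {u} → + u ℤ.≤ X → u + w ≤ v
  ℤ≤⇒ {u} h = ℤₚ.drop‿+≤+ (subst (+ (u + w) ℤ.≤_) X+w≡v (ℤₚ.+-monoˡ-≤ (+ w) h))

  ⇒ℤ≤ : ∀ {u} → u + w ≤ v → + u ℤ.≤ X
  ⇒ℤ≤ {u} h = subst₂ ℤ._≤_ (u≡ u) X≡ (ℤₚ.+-monoˡ-≤ (ℤ.- + w) (ℤ.+≤+ h))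

  ⇒ℤ≥ : ∀ {u} → v ≤ u + w → X ℤ.≤ + u
  ⇒ℤ≥ {u} h = subst₂ ℤ._≤_ X≡ (u≡ u) (ℤₚ.+-monoˡ-≤ (ℤ.- + w) (ℤ.+≤+ h))

  ℤ≡⇒ : ∀ {u} → + u ≡ X → u + w ≡ v
  ℤ≡⇒ e = ℤₚ.+-injective (trans (cong (ℤ._+ + w) e) X+w≡v)

  ⇒ℤ≡ : ∀ {u} → u + w ≡ v → + u ≡ X
  ⇒ℤ≡ {u} e = trans (sym (u≡ u)) (trans (cong (λ i → + i ℤ.+ ℤ.- + w) e) X≡)

condB-shift : ∀ D x → (+ D ℤ.- + 2 ℤ.* + x) ℤ.+ + (2 * x) ≡ + D
condB-shift D x = trans (cong (λ i → + D ℤ.- + 2 ℤ.* + x ℤ.+ i) (ℤₚ.pos-* 2 x)) (ring (+ D) (+ x))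
  where
  ring : ∀ D x → D ℤ.- + 2 ℤ.* x ℤ.+ + 2 ℤ.* x ≡ D
  ring = ℤRing.solve-∀

condC-shift : ∀ k d x y S →
  ((+ k) ℤ.* (+ (d + 1) ℤ.- + x) ℤ.- + S ℤ.- (+ x ℤ.- + y)) ℤ.+ + (S + suc k * x) ≡ + (k * suc d + y + 0)
condC-shift k d x y S = trans
  (cong (λ i → (+ k) ℤ.* (+ (d + 1) ℤ.- + x) ℤ.- + S ℤ.- (+ x ℤ.- + y) ℤ.+ (+ S ℤ.+ (+ x ℤ.+ i))) (ℤₚ.pos-* k x))
  (trans (ring (+ k) (+ (d + 1)) (+ x) (+ y) (+ S))
    (trans (cong (ℤ._+ + y) (sym (ℤₚ.pos-* k (d + 1)))) (cong +_ (nat k d y))))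
  where
  ring : ∀ k d x y S → k ℤ.* (d ℤ.- x) ℤ.- S ℤ.- (x ℤ.- y) ℤ.+ (S ℤ.+ (x ℤ.+ k ℤ.* x)) ≡ k ℤ.* d ℤ.+ y
  ring = ℤRing.solve-∀
  nat : ∀ k d y → k * (d + 1) + y ≡ k * suc d + y + 0
  nat = solve-∀

condC-shift-middle : ∀ k d x y S →
  ((+ k) ℤ.* (+ (d + 1) ℤ.- + x) ℤ.- + S ℤ.- ((+ x ℤ.- + y) ℤ.- + 1)) ℤ.+ + (S + suc k * x) ≡ + (k * suc d + y + 1)
condC-shift-middle k d x y S = trans
  (regroup ((+ k) ℤ.* (+ (d + 1) ℤ.- + x) ℤ.- + S) (+ x ℤ.- + y) (+ (S + suc k * x)))
  (trans (cong (ℤ._+ + 1) (condC-shift k d x y S)) (cong (λ n → + (n + 1)) (+-identityʳ (k * suc d + y))))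
  where
  regroup : ∀ a b c → a ℤ.- (b ℤ.- + 1) ℤ.+ c ≡ (a ℤ.- b ℤ.+ c) ℤ.+ + 1
  regroup = ℤRing.solve-∀

label-shift : ∀ f d l l′ y → (((+ f ℤ.+ + (d + 1)) ℤ.- + l) ℤ.- + l′) ℤ.- + y ℤ.+ + (l + l′ + y) ≡ + (f + suc d)
label-shift f d l l′ y = trans (ring (+ f) (+ (d + 1)) (+ l) (+ l′) (+ y)) (cong (λ n → + (f + n)) (+-comm d 1))
  where
  ring : ∀ f d l l′ y → f ℤ.+ d ℤ.- l ℤ.- l′ ℤ.- y ℤ.+ (l ℤ.+ l′ ℤ.+ y) ≡ f ℤ.+ d
  ring = ℤRing.solve-∀

sumTo-cong : ∀ n {g g′ : ℕ → ℕ} → (∀ t → t < n → g t ≡ g′ t) → sumTo n g ≡ sumTo n g′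
sumTo-cong zero    h = refl
sumTo-cong (suc n) h = cong₂ _+_ (sumTo-cong n (λ t t<n → h t (m≤n⇒m≤1+n t<n))) (h n ≤-refl)

sumTo-+ : ∀ s j (g : ℕ → ℕ) → sumTo (j + s) g ≡ sumTo s g + sumTo j (λ i → g (i + s))
sumTo-+ s zero    g = sym (+-identityʳ _)
sumTo-+ s (suc j) g = trans (cong (_+ g (j + s)) (sumTo-+ s j g)) (+-assoc (sumTo s g) _ _)

sum≡sumTo : ∀ n (g : ℕ → ℕ) → sum {n} (λ i → g (toℕ i)) ≡ sumTo n g
sum≡sumTo zero    g = refl
sum≡sumTo (suc n) g = trans (cong (λ s → g 0 + s) (sum≡sumTo n (λ t → g (suc t))))
  (sym (front n g))
  where
  front : ∀ n (g : ℕ → ℕ) → sumTo (suc n) g ≡ g 0 + sumTo n (λ t → g (suc t))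
  front zero    g = sym (+-identityʳ (g 0))
  front (suc n) g = trans (cong (_+ g (suc n)) (front n g)) (+-assoc (g 0) _ _)

-- The sum in (c) runs over all positions with a Boolean filter; splitting the range after `a` and
-- before `a + k + 1` isolates the part that counts.
sumTo-window : ∀ a k j (g : ℕ → ℕ) →
  sumTo (j + (k + suc a)) (λ t → if (a <ᵇ t) ∧ (t <ᵇ suc k + a) then g t else 0) ≡ sumTo k (λ i → g (suc (i + a)))
sumTo-window a k j g = begin
  sumTo (j + (k + suc a)) w
    ≡⟨ sumTo-+ (k + suc a) j w ⟩
  sumTo (k + suc a) w + sumTo j (λ i → w (i + (k + suc a)))
    ≡⟨ cong₂ _+_ (sumTo-+ (suc a) k w) (trans (sumTo-const j _ 0 (λ i _ → above i)) (*-zeroʳ j)) ⟩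
  sumTo (suc a) w + sumTo k (λ i → w (i + suc a)) + 0
    ≡⟨ +-identityʳ _ ⟩
  sumTo (suc a) w + sumTo k (λ i → w (i + suc a))
    ≡⟨ cong₂ _+_ (trans (sumTo-const (suc a) w 0 below) (*-zeroʳ a)) (sumTo-cong k inside) ⟩
  sumTo k (λ i → g (suc (i + a))) ∎
  where
  open ≡-Reasoning
  w : ℕ → ℕ
  w t = if (a <ᵇ t) ∧ (t <ᵇ suc k + a) then g t else 0
  below : ∀ t → t < suc a → w t ≡ 0
  below t t≤a with a <ᵇ t in e
  ... | false = refl
  ... | true  = contradiction (<ᵇ⇒< a t (from T-≡ e)) (≤⇒≯ (s≤s⁻¹ t≤a))
  above : ∀ i → w (i + (k + suc a)) ≡ 0
  above i with a <ᵇ i + (k + suc a) | i + (k + suc a) <ᵇ suc k + a in e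
  ... | false | _     = refl
  ... | true  | false = refl
  ... | true  | true  = contradiction (<ᵇ⇒< (i + (k + suc a)) (suc k + a) (from T-≡ e))
    (≤⇒≯ (≤-trans (≤-reflexive (sym (+-suc k a))) (m≤n+m (k + suc a) i)))
  inside : ∀ i → i < k → w (i + suc a) ≡ g (suc (i + a))
  inside i i<k rewrite +-suc i a
    | to T-≡ (<⇒<ᵇ {a} {suc (i + a)} (s≤s (m≤n+m a i)))
    | to T-≡ (<⇒<ᵇ {suc (i + a)} {suc k + a} (s≤s (+-monoˡ-< a i<k))) = refl

injective⇒surjective : {f : Fin N → Fin N} → Injective _≡_ _≡_ f → ∀ v → ∃[ i ] f i ≡ v
injective⇒surjective {suc N} {f} inj v with Finₚ.any? (λ i → f i Fin.≟ v)
... | yes hit = hit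
... | no miss = contradiction
  (Finₚ.injective⇒≤ {f = λ i → Fin.punchOut (avoids i)} (λ e → inj (Finₚ.punchOut-injective (avoids _) (avoids _) e))) 1+n≰n
  where
  avoids : ∀ i → v ≢ f i
  avoids i e = miss (i , sym e)

-- Sorting by counting smaller labels: a vertex does not count itself, so ranks lie below `p`;
-- distinct labels make the rank injective, and its inverse is the ordering.
module Sort {p : ℕ} (f : Fin p → ℕ) (f-inj : ∀ {u v} → f u ≡ f v → u ≡ v) where

  below : Fin p → Fin p → ℕ
  below v u = ⟦ f u <ᵇ f v ⟧

  rank : Fin p → ℕ
  rank v = sum (below v)

  ⟦⟧≤1 : ∀ b → ⟦ b ⟧ ≤ 1
  ⟦⟧≤1 true  = ≤-refl
  ⟦⟧≤1 false = z≤n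

  below-self : ∀ v → below v v ≡ 0
  below-self v with f v <ᵇ f v in e
  ... | false = refl
  ... | true  = contradiction (<ᵇ⇒< (f v) (f v) (from T-≡ e)) (<-irrefl refl)

  below-< : ∀ {u v} → f u < f v → below v u ≡ 1
  below-< {u} {v} lt = cong ⟦_⟧ (to T-≡ (<⇒<ᵇ lt))

  rank<p : ∀ v → rank v < p
  rank<p v = <-≤-trans
    (sum-mono-< (below v) (λ _ → 1) (λ u → ⟦⟧≤1 (f u <ᵇ f v)) v (≤-reflexive (cong suc (below-self v))))
    (≤-reflexive (trans (sum-const p 1) (*-identityʳ p)))

  rank-mono : ∀ {u v} → f u < f v → rank u < rank v
  rank-mono {u} {v} u<v = sum-mono-< (below u) (below v) pointwise u
    (≤-trans (≤-reflexive (cong suc (below-self u))) (≤-reflexive (sym (below-< u<v))))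
    where
    pointwise : ∀ w → below u w ≤ below v w
    pointwise w with f w <ᵇ f u in e
    ... | false = z≤n
    ... | true  = ≤-reflexive (sym (below-< (<-trans (<ᵇ⇒< (f w) (f u) (from T-≡ e)) u<v)))

  rankFin : Fin p → Fin p
  rankFin v = fromℕ< (rank<p v)

  toℕ-rank : ∀ v → toℕ (rankFin v) ≡ rank v
  toℕ-rank v = Finₚ.toℕ-fromℕ< (rank<p v)

  rank-inj : ∀ {u v} → rankFin u ≡ rankFin v → u ≡ v
  rank-inj {u} {v} e with <-cmp (f u) (f v)
  ... | tri≈ _ eq _ = f-inj eq
  ... | tri< lt _ _ = contradiction (trans (sym (toℕ-rank u)) (trans (cong toℕ e) (toℕ-rank v))) (<⇒≢ (rank-mono lt))
  ... | tri> _ _ gt = contradiction (trans (sym (toℕ-rank v)) (trans (cong toℕ (sym e)) (toℕ-rank u))) (<⇒≢ (rank-mono gt))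

  order : Fin p → Fin p
  order i = proj₁ (injective⇒surjective rank-inj i)

  rank-order : ∀ i → rankFin (order i) ≡ i
  rank-order i = proj₂ (injective⇒surjective rank-inj i)

  order-bijective : Bijective _≡_ _≡_ order
  order-bijective =
    (λ {i} {j} e → trans (sym (rank-order i)) (trans (cong rankFin e) (rank-order j))) ,
    (λ v → rankFin v , λ { refl → rank-inj (rank-order (rankFin v)) })

  order-increasing : ∀ {i j} → toℕ i < toℕ j → f (order i) < f (order j)
  order-increasing {i} {j} i<j with <-cmp (f (order i)) (f (order j))
  ... | tri< lt _ _ = lt
  ... | tri≈ _ eq _ = contradiction (cong toℕ (proj₁ order-bijective (f-inj eq))) (<⇒≢ i<j)
  ... | tri> _ _ gt = contradiction (rank-mono gt)
    (<⇒≯ (subst₂ _<_ (trans (cong toℕ (sym (rank-order i))) (toℕ-rank (order i)))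
                     (trans (cong toℕ (sym (rank-order j))) (toℕ-rank (order j))) i<j))

span-extremes : (f : Fin N → ℕ) (lo hi : Fin N) → (∀ v → f lo ≤ f v) → (∀ v → f v ≤ f hi) → spanL f ≡ f hi ∸ f lo
span-extremes f lo hi h₁ h₂ = cong₂ _∸_
  (≤-antisym (maxOver-least f h₂) (maxOver-upper f hi))
  (≤-antisym (foldr-⊓-lower f (allFin _) (∈-allFin lo))
             -- `minOver` starts from the default `maxOver f`, which is at least `f lo`.
             (foldr-⊓-greatest f (allFin _) (≤-trans (h₁ hi) (maxOver-upper f hi)) (λ v _ → h₁ v)))

sum-bijective : (g : Fin N → ℕ) {z : Fin N → Fin N} → Bijective _≡_ _≡_ z → sum g ≡ sum (λ i → g (z i))
sum-bijective g bij = sum-permute g (⤖⇒↔ (mk⤖ bij))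

-- The radio number

-- c is the indicator of the exceptional case E of the conditions (b) and (c).
module Bounds (d x : ℕ) (ξ : ℤ.ℤ) (ξ≡ : ξ ≡ + x) {E : Set} (E? : Dec E) {c : ℕ}
  (c-yes : E → c ≡ 1) (c-no : ¬ E → c ≡ 0) where

  IntB : ℕ → Set
  IntB l = (E → + (2 * l) ℤ.≤ (+ (d + 3)) ℤ.- + 2 ℤ.* ξ) × (¬ E → + (2 * l) ℤ.≤ (+ (d + 1)) ℤ.- + 2 ℤ.* ξ)

  intB⇔ : ∀ l → IntB l ⇔ 2 * l + 2 * x ≤ suc d + 2 * c
  intB⇔ l rewrite ξ≡ = mk⇔ forward (λ h → (λ e → backward₁ e h) , (λ ¬e → backward₀ ¬e h))
    where
    d+3 : d + 3 ≡ suc d + 2 * 1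
    d+3 = solve (d ⨟ [])
    d+1 : d + 1 ≡ suc d + 2 * 0
    d+1 = solve (d ⨟ [])
    backward₁ : E → 2 * l + 2 * x ≤ suc d + 2 * c → + (2 * l) ℤ.≤ (+ (d + 3)) ℤ.- + 2 ℤ.* + x
    backward₁ e h = ⇒ℤ≤ (condB-shift (d + 3) x)
      (≤-trans h (≤-reflexive (trans (cong (λ c → suc d + 2 * c) (c-yes e)) (sym d+3))))
    backward₀ : ¬ E → 2 * l + 2 * x ≤ suc d + 2 * c → + (2 * l) ℤ.≤ (+ (d + 1)) ℤ.- + 2 ℤ.* + x
    backward₀ ¬e h = ⇒ℤ≤ (condB-shift (d + 1) x)
      (≤-trans h (≤-reflexive (trans (cong (λ c → suc d + 2 * c) (c-no ¬e)) (sym d+1))))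
    forward : (E → + (2 * l) ℤ.≤ (+ (d + 3)) ℤ.- + 2 ℤ.* + x) × (¬ E → + (2 * l) ℤ.≤ (+ (d + 1)) ℤ.- + 2 ℤ.* + x) →
              2 * l + 2 * x ≤ suc d + 2 * c
    forward (h₁ , h₀) = case E? of λ
      { (yes e) → ≤-trans (ℤ≤⇒ (condB-shift (d + 3) x) (h₁ e))
          (≤-reflexive (trans d+3 (cong (λ c → suc d + 2 * c) (sym (c-yes e)))))
      ; (no ¬e) → ≤-trans (ℤ≤⇒ (condB-shift (d + 1) x) (h₀ ¬e))
          (≤-reflexive (trans d+1 (cong (λ c → suc d + 2 * c) (sym (c-no ¬e))))) }

  module _ (k s y f : ℕ) where

    IntC : Set
    IntC =
      (E → + (2 * f) ℤ.≤ ((+ k) ℤ.* ((+ (d + 1)) ℤ.- ξ) ℤ.- + (2 * s)) ℤ.- ((ξ ℤ.- + y) ℤ.- + 1)) ×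
      (¬ E → + (2 * f) ℤ.≤ ((+ k) ℤ.* ((+ (d + 1)) ℤ.- ξ) ℤ.- + (2 * s)) ℤ.- (ξ ℤ.- + y))

    NatC : Set
    NatC = 2 * f + 2 * s + suc k * x ≤ k * suc d + y + c

    intC⇔ : IntC ⇔ NatC
    intC⇔ rewrite ξ≡ = mk⇔ forward (λ h → (λ e → backward₁ e h) , (λ ¬e → backward₀ ¬e h))
      where
      Bound₁ Bound₀ : Set
      Bound₁ = + (2 * f) ℤ.≤ ((+ k) ℤ.* ((+ (d + 1)) ℤ.- + x) ℤ.- + (2 * s)) ℤ.- ((+ x ℤ.- + y) ℤ.- + 1)
      Bound₀ = + (2 * f) ℤ.≤ ((+ k) ℤ.* ((+ (d + 1)) ℤ.- + x) ℤ.- + (2 * s)) ℤ.- (+ x ℤ.- + y)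
      assoc = +-assoc (2 * f) (2 * s) (suc k * x)
      rhs = λ c → k * suc d + y + c
      backward₁ : E → NatC → Bound₁
      backward₁ e h = ⇒ℤ≤ (condC-shift-middle k d x y (2 * s))
        (subst₂ _≤_ assoc (cong rhs (c-yes e)) h)
      backward₀ : ¬ E → NatC → Bound₀
      backward₀ ¬e h = ⇒ℤ≤ (condC-shift k d x y (2 * s))
        (subst₂ _≤_ assoc (cong rhs (c-no ¬e)) h)
      forward : (E → Bound₁) × (¬ E → Bound₀) → NatC
      forward (h₁ , h₀) = case E? of λ
        { (yes e) → subst₂ _≤_ (sym assoc) (cong rhs (sym (c-yes e))) (ℤ≤⇒ (condC-shift-middle k d x y (2 * s)) (h₁ e))
        ; (no ¬e) → subst₂ _≤_ (sym assoc) (cong rhs (sym (c-no ¬e))) (ℤ≤⇒ (condC-shift k d x y (2 * s)) (h₀ ¬e)) }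

  natC-cong : ∀ {k k′ s s′ y y′ f f′} → k ≡ k′ → s ≡ s′ → y ≡ y′ → f ≡ f′ → NatC k s y f → NatC k′ s′ y′ f′
  natC-cong refl refl refl refl h = h

module DiameterAtLeastTwo {N : ℕ} (A : Adj N) (tree : IsTree A) (2≤diam : 2 ≤ diam A) where

  vertex : Fin N
  vertex = go A 2≤diam
    where
    go : ∀ {N} (A : Adj N) → 2 ≤ diam A → Fin N
    go {suc N} A _ = Fin.zero

  3≤N : 3 ≤ N
  3≤N = let u , v , e = diam-attained A vertex
            open Metric A (proj₁ tree) (proj₁ (proj₂ tree))
        in ≤-<-trans (≤-trans 2≤diam (≤-reflexive (trans e (sym (D≡dist u v))))) (D<N u v)

module RadioNumber {m n : ℕ} (A : Adj m) (B : Adj n) (treeA : IsTree A) (treeB : IsTree B)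
  (2≤diamA : 2 ≤ diam A) (2≤diamB : 2 ≤ diam B) where

  open Prod A B
  open CartesianProduct A B (proj₁ treeA) (proj₁ (proj₂ treeA)) (proj₁ treeB) (proj₁ (proj₂ treeB))

  private
    module NA = DiameterAtLeastTwo A treeA 2≤diamA
    module NB = DiameterAtLeastTwo B treeB 2≤diamB
    module SA = TreeStructure (treeStructure A treeA NA.vertex)
    module SB = TreeStructure (treeStructure B treeB NB.vertex)

  κ₁ κ₂ ξ′ q h : ℕ
  κ₁ = SA.κ
  κ₂ = SB.κ
  ξ′ = κ₁ + κ₂
  q  = p ∸ 1
  h  = half ∸ 1

  open CentreCounts κ₁ κ₂

  9≤p : 9 ≤ p
  9≤p = *-mono-≤ NA.3≤N NB.3≤N

  p≡ : suc q ≡ p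
  p≡ = m+[n∸m]≡n {1} {p} (≤-trans (s≤s z≤n) 9≤p)

  private
    instance
      p-nonZero : NonZero p
      p-nonZero = >-nonZero (≤-trans (s≤s z≤n) 9≤p)

  half≡ : suc h ≡ half
  half≡ = m+[n∸m]≡n {1} {half} (m≥n⇒m/n>0 (≤-trans (s≤s (s≤s z≤n)) 9≤p))

  h<q : h < q
  h<q = s≤s⁻¹ (subst₂ _<_ (sym half≡) (sym p≡) (m/n<m p 2 (s≤s (s≤s z≤n))))

  -- Only an even `p` has this form, so the rounding in `half` does no harm.
  half-unique : ∀ t → suc q ≡ suc t + suc t → t ≡ h
  half-unique t e = cong (_∸ 1) (trans (sym (m*n/n≡m (suc t) 2)) (cong (_/ 2) (trans double (trans (sym e) p≡))))
    where
    double : suc t * 2 ≡ suc t + suc t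
    double = solve (t ⨟ [])

  4≤d : 4 ≤ d
  4≤d = +-mono-≤ 2≤diamA 2≤diamB

  diamG : diam G ≡ d
  diamG = diam-product NA.vertex NB.vertex

  ξ≡ : ξ ≡ + ξ′
  ξ≡ = trans (cong₂ (λ a b → (+ a ℤ.+ + b) ℤ.- + 2) SA.nW≡ SB.nW≡) (ring (+ κ₁) (+ κ₂))
    where
    ring : ∀ a b → ((+ 1 ℤ.+ a) ℤ.+ (+ 1 ℤ.+ b)) ℤ.- + 2 ≡ a ℤ.+ b
    ring = ℤRing.solve-∀

  nWG≡ : nWG ≡ suc κ₁ * suc κ₂
  nWG≡ = trans nW-product (cong₂ _*_ SA.nW≡ SB.nW≡)

  fourCentres⇔ : nWG ≡ 4 ⇔ fourCentres ≡ true
  fourCentres⇔ = mk⇔ (λ e → to (four⇔ SA.κ-cases SB.κ-cases) (trans (sym nWG≡) e))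
                     (λ f → trans nWG≡ (from (four⇔ SA.κ-cases SB.κ-cases) f))

  side₁ side₂ parity : Fin p → Bool
  side₁ v = SA.side (x_ v)
  side₂ v = SB.side (y_ v)
  parity v = side₁ v xor side₂ v

  deltaG≡ : ∀ u v → deltaG u v ≡ ⟦ side₁ u xor side₁ v ⟧ + ⟦ side₂ u xor side₂ v ⟧
  deltaG≡ u v = cong₂ _+_ (SA.delta≡ (x_ u) (x_ v)) (SB.delta≡ (y_ u) (y_ v))

  flip₁≤ : ∀ u v → ⟦ side₁ u xor side₁ v ⟧ ≤ κ₁
  flip₁≤ = xor≤κ κ₁ side₁ SA.κ-cases (λ e u → SA.one-side e (x_ u))

  flip₂≤ : ∀ u v → ⟦ side₂ u xor side₂ v ⟧ ≤ κ₂
  flip₂≤ = xor≤κ κ₂ side₂ SB.κ-cases (λ e u → SB.one-side e (y_ u))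

  dist-eq : ∀ u v → dist G u v + 2 * phiG u v ≡ LG u + LG v + deltaG u v
  dist-eq u v = trans (cong (_+ 2 * phiG u v) (dist-product u v))
    (arith (dist A (x_ u) (x_ v)) (dist B (y_ u) (y_ v)) (phiT A (x_ u) (x_ v)) (phiT B (y_ u) (y_ v))
           (level A (x_ u)) (level B (y_ u)) (level A (x_ v)) (level B (y_ v))
           (deltaT A (x_ u) (x_ v)) (deltaT B (y_ u) (y_ v)) (SA.dist≡ (x_ u) (x_ v)) (SB.dist≡ (y_ u) (y_ v)))
    where
    arith : ∀ d₁ d₂ f₁ f₂ l₁ l₂ m₁ m₂ e₁ e₂ → d₁ + 2 * f₁ ≡ l₁ + m₁ + e₁ → d₂ + 2 * f₂ ≡ l₂ + m₂ + e₂ →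
            d₁ + d₂ + 2 * (f₁ + f₂) ≡ (l₁ + l₂) + (m₁ + m₂) + (e₁ + e₂)
    arith d₁ d₂ f₁ f₂ l₁ l₂ m₁ m₂ e₁ e₂ h₁ h₂ = ≡-by (cong₂ _+_ h₁ h₂)
      (solve (d₁ ⨟ d₂ ⨟ f₁ ⨟ f₂ ⨟ l₁ ⨟ l₂ ⨟ m₁ ⨟ m₂ ⨟ e₁ ⨟ e₂ ⨟ []))

  δ≤ξ : ∀ u v → deltaG u v ≤ ξ′
  δ≤ξ u v = ≤-trans (≤-reflexive (deltaG≡ u v)) (+-mono-≤ (flip₁≤ u v) (flip₂≤ u v))

  full-flips : ∀ u v → deltaG u v ≡ ξ′ → ⟦ side₁ u xor side₁ v ⟧ ≡ κ₁ × ⟦ side₂ u xor side₂ v ⟧ ≡ κ₂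
  full-flips u v e = split _ _ (trans (sym (deltaG≡ u v)) e) (flip₁≤ u v) (flip₂≤ u v)
    where
    split : ∀ a b → a + b ≡ κ₁ + κ₂ → a ≤ κ₁ → b ≤ κ₂ → a ≡ κ₁ × b ≡ κ₂
    split a b e a≤ b≤ =
      ≤-antisym a≤ (+-cancelʳ-≤ κ₂ κ₁ a (≤-trans (≤-reflexive (sym e)) (+-monoʳ-≤ a b≤))) ,
      ≤-antisym b≤ (+-cancelˡ-≤ κ₁ κ₂ b (≤-trans (≤-reflexive (sym e)) (+-monoˡ-≤ b a≤)))

  δ-opposite : ∀ u v w → deltaG u v ≡ ξ′ → deltaG v w ≡ ξ′ → deltaG u w ≡ 0
  δ-opposite u v w e e′ = trans (deltaG≡ u w) (cong₂ _+_
    (xor-transitive (side₁ u) (side₁ v) (side₁ w) (trans (proj₁ (full-flips u v e)) (sym (proj₁ (full-flips v w e′)))))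
    (xor-transitive (side₂ u) (side₂ v) (side₂ w) (trans (proj₂ (full-flips u v e)) (sym (proj₂ (full-flips v w e′))))))

  ξ≡2 : fourCentres ≡ true → ξ′ ≡ 2
  ξ≡2 f = cong₂ _+_ (proj₁ (both-one f)) (proj₂ (both-one f))

  dist-sym : ∀ u v → dist G u v ≡ dist G v u
  dist-sym u v = begin
    dist G u v                                        ≡⟨ dist-product u v ⟩
    dist A (x_ u) (x_ v) + dist B (y_ u) (y_ v)       ≡⟨ cong₂ _+_ (symA (x_ u) (x_ v)) (symB (y_ u) (y_ v)) ⟩
    dist A (x_ v) (x_ u) + dist B (y_ v) (y_ u)       ≡⟨ dist-product v u ⟨
    dist G v u                                        ∎
    where
    open ≡-Reasoning
    module MA = Metric A (proj₁ treeA) (proj₁ (proj₂ treeA))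
    module MB = Metric B (proj₁ treeB) (proj₁ (proj₂ treeB))
    symA : ∀ x x′ → dist A x x′ ≡ dist A x′ x
    symA x x′ = trans (sym (MA.D≡dist x x′)) (trans (MA.D-sym x x′) (MA.D≡dist x′ x))
    symB : ∀ y y′ → dist B y y′ ≡ dist B y′ y
    symB y y′ = trans (sym (MB.D≡dist y y′)) (trans (MB.D-sym y y′) (MB.D≡dist y′ y))

  -- Within a row the side in the first tree is fixed, and the exclusive or with a fixed bit at most
  -- exchanges the two equal halves of the second tree.
  parity-balanced : fourCentres ≡ true → sum (λ v → ⟦ parity v ⟧) ≡ sum (λ v → ⟦ not (parity v) ⟧)
  parity-balanced f = trans (sum-remQuot m n (λ (x , y) → ⟦ SA.side x xor SB.side y ⟧))
    (trans (sum-cong-≗ (λ x → row (SA.side x)))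
           (sym (sum-remQuot m n (λ (x , y) → ⟦ not (SA.side x xor SB.side y) ⟧))))
    where
    balB = SB.balanced (proj₂ (both-one f))
    not-not : ∀ b → b ≡ not (not b)
    not-not true  = refl
    not-not false = refl
    row : ∀ a → sum (λ y → ⟦ a xor SB.side y ⟧) ≡ sum (λ y → ⟦ not (a xor SB.side y) ⟧)
    row false = balB
    row true  = trans (sym balB) (sum-cong-≗ (λ y → cong ⟦_⟧ (not-not (SB.side y))))

  -- If both trees have a single centre, only one vertex of the product has level zero.
  ends≥ : ∀ u v → u ≢ v → endLevel ≤ LG u + LG v
  ends≥ u v u≢v = endLevel-≤ (λ κ₁0 κ₂0 e →
    let u0 = m+n≡0⇒m≡0 (LG u) e
        v0 = m+n≡0⇒n≡0 (LG u) e
    in u≢v (xy-injective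
      (SA.centre-unique κ₁0 (x_ u) (x_ v) (m+n≡0⇒m≡0 (level A (x_ u)) u0) (m+n≡0⇒m≡0 (level A (x_ v)) v0))
      (SB.centre-unique κ₂0 (y_ u) (y_ v) (m+n≡0⇒n≡0 (level A (x_ u)) u0) (m+n≡0⇒n≡0 (level A (x_ v)) v0))))

  open Core (dist G) LG phiG deltaG parity d ξ′ endLevel h q fourCentres
    dist-eq δ≤ξ δ-opposite ξ≡2
    (λ _ u v w e → trans (deltaG≡ u w) (three-flips (side₁ u) (side₂ u) (side₁ v) (side₂ v) (side₁ w) (side₂ w)
      (trans (sym (cong₂ _+_ (deltaG≡ u v) (deltaG≡ v w))) e)))
    (λ _ u v e → two-flips (side₁ u) (side₂ u) (side₁ v) (side₂ v) (trans (sym (deltaG≡ u v)) e))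
    (λ _ u v e → one-flip (side₁ u) (side₂ u) (side₁ v) (side₂ v) (trans (sym (deltaG≡ u v)) e))
    (endLevel-room SA.κ-cases SB.κ-cases 4≤d) h<q half-unique

  Middle⇔ : ∀ t → Middle t ⇔ middle t ≡ true
  Middle⇔ t = mk⇔ (λ (w , e) → middle-intro t (to fourCentres⇔ w) e)
                  (λ b → from fourCentres⇔ (middle⇒four t b) , middle⇒≡ t b)

  ExceptB : ℕ → Set
  ExceptB s = (nWG ≡ 4) × ((s ≡ half ∸ 1) ⊎ (s ≡ half))

  ExceptB⇔ : ∀ s → ExceptB s ⇔ nearMiddle s ≡ true
  ExceptB⇔ s = mk⇔ (λ (w , e) → forward s (to fourCentres⇔ w) e)
                   (λ b → from fourCentres⇔ (nearMiddle⇒four s b) , backward s b)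
    where
    forward : ∀ s → fourCentres ≡ true → s ≡ h ⊎ s ≡ half → nearMiddle s ≡ true
    forward zero    f (inj₁ e) = middle-intro 0 f e
    forward zero    f (inj₂ e) = contradiction (trans e (sym half≡)) 0≢1+n
    forward (suc t) f (inj₁ e) = to T-≡ (from (T-∨ {middle (suc t)} {middle t})
      (inj₁ (from T-≡ (middle-intro (suc t) f e))))
    forward (suc t) f (inj₂ e) = to T-≡ (from (T-∨ {middle (suc t)} {middle t})
      (inj₂ (from T-≡ (middle-intro t f (suc-injective (trans e (sym half≡)))))))
    backward : ∀ s → nearMiddle s ≡ true → s ≡ h ⊎ s ≡ half
    backward zero    b = inj₁ (middle⇒≡ 0 b)
    backward (suc t) b with to (T-∨ {middle (suc t)} {middle t}) (from T-≡ b)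
    ... | inj₁ b₁ = inj₁ (middle⇒≡ (suc t) (to T-≡ b₁))
    ... | inj₂ b₂ = inj₂ (trans (cong suc (middle⇒≡ t (to T-≡ b₂))) half≡)

  module B-bounds (s : ℕ) = Bounds d ξ′ ξ ξ≡ {ExceptB s}
    (map′ (from (ExceptB⇔ s)) (to (ExceptB⇔ s)) (nearMiddle s Bool.≟ true)) {⟦ nearMiddle s ⟧}
    (λ e → cong ⟦_⟧ (to (ExceptB⇔ s) e)) (λ ¬e → no-true (nearMiddle s) (¬e ∘ from (ExceptB⇔ s)))

  ExceptC : ℕ → ℕ → Set
  ExceptC a b = (nWG ≡ 4) × (a ≤ half ∸ 1) × (half ≤ b)

  midCount′ : ℕ → ℕ → ℕ
  midCount′ a k = sumTo (suc k) (λ i → ⟦ middle (i + a) ⟧)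

  midCount-yes : ∀ a k → ExceptC a (suc k + a) → midCount′ a k ≡ 1
  midCount-yes a k (w , a≤h , half≤) = trans
    (sumTo-single (suc k) (λ i → ⟦ middle (i + a) ⟧) (h ∸ a)
      (+-cancelʳ-< a (h ∸ a) (suc k) (subst (_< suc k + a) (sym (m∸n+n≡m a≤h)) (≤-trans (≤-reflexive half≡) half≤)))
      (λ i _ i≢ → off i (λ e → i≢ (+-cancelʳ-≡ a i (h ∸ a) (trans e (sym (m∸n+n≡m a≤h)))))))
    (cong ⟦_⟧ (middle-intro (h ∸ a + a) (to fourCentres⇔ w) (m∸n+n≡m a≤h)))
    where
    off : ∀ i → i + a ≢ h → ⟦ middle (i + a) ⟧ ≡ 0
    off i i≢ = no-true (middle (i + a)) (λ b → i≢ (middle⇒≡ (i + a) b))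

  midCount-no : ∀ a k → ¬ ExceptC a (suc k + a) → midCount′ a k ≡ 0
  midCount-no a k ¬E = trans (sumTo-const (suc k) (λ i → ⟦ middle (i + a) ⟧) 0 off) (*-zeroʳ (suc k))
    where
    off : ∀ i → i < suc k → ⟦ middle (i + a) ⟧ ≡ 0
    off i i≤k = no-true (middle (i + a)) (λ b → ¬E
      ( from fourCentres⇔ (middle⇒four (i + a) b)
      , ≤-trans (m≤n+m a i) (≤-reflexive (middle⇒≡ (i + a) b))
      , ≤-trans (≤-reflexive (trans (sym half≡) (cong suc (sym (middle⇒≡ (i + a) b))))) (+-monoˡ-≤ a i≤k)))

  first last : Fin p
  first = fromℕ< (≤-trans (s≤s z≤n) 9≤p)
  last  = fromℕ< (≤-reflexive p≡)

  toℕ-first : toℕ first ≡ 0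
  toℕ-first = Finₚ.toℕ-fromℕ< _

  toℕ-last : toℕ last ≡ q
  toℕ-last = Finₚ.toℕ-fromℕ< _

  toℕ≤q : ∀ (i : Fin p) → toℕ i ≤ q
  toℕ≤q i = s≤s⁻¹ (≤-trans (Finₚ.toℕ<n i) (≤-reflexive (sym p≡)))

  index : ∀ t → t ≤ q → ∃[ i ] toℕ i ≡ t
  index t t≤q = let t<p = ≤-trans (s≤s t≤q) (≤-reflexive p≡) in fromℕ< t<p , Finₚ.toℕ-fromℕ< t<p

  gap : ∀ {a b} → a < b → b ≡ suc (b ∸ a ∸ 1) + a
  gap {a} {b} a<b = trans (sym (m∸n+n≡m (<⇒≤ a<b))) (cong (_+ a) (sym (m+[n∸m]≡n (m<n⇒0<n∸m a<b))))

  gap-of : ∀ {a b} k → b ≡ suc k + a → b ∸ a ∸ 1 ≡ k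
  gap-of {a} k refl = cong (_∸ 1) (m+n∸n≡m (suc k) a)

  module VertexOrder (z : Fin p → Fin p) where

    -- z continued by its last value, so that it can be indexed by ℕ.
    Z : ℕ → Fin p
    Z t with t <? p
    ... | yes t<p = z (fromℕ< t<p)
    ... | no _    = z last

    Z-toℕ : ∀ i → z i ≡ Z (toℕ i)
    Z-toℕ i with toℕ i <? p
    ... | yes lt = cong z (sym (Finₚ.fromℕ<-toℕ i lt))
    ... | no ≮p  = contradiction (Finₚ.toℕ<n i) ≮p

    Z-at : ∀ {t} i → toℕ i ≡ t → z i ≡ Z t
    Z-at i refl = Z-toℕ i

    open Order Z

    sum-Z : Bijective _≡_ _≡_ z → (g : Fin p → ℕ) → sumTo (suc q) (λ t → g (Z t)) ≡ sum g
    sum-Z bij g = begin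
      sumTo (suc q) (λ t → g (Z t))  ≡⟨ cong (λ n → sumTo n (λ t → g (Z t))) p≡ ⟩
      sumTo p (λ t → g (Z t))        ≡⟨ sum≡sumTo p (λ t → g (Z t)) ⟨
      sum {p} (λ i → g (Z (toℕ i)))  ≡⟨ sum-cong-≗ {p} (λ i → cong g (Z-toℕ i)) ⟨
      sum (λ i → g (z i))            ≡⟨ sum-bijective g bij ⟨
      sum g                          ∎
      where open ≡-Reasoning

    innerSum≡ : ∀ i j k → toℕ j ≡ suc k + toℕ i → innerSum z i j ≡ inner (toℕ i) k
    innerSum≡ i j k e = begin
      innerSum z i j
        ≡⟨ sumOver≡sum (λ t → if (toℕ i <ᵇ toℕ t) ∧ (toℕ t <ᵇ toℕ j) then LG (z t) else 0) ⟩
      sum {p} (λ t → if (toℕ i <ᵇ toℕ t) ∧ (toℕ t <ᵇ toℕ j) then LG (z t) else 0)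
        ≡⟨ sum-cong-≗ {p} (λ t → cong₂ (λ v b → if (toℕ i <ᵇ toℕ t) ∧ (toℕ t <ᵇ b) then LG v else 0) (Z-toℕ t) e) ⟩
      sum {p} (λ t → w (toℕ t))
        ≡⟨ sum≡sumTo p w ⟩
      sumTo p w
        ≡⟨ cong (λ n → sumTo n w) (sym (m∸n+n≡m k+a≤p)) ⟩
      sumTo (p ∸ (k + suc (toℕ i)) + (k + suc (toℕ i))) w
        ≡⟨ sumTo-window (toℕ i) k (p ∸ (k + suc (toℕ i))) ℓ ⟩
      inner (toℕ i) k ∎
      where
      open ≡-Reasoning
      w : ℕ → ℕ
      w t = if (toℕ i <ᵇ t) ∧ (t <ᵇ suc k + toℕ i) then ℓ t else 0
      k+a≤p : k + suc (toℕ i) ≤ p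
      k+a≤p = ≤-trans (≤-reflexive (trans (+-suc k (toℕ i)) (sym e))) (<⇒≤ (Finₚ.toℕ<n j))

    module C-bounds (i j : Fin p) (k : ℕ) (e : toℕ j ≡ suc k + toℕ i) =
      Bounds d ξ′ ξ ξ≡ {ExceptC (toℕ i) (toℕ j)}
        ((nWG ≟ 4) ×-dec ((toℕ i ≤? half ∸ 1) ×-dec (half ≤? toℕ j))) {midCount (toℕ i) k}
        (λ E → midCount-yes (toℕ i) k (subst (ExceptC (toℕ i)) e E))
        (λ ¬E → midCount-no (toℕ i) k (¬E ∘ subst (ExceptC (toℕ i)) (sym e)))

    IntCBound : (i j : Fin p) (k : ℕ) → toℕ j ≡ suc k + toℕ i → Set
    IntCBound i j k e =
      C-bounds.IntC i j k e (toℕ j ∸ toℕ i ∸ 1) (innerSum z i j) (deltaG (z i) (z j)) (phiG (z i) (z j))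

    CBound⇔ : ∀ i j k e → IntCBound i j k e ⇔ CBound (toℕ i) k
    CBound⇔ i j k e = mk⇔
      (λ c → natC-cong k≡ s≡ y≡ f≡ (to equiv c))
      (λ c → from equiv (natC-cong (sym k≡) (sym s≡) (sym y≡) (sym f≡) c))
      where
      open C-bounds i j k e
      equiv = intC⇔ (toℕ j ∸ toℕ i ∸ 1) (innerSum z i j) (deltaG (z i) (z j)) (phiG (z i) (z j))
      k≡ = gap-of k e
      s≡ = innerSum≡ i j k e
      y≡ = cong₂ deltaG (Z-at i refl) (Z-at j e)
      f≡ = cong₂ phiG (Z-at i refl) (Z-at j e)

    Conditions : Set
    Conditions = FeasibleOrdering z × CondA z × CondB z × CondC z

    conditions⇒good : Conditions → Good
    conditions⇒good ((_ , feas) , ca , cb , cc) = record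
      { φ-zero = λ t t<q → proj₁ (consecutive t t<q)
      ; δ-full = λ t t<q → proj₂ (consecutive t t<q)
      ; condA  = subst₂ (λ u v → LG u + LG v ≡ endLevel) (Z-at first toℕ-first) (Z-at last toℕ-last)
          (to (endLevel⇔ SA.κ-cases SB.κ-cases _)
            ( (λ e → proj₁ (ca first last toℕ-first toℕ-last) (trans nWG≡ e))
            , (λ le → proj₂ (ca first last toℕ-first toℕ-last) (≤-trans le (≤-reflexive (sym nWG≡))))))
      ; condB  = boundB
      ; condC  = boundC
      }
      where
      adjacent : ∀ i j → toℕ j ≡ suc (toℕ i) → ∀ b → middle (toℕ i) ≡ b →
                 phiG (z i) (z j) ≡ 0 × deltaG (z i) (z j) + ⟦ b ⟧ ≡ ξ′
      adjacent i j e true  b = let φ0 , δ1 = proj₁ (feas i j e) (from (Middle⇔ (toℕ i)) b)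
                               in φ0 , trans (cong (_+ 1) δ1) (sym (ξ≡2 (middle⇒four (toℕ i) b)))
      adjacent i j e false b = let not-middle M = contradiction (trans (sym b) (to (Middle⇔ (toℕ i)) M)) λ ()
                                   φ0 , δξ = proj₂ (feas i j e) not-middle
                               in φ0 , trans (+-identityʳ _) (ℤₚ.+-injective (trans δξ ξ≡))
      consecutive : ∀ t → t < q → phiG (Z t) (Z (suc t)) ≡ 0 × deltaG (Z t) (Z (suc t)) + ⟦ middle t ⟧ ≡ ξ′
      consecutive t t<q =
        let i , ei = index t (<⇒≤ t<q)
            j , ej = index (suc t) t<q
        in subst₂ (λ u v → phiG u v ≡ 0 × deltaG u v + ⟦ middle t ⟧ ≡ ξ′) (Z-at i ei) (Z-at j ej)
             (adjacent i j (trans ej (cong suc (sym ei))) (middle t) (cong middle ei))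
      boundB : ∀ s → s ≤ q → 2 * ℓ s + 2 * ξ′ ≤ suc d + 2 * ⟦ nearMiddle s ⟧
      boundB s s≤q =
        let i , ei = index s s≤q
        in subst₂ (λ v t → 2 * LG v + 2 * ξ′ ≤ suc d + 2 * ⟦ nearMiddle t ⟧) (Z-at i ei) ei
             (to (B-bounds.intB⇔ (toℕ i) (LG (z i))) (cb i))
      boundC : ∀ a k → suc k + a ≤ q →
               ¬ (phiG (Z a) (Z (suc k + a)) ≡ 0 × deltaG (Z a) (Z (suc k + a)) ≡ ξ′) → CBound a k
      boundC a k le ¬f =
        let i , ei = index a (≤-trans (m≤n+m a (suc k)) le)
            j , ej = index (suc k + a) le
            e      = trans ej (cong (λ t → suc k + t) (sym ei))
        in subst (λ t → CBound t k) ei (to (CBound⇔ i j k e) (cc i j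
             (≤-trans (s≤s (m≤n+m (toℕ i) k)) (≤-reflexive (sym e)))
             (λ (φ0 , δξ) → ¬f (subst₂ (λ u v → phiG u v ≡ 0 × deltaG u v ≡ ξ′) (Z-at i ei) (Z-at j ej)
               (φ0 , ℤₚ.+-injective (trans δξ ξ≡))))))

    good⇒conditions : Bijective _≡_ _≡_ z → Good → Conditions
    good⇒conditions bij good = (bij , feas) , ca , cb , cc
      where
      open Good good
      feas : ∀ (a b : Fin p) → toℕ b ≡ suc (toℕ a) →
             (Middle (toℕ a) → (phiG (z a) (z b) ≡ 0) × (deltaG (z a) (z b) ≡ 1)) ×
             (¬ Middle (toℕ a) → Feasible (z a) (z b))
      feas a b e = subst₂ P (sym (Z-at a refl)) (sym (Z-at b e))
        ( (λ M → φ0 , one (to (Middle⇔ (toℕ a)) M))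
        , (λ ¬M → φ0 , trans (cong +_ (full (middle (toℕ a)) (λ b → ¬M (from (Middle⇔ (toℕ a)) b)) δξ)) (sym ξ≡)) )
        where
        P = λ u v → (Middle (toℕ a) → (phiG u v ≡ 0) × (deltaG u v ≡ 1)) × (¬ Middle (toℕ a) → Feasible u v)
        a<q = ≤-trans (≤-reflexive (sym e)) (toℕ≤q b)
        φ0 = φ-zero (toℕ a) a<q
        δξ = δ-full (toℕ a) a<q
        one : middle (toℕ a) ≡ true → deltaG (Z (toℕ a)) (Z (suc (toℕ a))) ≡ 1
        one b = +-cancelʳ-≡ 1 _ 1
          (trans (trans (cong (λ c → deltaG (Z (toℕ a)) (Z (suc (toℕ a))) + ⟦ c ⟧) (sym b)) δξ)
                 (ξ≡2 (middle⇒four (toℕ a) b)))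
        full : ∀ {x} b → ¬ (b ≡ true) → x + ⟦ b ⟧ ≡ ξ′ → x ≡ ξ′
        full false _ e = trans (sym (+-identityʳ _)) e
        full true  f _ = contradiction refl f
      ca : CondA z
      ca i j i0 jq = let h₁ , h₂ = from (endLevel⇔ SA.κ-cases SB.κ-cases _)
                                     (subst₂ (λ u v → LG u + LG v ≡ endLevel) (sym (Z-at i i0)) (sym (Z-at j jq)) condA)
                     in (λ e → h₁ (trans (sym nWG≡) e)) , (λ le → h₂ (≤-trans le (≤-reflexive nWG≡)))
      cb : CondB z
      cb s = from (B-bounds.intB⇔ (toℕ s) (LG (z s)))
        (subst (λ v → 2 * LG v + 2 * ξ′ ≤ suc d + 2 * ⟦ nearMiddle (toℕ s) ⟧) (sym (Z-at s refl))
          (condB (toℕ s) (toℕ≤q s)))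
      cc : CondC z
      cc a b a<b ¬f = from (CBound⇔ a b k e) (condC (toℕ a) k (≤-trans (≤-reflexive (sym e)) (toℕ≤q b))
        (λ (φ0 , δξ) → ¬f (subst₂ Feasible (sym (Z-at a refl)) (sym (Z-at b e)) (φ0 , trans (cong +_ δξ) (sym ξ≡)))))
        where
        k = toℕ b ∸ toℕ a ∸ 1
        e = gap a<b

  -- What `rnValue` subtracts from `optimum`; spans are compared after adding it.
  levelTotal : ℕ
  levelTotal = 2 * n * totLevel A + 2 * m * totLevel B + q * ξ′

  optimum : ℕ
  optimum = q * suc d + endLevel + ⟦ fourCentres ⟧

  rnValue-shift : rnValue ℤ.+ + levelTotal ≡ + optimum
  rnValue-shift = trans
    (cong₂ (λ a b → rnCases a b v₁ v₂ v₃ ℤ.+ + levelTotal) SA.nW≡ SB.nW≡)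
    (rnCases-value SA.κ-cases SB.κ-cases q d (2 * n * totLevel A) (2 * m * totLevel B))
    where
    X = + (2 * n * totLevel A)
    Y = + (2 * m * totLevel B)
    v₁ = ((+ (p ∸ 1)) ℤ.* (+ (d + 1)) ℤ.- X ℤ.- Y) ℤ.+ + 1
    v₂ = (+ (p ∸ 1)) ℤ.* (+ d) ℤ.- X ℤ.- Y
    v₃ = ((+ (p ∸ 1)) ℤ.* ((+ d) ℤ.- + 1) ℤ.- X ℤ.- Y) ℤ.+ + 1

  module _ (z : Fin p → Fin p) (bij : Bijective _≡_ _≡_ z) where

    open VertexOrder z
    open Order Z

    levels≡ : 2 * sumTo (suc q) ℓ + q * ξ′ ≡ levelTotal
    levels≡ = cong (_+ q * ξ′) (trans (cong (2 *_) (trans (sum-Z bij LG) sum-LG))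
      (arith n m (totLevel A) (totLevel B)))
      where
      arith : ∀ n m a b → 2 * (n * a + m * b) ≡ 2 * n * a + 2 * m * b
      arith = solve-∀

    module Labelling (good : Good) where

      open Sufficiency good

      position : Fin p → Fin p
      position v = proj₁ (proj₂ bij v)

      z-position : ∀ v → z (position v) ≡ v
      z-position v = proj₂ (proj₂ bij v) refl

      label : Fin p → ℕ
      label v = F (toℕ (position v))

      label-z : ∀ i → label (z i) ≡ F (toℕ i)
      label-z i = cong (F ∘ toℕ) (proj₁ bij (z-position (z i)))

      -- `Tight` uses `ξ` at every step. The unit added at the middle step equals `ξ - δ` there, so
      -- expressed by `δ` the recursion has no exception.
      label-recursive : RecLabel z label
      label-recursive = (λ i i0 → trans (label-z i) (cong F i0)) , next
        where
        next : ∀ (a b : Fin p) → toℕ b ≡ suc (toℕ a) →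
               + label (z b) ≡ ((((+ label (z a) ℤ.+ + (d + 1)) ℤ.- + LG (z a)) ℤ.- + LG (z b)) ℤ.- + deltaG (z a) (z b))
        next a b e = ⇒ℤ≡ (label-shift (label (z a)) d (LG (z a)) (LG (z b)) (deltaG (z a) (z b)))
          (subst₂ (λ u v → label (z b) + (LG u + LG v + deltaG u v) ≡ label (z a) + suc d)
            (sym (Z-at a refl)) (sym (Z-at b e))
            (subst₂ (λ x y → x + (ℓ t + ℓ (suc t) + deltaG (Z t) (Z (suc t))) ≡ y + suc d)
              (sym (trans (label-z b) (cong F e))) (sym (label-z a))
              (arith (F t) (F (suc t)) (ℓ t) (ℓ (suc t)) (deltaG (Z t) (Z (suc t))) ⟦ middle t ⟧ ξ′ d
                (tight t t<q) (Good.δ-full good t t<q))))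
          where
          t = toℕ a
          t<q = ≤-trans (≤-reflexive (sym e)) (toℕ≤q b)
          arith : ∀ f f′ l l′ y c x d → f′ + (l + l′ + x) ≡ f + (suc d + c) → y + c ≡ x → f′ + (l + l′ + y) ≡ f + suc d
          arith f f′ l l′ y c x d h₁ h₂ = ≡-by (cong₂ _+_ h₁ h₂)
            (solve (f ⨟ f′ ⨟ l ⨟ l′ ⨟ y ⨟ c ⨟ x ⨟ d ⨟ []))

      F-≤ : ∀ {a b} → a ≤ b → F a ≤ F b
      F-≤ {a} {b} a≤b = subst (λ t → F a ≤ F t) (m∸n+n≡m a≤b) (F-mono (b ∸ a) a)

      radio-pair : ∀ i j → toℕ i < toℕ j → d + 1 ≤ ∣ F (toℕ i) - F (toℕ j) ∣ + dist G (z i) (z j)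
      radio-pair i j i<j = subst₂ (λ x y → d + 1 ≤ x + y)
        (sym (m≤n⇒∣m-n∣≡n∸m F≤)) (sym (cong₂ (dist G) (Z-at i refl) (Z-at j e)))
        (arith (F a) (F (toℕ j)) (F (toℕ j) ∸ F a) (dist G (Z a) (Z (suc k + a))) d
          (m+[n∸m]≡n F≤) (subst (λ t → F a + suc d ≤ F t + dist G (Z a) (Z (suc k + a))) (sym e)
            (radio a k (≤-trans (≤-reflexive (sym e)) (toℕ≤q j)))))
        where
        a = toℕ i
        k = toℕ j ∸ toℕ i ∸ 1
        e = gap i<j
        F≤ : F a ≤ F (toℕ j)
        F≤ = F-≤ (<⇒≤ i<j)
        arith : ∀ f f′ g D d → f + g ≡ f′ → f + suc d ≤ f′ + D → d + 1 ≤ g + D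
        arith f f′ g D d h₁ h₂ = ≤-by 0 (+-mono-≤ (≤-reflexive (sym h₁)) h₂) (solve (f ⨟ f′ ⨟ g ⨟ D ⨟ d ⨟ []))

      label-radio : IsRadio G label
      label-radio u v u≢v = subst (λ D → D + 1 ≤ ∣ label u - label v ∣ + dist G u v) (sym diamG)
        (subst₂ (λ u′ v′ → d + 1 ≤ ∣ label u - label v ∣ + dist G u′ v′) (z-position u) (z-position v) pair-bound)
        where
        i = position u
        j = position v
        pair-bound : d + 1 ≤ ∣ F (toℕ i) - F (toℕ j) ∣ + dist G (z i) (z j)
        pair-bound = case <-cmp (toℕ i) (toℕ j) of λ
          { (tri< lt _ _) → radio-pair i j lt
          ; (tri≈ _ eq _) → contradiction
              (trans (sym (z-position u)) (trans (cong z (Finₚ.toℕ-injective eq)) (z-position v))) u≢v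
          ; (tri> _ _ gt) → subst₂ (λ x y → d + 1 ≤ x + y) (∣-∣-comm (F (toℕ j)) (F (toℕ i))) (dist-sym (z j) (z i))
              (radio-pair j i gt) }

      label-span : + spanL label ≡ rnValue
      label-span = ⇒ℤ≡ rnValue-shift (trans (cong (_+ levelTotal) span≡)
        (trans (cong (λ s → F q + s) (sym levels≡)) span-value))
        where
        span≡ : spanL label ≡ F q
        span≡ = trans
          (span-extremes label (z first) (z last)
            (λ v → ≤-trans (≤-reflexive (trans (label-z first) (cong F toℕ-first))) z≤n)
            (λ v → ≤-trans (F-≤ (toℕ≤q (position v))) (≤-reflexive (sym (trans (label-z last) (cong F toℕ-last))))))
          (cong₂ _∸_ (trans (label-z last) (cong F toℕ-last)) (trans (label-z first) (cong F toℕ-first)))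

  module _ (f : Fin p → ℕ) (radio : IsRadio G f) where

    -- No distance exceeds the diameter, so equal labels on distinct vertices would violate the
    -- radio inequality; hence sorting by labels is strict.
    radio-injective : ∀ {u v} → f u ≡ f v → u ≡ v
    radio-injective {u} {v} e = case u Fin.≟ v of λ
      { (yes u≡v) → u≡v
      ; (no u≢v)  → contradiction
          (≤-trans (≤-trans (≤-reflexive (+-comm 1 (diam G))) (radio u v u≢v))
            (+-mono-≤ (≤-reflexive (trans (cong (λ x → ∣ f u - x ∣) (sym e)) (∣n-n∣≡0 (f u)))) (dist≤diam G u v)))
          1+n≰n }

    open Sort f radio-injective
    open VertexOrder order hiding (Conditions)
    open Order Z

    sorted : ∀ {a b} → a < b → b ≤ q → f (Z a) < f (Z b)
    sorted {a} {b} a<b b≤q =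
      let i , ei = index a (≤-trans (<⇒≤ a<b) b≤q)
          j , ej = index b b≤q
      in subst₂ (λ u v → f u < f v) (Z-at i ei) (Z-at j ej) (order-increasing (subst₂ _<_ (sym ei) (sym ej) a<b))

    radio-sequence : RadioSeq (f ∘ Z)
    radio-sequence a k le = arith (f (Z a)) (f (Z b)) (f (Z b) ∸ f (Z a)) (dist G (Z a) (Z b)) d
      (m+[n∸m]≡n (<⇒≤ a<b)) (subst₂ (λ x y → x + 1 ≤ y + dist G (Z a) (Z b)) diamG
        (m≤n⇒∣m-n∣≡n∸m (<⇒≤ a<b)) (radio (Z a) (Z b) (λ e → <⇒≢ a<b (cong f e))))
      where
      b = suc k + a
      a<b : f (Z a) < f (Z b)
      a<b = sorted (s≤s (m≤n+m a k)) le
      arith : ∀ f f′ g D d → f + g ≡ f′ → d + 1 ≤ g + D → f + suc d ≤ f′ + D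
      arith f f′ g D d h₁ h₂ = ≤-by 0 (+-mono-≤ (≤-reflexive h₁) h₂) (solve (f ⨟ f′ ⨟ g ⨟ D ⨟ d ⨟ []))

    0<q : 0 < q
    0<q = ≤-<-trans z≤n h<q

    open LowerBound
      (ends≥ (Z 0) (Z q) (λ e → <⇒≢ (sorted 0<q ≤-refl) (cong f e)))
      (λ four → trans (sum-Z order-bijective (λ v → ⟦ parity v ⟧))
        (trans (parity-balanced four) (sym (sum-Z order-bijective (λ v → ⟦ not (parity v) ⟧)))))
      (f ∘ Z) radio-sequence

    extreme : ∀ v → f (Z 0) ≤ f v × f v ≤ f (Z q)
    extreme v =
      let i , onto = proj₂ order-bijective v
      in subst (λ u → f (Z 0) ≤ f u × f u ≤ f (Z q)) (trans (sym (Z-toℕ i)) (onto refl))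
           (monotone z≤n (toℕ≤q i) , monotone (toℕ≤q i) ≤-refl)
      where
      monotone : ∀ {a b} → a ≤ b → b ≤ q → f (Z a) ≤ f (Z b)
      monotone a≤b b≤q = case m≤n⇒m<n∨m≡n a≤b of λ
        { (inj₁ a<b)  → <⇒≤ (sorted a<b b≤q)
        ; (inj₂ refl) → ≤-refl }

    span≡ : f (Z 0) + spanL f ≡ f (Z q)
    span≡ = trans (cong (λ s → f (Z 0) + s) (span-extremes f (Z 0) (Z q) (proj₁ ∘ extreme) (proj₂ ∘ extreme)))
      (m+[n∸m]≡n (proj₂ (extreme (Z 0))))

    -- The least label of an arbitrary radio labelling need not be zero, so it is carried along on
    -- the left.
    span-total : f (Z 0) + (spanL f + levelTotal) ≡ f (Z q) + (2 * sumTo (suc q) ℓ + q * ξ′)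
    span-total = trans (sym (+-assoc (f (Z 0)) (spanL f) levelTotal))
      (cong₂ _+_ span≡ (sym (levels≡ order order-bijective)))

    span-lower-bound : rnValue ℤ.≤ + spanL f
    span-lower-bound = ⇒ℤ≥ rnValue-shift
      (+-cancelˡ-≤ (f (Z 0)) optimum (spanL f + levelTotal) (≤-trans lower-bound (≤-reflexive (sym span-total))))

    optimal-ordering : + spanL f ≡ rnValue → Σ (Fin p → Fin p) VertexOrder.Conditions
    optimal-ordering e = order , good⇒conditions order-bijective (Equality.good
      (trans (sym span-total) (cong (λ s → f (Z 0) + s) (ℤ≡⇒ rnValue-shift e))))

  module _ (z : Fin p → Fin p) (conditions : VertexOrder.Conditions z) where

    private
      module L = Labelling z (proj₁ (proj₁ conditions)) (VertexOrder.conditions⇒good z conditions)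

    optimal-labelling : Σ (Fin p → ℕ) (λ f → RecLabel z f × IsRadio G f × + spanL f ≡ rnValue)
    optimal-labelling = L.label , L.label-recursive , L.label-radio , L.label-span

theorem3p4 : (m n : ℕ) (T₁ : Adj m) (T₂ : Adj n) →
    IsTree T₁ → IsTree T₂ → 2 ≤ diam T₁ → 2 ≤ diam T₂ →
    (IsRn (Prod.G T₁ T₂) (Prod.rnValue T₁ T₂)
    ⇔ Σ (Fin (Prod.p T₁ T₂) → Fin (Prod.p T₁ T₂)) (λ z →
    Prod.FeasibleOrdering T₁ T₂ z × Prod.CondA T₁ T₂ z
    × Prod.CondB T₁ T₂ z × Prod.CondC T₁ T₂ z))
    × ((z : Fin (Prod.p T₁ T₂) → Fin (Prod.p T₁ T₂)) →
    Prod.FeasibleOrdering T₁ T₂ z → Prod.CondA T₁ T₂ z →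
    Prod.CondB T₁ T₂ z → Prod.CondC T₁ T₂ z →
    Σ (Fin (Prod.p T₁ T₂) → ℕ) (λ f →
    Prod.RecLabel T₁ T₂ z f × IsRadio (Prod.G T₁ T₂) f
    × IsRn (Prod.G T₁ T₂) (+ spanL f)))
theorem3p4 m n T₁ T₂ tree₁ tree₂ 2≤d₁ 2≤d₂ =
  mk⇔ (λ ((f , radio , span) , _) → optimal-ordering f radio span)
      (λ (z , conditions) → let f , _ , radio , span = optimal-labelling z conditions
                            in (f , radio , span) , span-lower-bound) ,
  λ z feasible a b c →
    let f , rec , radio , span = optimal-labelling z (feasible , a , b , c)
    in f , rec , radio , (f , radio , refl) ,
       λ g g-radio → subst (ℤ._≤ + spanL g) (sym span) (span-lower-bound g g-radio)
  where open RadioNumber T₁ T₂ tree₁ tree₂ 2≤d₁ 2≤d₂
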